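{- When $\mathrm{M}$ has no loops and no coloops, we have \[ \mathrm{csm}_k(\mathrm{M})=(-1)^{r-k} \pi_{*} (\delta^{n-k-1} \cap 1_{\mathrm{M},\mathrm{M}^\perp} ) \ \ \text{for $0 \le k \le r$}, \] where $1_{\mathrm{M},\mathrm{M}^\perp}$ is the top-dimensional constant Minkowski weight $1$ on the conormal fan of $\mathrm{M}$.
   Context: Let $\mathrm{M}$ be a matroid of rank $r+1$ on a finite set $E$ with $|E|=n+1$, $n\ge 1$, and let $\mathrm{M}^\perp$ be its dual matroid. Let $\mathrm{N}_E=\mathbb{R}^E/\mathbb{R}\mathbf{e}_E$ with $\mathbf{e}_S=\sum_{i\in S}\mathbf{e}_i$, and $\mathrm{N}_{E,E}=\mathrm{N}_E\oplus\mathrm{N}_E$, where $\mathbf{f}_S$ denotes the analogous vector in the second summand. The tropical linear space of $\mathrm{M}$ is $\mathrm{trop}(\mathrm{M})=\{z\in\mathrm{N}_E : \min_{i\in C} z_i \text{ is achieved at least twice for every circuit } C\}$. The Bergman fan $\Sigma_{\mathrm{M}}$ is the unimodular fan in $\mathrm{N}_E$ with cones $\sigma_{\mathscr F}=\mathrm{cone}\{\mathbf{e}_F\}_{F\in\mathscr F}$ for flags $\mathscr F$ of nonempty proper flats of $\mathrm{M}$ (its support is $\mathrm{trop}(\mathrm{M})$). A biflat of $\mathrm{M}$ is a pair $F|G$ with $F$ a flat of $\mathrm{M}$ and $G$ a flat of $\mathrm{M}^\perp$, both nonempty, not both equal to $E$, with $F\cup G=E$; two biflats $F|G$, $F'|G'$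 are comparable if ($F\subseteq F'$ and $G\supseteq G'$) or the reverse; a flag of biflats is a set of pairwise comparable biflats such that the union of the sets $F\cap G$ over its members is not $E$. The conormal fan $\Sigma_{\mathrm{M},\mathrm{M}^\perp}$ (for $\mathrm{M}$ loopless and coloopless) is the unimodular $(n-1)$-dimensional fan in $\mathrm{N}_{E,E}$ with cones $\mathrm{cone}\{\mathbf{e}_F+\mathbf{f}_G\}_{F|G\in\mathscr F|\mathscr G}$ for flags of biflats $\mathscr F|\mathscr G$; its support is $\mathrm{trop}(\mathrm{M})\times\mathrm{trop}(\mathrm{M}^\perp)$. The functions $\delta_j(z,w)=\max_{i\in E}(z_j+w_j-z_i-w_i)$ are piecewise linear on it, all congruent modulo linear functions, and $\delta$ denotes their common class in the Chow ring of the conormal fan. The projection $\pi(z,w)=z$ is a morphism of fans $\Sigma_{\mathrm{M},\mathrm{M}^\perp}\to\Sigma_{\mathrm{M}}$, and $\pi_*$ is the induced pushforward on Minkowski weights (dual to pullback on Chow rings); $\cap$ is the cap product of Chow classes with Minkowski weights. The $k$-th Chern–Schwartz–MacPherson cycle $\mathrm{csm}_k(\mathrm{M})$ is the $k$-dimensional Minkowski weight on $\Sigma_{\mathrm{M}}$ whose value on the cone $\sigma_{\mathscr F}$ of a flag $\mathscr F=(F_1\subsetneq\cdots\subsetneq F_k)$ of nonempty proper flats (with $F_0=\varnothing$, $F_{k+1}=E$) is $(-1)^{r-k}\prod_{i=0}^{k}\beta_{\mathrm{M}|F_{i+1}/F_i}$, where $\beta$ denotes Crapo's beta invariant ($\beta_{\mathrm{N}}=(-1)^{\mathrm{rk}(\mathrm{N})-1}\overline{\chi}_{\mathrm{N}}(1)$,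 $\overline\chi$ the reduced characteristic polynomial). -}

module Defs where

open import Data.Nat as ℕ using (ℕ; zero; suc; _≤_; _<_; _∸_; _≡ᵇ_)
open import Data.Integer as ℤ using (ℤ; +_; -[1+_]; _⊔_; _^_)
  renaming (_+_ to _+ℤ_; _*_ to _*ℤ_; _-_ to _-ℤ_)
open import Data.Fin using (Fin)
open import Data.Fin.Subset using (Subset; _∈_; _∉_; _⊆_; _∪_; _∩_; ∁; ⁅_⁆; ⊥; ⊤; ∣_∣)
open import Data.Fin.Subset.Properties using (_⊆?_)
open import Data.Vec using (Vec; []; _∷_)
import Data.Vec as Vec
open import Data.Bool using (Bool; true; false; if_then_else_)
open import Data.List using (List; []; _∷_; map; foldr; concatMap; filter; length; allFin; upTo; _++_)
import Data.List as List
open import Data.List.Relation.Unary.All using (All)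
open import Data.List.Relation.Unary.AllPairs using (AllPairs)
open import Data.List.Relation.Unary.Linked using (Linked)
open import Data.Product using (Σ; ∃; _×_; _,_; proj₁; proj₂)
open import Data.Sum using (_⊎_)
open import Relation.Nullary using (¬_)
open import Relation.Binary.PropositionalEquality using (_≡_; _≢_)

record Matroid (m : ℕ) : Set where
  field
    rk        : Subset m → ℕ
    rk-bound  : ∀ S → rk S ≤ ∣ S ∣
    rk-mono   : ∀ {S T} → S ⊆ T → rk S ≤ rk T
    rk-submod : ∀ S T → rk (S ∪ T) ℕ.+ rk (S ∩ T) ≤ rk S ℕ.+ rk T

open Matroid public

dualRk : ∀ {m} → Matroid m → Subset m → ℕ
dualRk M S = (∣ S ∣ ℕ.+ rk M (∁ S)) ∸ rk M ⊤

IsFlatFor : ∀ {m} → (Subset m → ℕ) → Subset m → Set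
IsFlatFor f F = ∀ i → i ∉ F → f F < f (F ∪ ⁅ i ⁆)

Flat : ∀ {m} → Matroid m → Subset m → Set
Flat M = IsFlatFor (rk M)

CoFlat : ∀ {m} → Matroid m → Subset m → Set
CoFlat M = IsFlatFor (dualRk M)

Loopless : ∀ {m} → Matroid m → Set
Loopless M = ∀ i → ¬ (rk M ⁅ i ⁆ ≡ 0)

Coloopless : ∀ {m} → Matroid m → Set
Coloopless M = ∀ i → ¬ (dualRk M ⁅ i ⁆ ≡ 0)

NonEmpty : ∀ {m} → Subset m → Set
NonEmpty S = ∃ λ i → i ∈ S

BF : ℕ → Set
BF m = Subset m × Subset m

Biflat : ∀ {m} → Matroid m → BF m → Set
Biflat M (F , G) =
  Flat M F × CoFlat M G × NonEmpty F × NonEmpty G ×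
  ¬ (F ≡ ⊤ × G ≡ ⊤) × (F ∪ G ≡ ⊤)

Comparable : ∀ {m} → BF m → BF m → Set
Comparable (F , G) (F' , G') = (F ⊆ F' × G' ⊆ G) ⊎ (F' ⊆ F × G ⊆ G')

unionFG : ∀ {m} → List (BF m) → Subset m
unionFG = foldr (λ ρ acc → (proj₁ ρ ∩ proj₂ ρ) ∪ acc) ⊥

-- a flag of biflats, listed without repetition (a cone is the set of its members)
IsBiflag : ∀ {m} → Matroid m → List (BF m) → Set
IsBiflag M σ =
  All (Biflat M) σ × AllPairs (λ x y → x ≢ y × Comparable x y) σ × ¬ (unionFG σ ≡ ⊤)

sumℤ : List ℤ → ℤ
sumℤ = foldr _+ℤ_ (+ 0)

prodℤ : List ℤ → ℤ
prodℤ = foldr _*ℤ_ (+ 1)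

sgn : ℕ → ℤ
sgn k = -[1+ 0 ] ^ k

ind : ∀ {m} → Subset m → Fin m → ℤ
ind S i = if Vec.lookup S i then + 1 else + 0

allSubsets : (m : ℕ) → List (Subset m)
allSubsets zero    = [] ∷ []
allSubsets (suc m) = map (true ∷_) (allSubsets m) ++ map (false ∷_) (allSubsets m)

allPairs : (m : ℕ) → List (BF m)
allPairs m = concatMap (λ F → map (F ,_) (allSubsets m)) (allSubsets m)

-- The piecewise linear function δ_j(z,w) = max_i (z_j + w_j - z_i - w_i)
-- on N_{E,E}, evaluated at integer representatives (well defined mod e_E, f_E).

δfun : ∀ {m} → Fin m → (Fin m → ℤ) → (Fin m → ℤ) → ℤ
δfun {m} j z w =
  foldr (λ i acc → acc ⊔ ((z j +ℤ w j) -ℤ (z i +ℤ w i)))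
        ((z j +ℤ w j) -ℤ (z j +ℤ w j))     -- the i = j term
        (allFin m)

-- its value at the ray generator e_F + f_G of a biflat F|G
δray : ∀ {m} → Fin m → BF m → ℤ
δray j (F , G) = δfun j (ind F) (ind G)

-- Minkowski weights on the conormal fan: integer functions on cones,
-- cones being given as lists of biflats (flags).

Weight : ℕ → Set
Weight m = List (BF m) → ℤ

IsTop : ∀ {m} → Matroid m → ℕ → Weight m → Set
IsTop M n c = ∀ σ →
  ((IsBiflag M σ × length σ ≡ n ∸ 1) → c σ ≡ + 1) ×
  (¬ (IsBiflag M σ × length σ ≡ n ∸ 1) → c σ ≡ + 0)

-- c' = φ ∩ c for c a d-dimensional Minkowski weight on the (unimodular)
-- conormal fan and φ the piecewise linear function with ray values φ ρ
-- (linear on each cone):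
--   (φ ∩ c)(τ) = Σ_{σ = τ ∪ ρ} φ(u_ρ) c(σ) - φ(Σ_{σ = τ ∪ ρ} c(σ) u_ρ),
-- where Σ c(σ) u_ρ = Σ_t a_t u_t lies in the span of τ (modulo e_E, f_E)
-- and φ is evaluated there by linearity on τ.
IsCap : ∀ {m} → Matroid m → (BF m → ℤ) → ℕ → Weight m → Weight m → Set
IsCap {m} M φ d c c' = ∀ τ →
  ((IsBiflag M τ × length τ ≡ d ∸ 1) →
     Σ (Fin (length τ) → ℤ) λ a → Σ ℤ λ λ₁ → Σ ℤ λ λ₂ →
       (∀ i → sumℤ (map (λ ρ → c (ρ ∷ τ) *ℤ ind (proj₁ ρ) i) (allPairs m))
                -ℤ sumℤ (map (λ t → a t *ℤ ind (proj₁ (List.lookup τ t)) i) (allFin (length τ)))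
              ≡ λ₁) ×
       (∀ i → sumℤ (map (λ ρ → c (ρ ∷ τ) *ℤ ind (proj₂ ρ) i) (allPairs m))
                -ℤ sumℤ (map (λ t → a t *ℤ ind (proj₂ (List.lookup τ t)) i) (allFin (length τ)))
              ≡ λ₂) ×
       (c' τ ≡ sumℤ (map (λ ρ → c (ρ ∷ τ) *ℤ φ ρ) (allPairs m))
               -ℤ sumℤ (map (λ t → a t *ℤ φ (List.lookup τ t)) (allFin (length τ))))) ×
  (¬ (IsBiflag M τ × length τ ≡ d ∸ 1) → c' τ ≡ + 0)

PowCap : ∀ {m} → Matroid m → (BF m → ℤ) → ℕ → ℕ → Weight m → Weight m → Set
PowCap M φ zero    d c c' = ∀ σ → c' σ ≡ c σ
PowCap {m} M φ (suc p) d c c' =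
  Σ (Weight m) λ c₁ → PowCap M φ p d c c₁ × IsCap M φ (d ∸ p) c₁ c'

-- Pushforward along π(z,w) = z to a cone σ_𝓕 of Σ_M (𝓕 = F₁ ⊊ ... ⊊ F_k).
-- The k-cones of the conormal fan mapped by π (injectively, unimodularly,
-- lattice index 1) onto σ_𝓕 are exactly the flags (F₁|G₁,...,F_k|G_k);
-- all other k-cones have lower-dimensional image or image a different cone.

lifts : ∀ {m} → List (Subset m) → List (List (BF m))
lifts []       = [] ∷ []
lifts {m} (F ∷ Fs) = concatMap (λ G → map ((F , G) ∷_) (lifts Fs)) (allSubsets m)

pushforward : ∀ {m} → Weight m → List (Subset m) → ℤ
pushforward c 𝓕 = sumℤ (map c (lifts 𝓕))

IsFlagOfFlats : ∀ {m} → Matroid m → List (Subset m) → Set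
IsFlagOfFlats M 𝓕 =
  All (λ F → Flat M F × NonEmpty F × F ≢ ⊤) 𝓕 × Linked (λ A B → A ⊆ B × A ≢ B) 𝓕

module _ {m : ℕ} (M : Matroid m) (F F' : Subset m) where
  minorGround : Subset m
  minorGround = F' ∩ ∁ F

  minorRk : Subset m → ℕ
  minorRk X = rk M (X ∪ F) ∸ rk M F

  minorRank : ℕ
  minorRank = rk M F' ∸ rk M F

  minorSubsets : List (Subset m)
  minorSubsets = filter (_⊆? minorGround) (allSubsets m)

  chiCoeff : ℕ → ℤ
  chiCoeff e = sumℤ (map (λ X → if (minorRank ∸ minorRk X) ≡ᵇ e then sgn ∣ X ∣ else + 0)
                         minorSubsets)

  chi : List ℤ
  chi = map chiCoeff (upTo (suc minorRank))

  -- ascending coefficients of the quotient χ(t)/(t-1): q_i = Σ_{j>i} a_j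
  -- (exact division since χ(1) = 0 for a nonempty ground set)
  tailSums : List ℤ → List ℤ
  tailSums []       = []
  tailSums (a ∷ as) = sumℤ as ∷ tailSums as

  reducedChiAt1 : ℤ
  reducedChiAt1 = sumℤ (tailSums chi)

  beta : ℤ
  beta = sgn (minorRank ∸ 1) *ℤ reducedChiAt1

prodBeta : ∀ {m} → Matroid m → List (Subset m) → ℤ
prodBeta M (A ∷ B ∷ rest) = beta M A B *ℤ prodBeta M (B ∷ rest)
prodBeta M _              = + 1

-- value of csm_k(M) on the cone σ_𝓕, 𝓕 = (F₁ ⊊ ... ⊊ F_k), rk M = r + 1
csm : ∀ {m} → Matroid m → ℕ → ℕ → List (Subset m) → ℤ
csm M r k 𝓕 = sgn (r ∸ k) *ℤ prodBeta M (⊥ ∷ 𝓕 ++ ⊤ ∷ [])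

{-# OPTIONS --safe #-}
-- On biflats δ_j takes the value ind F j + ind G j - 1, so changing j changes δ_j by a function that is
-- linear on N_{E,E}. Hence (δ ∩ c)(τ) is the sum of c(ρ τ) over the biflats ρ = F|G with e ∈ F ∩ G, for any
-- fixed e outside the union of the F ∩ G of the members of τ, and the iterated caps can be computed by
-- inserting biflats one at a time into a chain from ∅|E to E|∅.
-- A step from F|G to F′|G′ has size rk F′ - rk F + rk* G - rk* G′; the sizes add up to |E|. Put
-- D = E - (F ∪ G′). The weight of a chain vanishes unless every step either has D = ∅ and size 1, or D spans
-- F′/F in M and G/G′ in the dual, which forces size ≤ |D|. If the size equals |D| in all steps of the second
-- kind, only two insertions containing a given e ∈ D survive, one contracting e and one deleting it, so the
-- weight is the product of the beta invariants of M|(F ∪ D)/F by deletion-contraction.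
-- Over a flag of flats the nonvanishing condition leaves the single lift with G_i the dual closure of E - F_i,
-- for which F ∪ D = F′ or a coloop makes both sides vanish.
-- For existence, the constant weight 1 is balanced by inspecting the steps of a chain of codimension one, and
-- capping with δ preserves balancing.
module Submission where

open import Defs
open import Data.Nat using (ℕ; zero; suc; _+_; _∸_; _≤_; _<_; z≤n; s≤s)
import Data.Nat as ℕ
import Data.Nat.Properties as ℕₚ
open import Data.Integer using (ℤ; +_; -_) renaming (_+_ to _+ℤ_; _*_ to _*ℤ_; _-_ to _-ℤ_)
import Data.Integer as ℤ
import Data.Integer.Properties as ℤₚ
import Data.Integer.Tactic.RingSolver as ℤRing
import Data.Nat.Tactic.RingSolver as ℕRing
open import Data.Fin using (Fin; zero; suc)
import Data.Fin.Properties as Finₚ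
open import Data.Fin.Subset using (Subset; _∈_; _∉_; _⊆_; _∪_; _∩_; ∁; ⁅_⁆; ⊥; ⊤; ∣_∣; Nonempty)
import Data.Fin.Subset.Properties as Sₚ
open import Data.Vec using (Vec; []; _∷_; here; there)
import Data.Vec as Vec
import Data.Vec.Properties as Vecₚ
open import Data.Bool using (Bool; true; false; if_then_else_)
import Data.Bool as Bool
import Data.Bool.Properties as Boolₚ
open import Data.List using (List; []; _∷_; map; foldr; concatMap; filter; length; allFin; upTo; tabulate; _++_)
import Data.List as List
import Data.List.Properties as Listₚ
open import Data.List.Relation.Unary.All using (All; []; _∷_)
import Data.List.Relation.Unary.All as All
open import Data.List.Relation.Unary.Any using (here; there)
open import Data.List.Relation.Unary.AllPairs using (AllPairs; []; _∷_)
open import Data.List.Relation.Unary.Linked using (_∷_)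
import Data.List.Membership.Propositional as L∈
import Data.List.Membership.Propositional.Properties as L∈ₚ
open import Data.List.Relation.Binary.Permutation.Propositional using (_↭_; ↭-sym)
open _↭_ using (prep; swap) renaming (refl to ↭-refl; trans to ↭-trans)
import Data.List.Relation.Binary.Permutation.Propositional.Properties as ↭ₚ
open import Data.Product using (Σ; ∃; _×_; _,_; proj₁; proj₂)
import Data.Product.Properties as ×ₚ
open import Data.Sum using (_⊎_; inj₁; inj₂; [_,_]′)
open import Data.Unit using (tt)
open import Data.Empty using (⊥-elim)
open import Function using (_∘_; id)
open import Relation.Nullary using (¬_; Dec; yes; no; contradiction; does; ¬?; _×-dec_; _⊎-dec_; _→-dec_)
open import Relation.Nullary.Decidable using (dec-true; dec-false; decidable-stable)
open import Relation.Binary.PropositionalEquality using (_≡_; _≢_; refl; sym; trans; cong; cong₂; subst; subst₂; module ≡-Reasoning)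

-- Sums and subsets

-- The induction on the number of caps cannot stay with lifts of flags of flats, since evaluating a
-- cap at such a lift inserts further biflats. It runs over all chains whose steps are `Tight`, a
-- class that the two surviving insertions preserve unless the matching beta invariant is zero. The
-- equality size = |D| isolates these two: if both halves of a refined step had nonempty D, their
-- sizes would add up to at most |D| - 1. The survivors are cl(F + e)|G and F'|cl*(G' + e). Each
-- splits off a step of size 1, and the remaining step carries the contraction or the deletion of e
-- on D - e. The vanishing statement has to be proved separately and for all chains: if e has a
-- parallel or series partner in D, then D loses at least two elements while the size drops by one,
-- so the remaining step is not `Good`; on the other side the partner becomes a loop or a coloop and
-- kills the beta invariant. The induction ends at top cones, where one step has size 2 and beta
-- invariant 1.

lin≤ : ∀ {a b L R} k → L ≤ R → k + a + R ≡ b + L → a ≤ b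
-- Linear arithmetic by certificate: the caller adds its hypotheses up to `L ≤ R` and leaves one
-- identity to the ring solver.
lin≤ {a} {b} {L} {R} k L≤R eq = ℕₚ.≤-trans (ℕₚ.m≤n+m a k) (ℕₚ.+-cancelʳ-≤ L (k + a) b (begin
  k + a + L ≤⟨ ℕₚ.+-monoʳ-≤ (k + a) L≤R ⟩
  k + a + R ≡⟨ eq ⟩
  b + L     ∎))
  where open ℕₚ.≤-Reasoning

∑ : ∀ {A : Set} → List A → (A → ℤ) → ℤ
∑ L f = sumℤ (map f L)

module _ {A : Set} where

  ∑-cong : ∀ (L : List A) {f g : A → ℤ} → (∀ x → f x ≡ g x) → ∑ L f ≡ ∑ L g
  ∑-cong []      h = refl
  ∑-cong (x ∷ L) h = cong₂ _+ℤ_ (h x) (∑-cong L h)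

  ∑-zero : ∀ (L : List A) {f : A → ℤ} → (∀ x → f x ≡ + 0) → ∑ L f ≡ + 0
  ∑-zero []      h = refl
  ∑-zero (x ∷ L) h = cong₂ _+ℤ_ (h x) (∑-zero L h)

  ∑-+ : ∀ (L : List A) (f g : A → ℤ) → ∑ L (λ x → f x +ℤ g x) ≡ ∑ L f +ℤ ∑ L g
  ∑-+ []      f g = refl
  ∑-+ (x ∷ L) f g = trans (cong (f x +ℤ g x +ℤ_) (∑-+ L f g)) (lem (f x) (g x) (∑ L f) (∑ L g))
    where
    lem : ∀ a b c d → a +ℤ b +ℤ (c +ℤ d) ≡ a +ℤ c +ℤ (b +ℤ d)
    lem = ℤRing.solve-∀

  ∑-*ˡ : ∀ (L : List A) k (f : A → ℤ) → ∑ L (λ x → k *ℤ f x) ≡ k *ℤ ∑ L f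
  ∑-*ˡ []      k f = sym (ℤₚ.*-zeroʳ k)
  ∑-*ˡ (x ∷ L) k f = trans (cong (k *ℤ f x +ℤ_) (∑-*ˡ L k f)) (sym (ℤₚ.*-distribˡ-+ k (f x) (∑ L f)))

  ∑-- : ∀ (L : List A) (f g : A → ℤ) → ∑ L (λ x → f x -ℤ g x) ≡ ∑ L f -ℤ ∑ L g
  ∑-- []      f g = refl
  ∑-- (x ∷ L) f g = trans (cong (f x -ℤ g x +ℤ_) (∑-- L f g)) (lem (f x) (g x) (∑ L f) (∑ L g))
    where
    lem : ∀ a b c d → a -ℤ b +ℤ (c -ℤ d) ≡ a +ℤ c -ℤ (b +ℤ d)
    lem = ℤRing.solve-∀

  ∑-++ : ∀ (L L' : List A) (f : A → ℤ) → ∑ (L ++ L') f ≡ ∑ L f +ℤ ∑ L' f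
  ∑-++ []      L' f = sym (ℤₚ.+-identityˡ _)
  ∑-++ (x ∷ L) L' f = trans (cong (f x +ℤ_) (∑-++ L L' f)) (sym (ℤₚ.+-assoc (f x) _ _))

  ∑-↭ : ∀ {L L' : List A} (f : A → ℤ) → L ↭ L' → ∑ L f ≡ ∑ L' f
  ∑-↭ f ↭-refl        = refl
  ∑-↭ f (prep x p)    = cong (f x +ℤ_) (∑-↭ f p)
  ∑-↭ {x ∷ y ∷ L} {_ ∷ _ ∷ L'} f (swap x y p) =
    trans (cong (λ s → f x +ℤ (f y +ℤ s)) (∑-↭ f p)) (lem (f x) (f y) (∑ L' f))
    where
    lem : ∀ a b c → a +ℤ (b +ℤ c) ≡ b +ℤ (a +ℤ c)
    lem = ℤRing.solve-∀
  ∑-↭ f (↭-trans p q) = trans (∑-↭ f p) (∑-↭ f q)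

  ∏ : List A → (A → ℤ) → ℤ
  ∏ L f = prodℤ (map f L)

  ∏-↭ : ∀ {L L' : List A} (f : A → ℤ) → L ↭ L' → ∏ L f ≡ ∏ L' f
  ∏-↭ f ↭-refl        = refl
  ∏-↭ f (prep x p)    = cong (f x *ℤ_) (∏-↭ f p)
  ∏-↭ {x ∷ y ∷ L} {_ ∷ _ ∷ L'} f (swap x y p) =
    trans (cong (λ s → f x *ℤ (f y *ℤ s)) (∏-↭ f p)) (lem (f x) (f y) (∏ L' f))
    where
    lem : ∀ a b c → a *ℤ (b *ℤ c) ≡ b *ℤ (a *ℤ c)
    lem = ℤRing.solve-∀
  ∏-↭ f (↭-trans p q) = trans (∏-↭ f p) (∏-↭ f q)

  ∏-one : ∀ {L : List A} {f : A → ℤ} → All (λ x → f x ≡ + 1) L → ∏ L f ≡ + 1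
  ∏-one []       = refl
  ∏-one (h ∷ hs) = cong₂ _*ℤ_ h (∏-one hs)

  ∑ℕ : List A → (A → ℕ) → ℕ
  ∑ℕ []      f = 0
  ∑ℕ (x ∷ L) f = f x + ∑ℕ L f

  ∑ℕ-↭ : ∀ {L L' : List A} (f : A → ℕ) → L ↭ L' → ∑ℕ L f ≡ ∑ℕ L' f
  ∑ℕ-↭ f ↭-refl        = refl
  ∑ℕ-↭ f (prep x p)    = cong (λ s → f x + s) (∑ℕ-↭ f p)
  ∑ℕ-↭ {x ∷ y ∷ L} {_ ∷ _ ∷ L'} f (swap x y p) =
    trans (cong (λ s → f x + (f y + s)) (∑ℕ-↭ f p)) (lem (f x) (f y) (∑ℕ L' f))
    where
    lem : ∀ a b c → a + (b + c) ≡ b + (a + c)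
    lem = ℕRing.solve-∀
  ∑ℕ-↭ f (↭-trans p q) = trans (∑ℕ-↭ f p) (∑ℕ-↭ f q)

  AllPairs-↭ : ∀ {R : A → A → Set} → (∀ {x y} → R x y → R y x) →
    ∀ {L L'} → L ↭ L' → AllPairs R L → AllPairs R L'
  AllPairs-↭ sy ↭-refl        ps                    = ps
  AllPairs-↭ sy (prep x p)    (h ∷ ps)              = ↭ₚ.All-resp-↭ p h ∷ AllPairs-↭ sy p ps
  AllPairs-↭ sy (swap x y p)  ((r ∷ h) ∷ (h' ∷ ps)) =
    (sy r ∷ ↭ₚ.All-resp-↭ p h') ∷ (↭ₚ.All-resp-↭ p h ∷ AllPairs-↭ sy p ps)
  AllPairs-↭ sy (↭-trans p q) ps                    = AllPairs-↭ sy q (AllPairs-↭ sy p ps)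

  extract : ∀ {x : A} {L} → x L∈.∈ L → ∃ λ L' → L ↭ x ∷ L'
  extract x∈L with L∈ₚ.∈-∃++ x∈L
  ... | xs , ys , refl = xs ++ ys , ↭ₚ.shift _ xs ys

∑-swap : ∀ {A B : Set} (L : List A) (L' : List B) (f : A → B → ℤ) →
  ∑ L (λ x → ∑ L' (f x)) ≡ ∑ L' (λ y → ∑ L (λ x → f x y))
∑-swap []      L' f = sym (∑-zero L' (λ _ → refl))
∑-swap (x ∷ L) L' f = trans (cong (∑ L' (f x) +ℤ_) (∑-swap L L' f))
                            (sym (∑-+ L' (f x) (λ y → ∑ L (λ x → f x y))))

∑-map : ∀ {A B : Set} (L : List A) (h : A → B) (f : B → ℤ) → ∑ (map h L) f ≡ ∑ L (f ∘ h)
∑-map L h f = cong sumℤ (sym (Listₚ.map-∘ L))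

∑-concatMap : ∀ {A B : Set} (L : List A) (h : A → List B) (f : B → ℤ) →
  ∑ (concatMap h L) f ≡ ∑ L (λ x → ∑ (h x) f)
∑-concatMap []      h f = refl
∑-concatMap (x ∷ L) h f = trans (∑-++ (h x) (concatMap h L) f) (cong (∑ (h x) f +ℤ_) (∑-concatMap L h f))

∑-allSubsets : ∀ {m} (S : Subset m) (f : Subset m → ℤ) → (∀ T → T ≢ S → f T ≡ + 0) →
  ∑ (allSubsets m) f ≡ f S
∑-allSubsets []          f h = ℤₚ.+-identityʳ (f [])
∑-allSubsets {suc m} (true ∷ S)  f h = begin
  ∑ (map (true ∷_) (allSubsets m) ++ map (false ∷_) (allSubsets m)) f
    ≡⟨ ∑-++ (map (true ∷_) (allSubsets m)) _ f ⟩
  ∑ (map (true ∷_) (allSubsets m)) f +ℤ ∑ (map (false ∷_) (allSubsets m)) f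
    ≡⟨ cong₂ _+ℤ_ (∑-map (allSubsets m) (true ∷_) f) (∑-map (allSubsets m) (false ∷_) f) ⟩
  ∑ (allSubsets m) (f ∘ (true ∷_)) +ℤ ∑ (allSubsets m) (f ∘ (false ∷_))
    ≡⟨ cong₂ _+ℤ_ (∑-allSubsets S _ (λ T ne → h _ (λ eq → ne (Vecₚ.∷-injectiveʳ eq))))
                  (∑-zero (allSubsets m) (λ T → h _ (λ ()))) ⟩
  f (true ∷ S) +ℤ + 0
    ≡⟨ ℤₚ.+-identityʳ _ ⟩
  f (true ∷ S) ∎
  where open ≡-Reasoning
∑-allSubsets {suc m} (false ∷ S) f h = begin
  ∑ (map (true ∷_) (allSubsets m) ++ map (false ∷_) (allSubsets m)) f
    ≡⟨ ∑-++ (map (true ∷_) (allSubsets m)) _ f ⟩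
  ∑ (map (true ∷_) (allSubsets m)) f +ℤ ∑ (map (false ∷_) (allSubsets m)) f
    ≡⟨ cong₂ _+ℤ_ (∑-map (allSubsets m) (true ∷_) f) (∑-map (allSubsets m) (false ∷_) f) ⟩
  ∑ (allSubsets m) (f ∘ (true ∷_)) +ℤ ∑ (allSubsets m) (f ∘ (false ∷_))
    ≡⟨ cong₂ _+ℤ_ (∑-zero (allSubsets m) (λ T → h _ (λ ())))
                  (∑-allSubsets S _ (λ T ne → h _ (λ eq → ne (Vecₚ.∷-injectiveʳ eq)))) ⟩
  + 0 +ℤ f (false ∷ S)
    ≡⟨ ℤₚ.+-identityˡ _ ⟩
  f (false ∷ S) ∎
  where open ≡-Reasoning

_≟ˢ_ : ∀ {m} (S T : Subset m) → Dec (S ≡ T)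
_≟ˢ_ = Vecₚ.≡-dec Boolₚ._≟_

_≟ᴮ_ : ∀ {m} (x y : BF m) → Dec (x ≡ y)
_≟ᴮ_ = ×ₚ.≡-dec _≟ˢ_ _≟ˢ_

∑-allPairs : ∀ {m} (ρ : BF m) (f : BF m → ℤ) → (∀ ρ' → ρ' ≢ ρ → f ρ' ≡ + 0) →
  ∑ (allPairs m) f ≡ f ρ
∑-allPairs {m} (F , G) f h = begin
  ∑ (allPairs m) f
    ≡⟨ ∑-concatMap (allSubsets m) _ f ⟩
  ∑ (allSubsets m) (λ F' → ∑ (map (F' ,_) (allSubsets m)) f)
    ≡⟨ ∑-cong (allSubsets m) (λ F' → ∑-map (allSubsets m) (F' ,_) f) ⟩
  ∑ (allSubsets m) (λ F' → ∑ (allSubsets m) (λ G' → f (F' , G')))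
    ≡⟨ ∑-allSubsets F _ (λ F' ne → ∑-zero (allSubsets m) (λ G' → h _ (ne ∘ cong proj₁))) ⟩
  ∑ (allSubsets m) (λ G' → f (F , G'))
    ≡⟨ ∑-allSubsets G _ (λ G' ne → h _ (ne ∘ cong proj₂)) ⟩
  f (F , G) ∎
  where open ≡-Reasoning

∑-allPairs₂ : ∀ {m} (ρ σ : BF m) (f : BF m → ℤ) → ρ ≢ σ →
  (∀ ρ' → ρ' ≢ ρ → ρ' ≢ σ → f ρ' ≡ + 0) → ∑ (allPairs m) f ≡ f ρ +ℤ f σ
∑-allPairs₂ {m} ρ σ f ρ≢σ h = begin
  ∑ (allPairs m) f                        ≡⟨ ∑-cong (allPairs m) split ⟩
  ∑ (allPairs m) (λ x → at x +ℤ off x)    ≡⟨ ∑-+ (allPairs m) at off ⟩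
  ∑ (allPairs m) at +ℤ ∑ (allPairs m) off ≡⟨ cong₂ _+ℤ_ (∑-allPairs ρ at at-0) (∑-allPairs σ off off-0) ⟩
  at ρ +ℤ off σ                           ≡⟨ cong₂ _+ℤ_ at-ρ off-σ ⟩
  f ρ +ℤ f σ                              ∎
  where
  open ≡-Reasoning
  at off : _ → ℤ
  at  x = if does (x ≟ᴮ ρ) then f x else + 0
  off x = if does (x ≟ᴮ ρ) then + 0 else f x
  split : ∀ x → f x ≡ at x +ℤ off x
  split x with does (x ≟ᴮ ρ)
  ... | true  = sym (ℤₚ.+-identityʳ _)
  ... | false = sym (ℤₚ.+-identityˡ _)
  at-0 : ∀ x → x ≢ ρ → at x ≡ + 0
  at-0 x ne rewrite dec-false (x ≟ᴮ ρ) ne = refl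
  at-ρ : at ρ ≡ f ρ
  at-ρ rewrite dec-true (ρ ≟ᴮ ρ) refl = refl
  off-σ : off σ ≡ f σ
  off-σ rewrite dec-false (σ ≟ᴮ ρ) (ρ≢σ ∘ sym) = refl
  off-0 : ∀ x → x ≢ σ → off x ≡ + 0
  off-0 x ne with x ≟ᴮ ρ
  ... | yes _ = refl
  ... | no x≢ρ = h x x≢ρ ne

module _ {m : ℕ} where

  ∈ˡ : ∀ {i} {S : Subset m} T → i ∈ S → i ∈ S ∪ T
  ∈ˡ {S = S} T = λ p → Sₚ.x∈p∪q⁺ (inj₁ p)

  ∈ʳ : ∀ {i} (S : Subset m) {T} → i ∈ T → i ∈ S ∪ T
  ∈ʳ S p = Sₚ.x∈p∪q⁺ (inj₂ p)

  ∈-∪ : ∀ {i} (S T : Subset m) → i ∈ S ∪ T → i ∈ S ⊎ i ∈ T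
  ∈-∪ = Sₚ.x∈p∪q⁻

  ∉-∪ : ∀ {i} {S T : Subset m} → i ∉ S → i ∉ T → i ∉ S ∪ T
  ∉-∪ {S = S} {T} p q r = [ p , q ]′ (∈-∪ S T r)

  ∪-⊆ : ∀ {S T U : Subset m} → S ⊆ U → T ⊆ U → S ∪ T ⊆ U
  ∪-⊆ {S} {T} p q r = [ (λ z → p z) , (λ z → q z) ]′ (∈-∪ S T r)

  ∪-mono : ∀ {S T S' T' : Subset m} → S ⊆ S' → T ⊆ T' → S ∪ T ⊆ S' ∪ T'
  ∪-mono p q = ∪-⊆ (λ z → ∈ˡ _ (p z)) (λ z → ∈ʳ _ (q z))

  ∉⇒∈∁ : ∀ {i} {S : Subset m} → i ∉ S → i ∈ ∁ S
  ∉⇒∈∁ = Sₚ.x∉p⇒x∈∁p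

  ∈∁⇒∉ : ∀ {i} {S : Subset m} → i ∈ ∁ S → i ∉ S
  ∈∁⇒∉ = Sₚ.x∈∁p⇒x∉p

  ∁-anti : ∀ {S T : Subset m} → S ⊆ T → ∁ T ⊆ ∁ S
  ∁-anti p q = ∉⇒∈∁ (λ s → ∈∁⇒∉ q (p s))

  ⁅⁆-⊆ : ∀ {i} {S : Subset m} → i ∈ S → ⁅ i ⁆ ⊆ S
  ⁅⁆-⊆ {i} {S} p q = subst (_∈ S) (sym (Sₚ.x∈⁅y⁆⇒x≡y i q)) p

  ∁∁ : ∀ (S : Subset m) → ∁ (∁ S) ≡ S
  ∁∁ S = Sₚ.⊆-antisym (λ p → decidable-stable (_ Sₚ.∈? S) (λ q → ∈∁⇒∉ p (∉⇒∈∁ q)))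
                      (λ p → ∉⇒∈∁ (λ q → ∈∁⇒∉ q p))

  infixl 6 _∖_
  _∖_ : Subset m → Fin m → Subset m
  S ∖ e = S ∩ ∁ ⁅ e ⁆

  ∖⁺ : ∀ {i e} {S : Subset m} → i ∈ S → i ≢ e → i ∈ S ∖ e
  ∖⁺ {i} {e} p ne = Sₚ.x∈p∩q⁺ (p , ∉⇒∈∁ (Sₚ.x≢y⇒x∉⁅y⁆ ne))

  ∖-⊆ : ∀ {e} {S : Subset m} → S ∖ e ⊆ S
  ∖-⊆ {e} {S} p = proj₁ (Sₚ.x∈p∩q⁻ S (∁ ⁅ e ⁆) p)

  ∉-∖ : ∀ {e} {S : Subset m} → e ∉ S ∖ e
  ∉-∖ {e} {S} p = ∈∁⇒∉ (proj₂ (Sₚ.x∈p∩q⁻ S (∁ ⁅ e ⁆) p)) (Sₚ.x∈⁅x⁆ e)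

  ∖-≢ : ∀ {i e} {S : Subset m} → i ∈ S ∖ e → i ≢ e
  ∖-≢ p refl = ∉-∖ p

  ⊆-or-witness : ∀ (S T : Subset m) → S ⊆ T ⊎ ∃ λ e → e ∈ S × e ∉ T
  ⊆-or-witness S T with Finₚ.any? (λ e → e Sₚ.∈? S ×-dec ¬? (e Sₚ.∈? T))
  ... | yes w = inj₂ w
  ... | no ¬w = inj₁ (λ {i} p → decidable-stable (i Sₚ.∈? T) (λ q → ¬w (i , p , q)))

  ≡-or-witness : ∀ {S T : Subset m} → S ⊆ T → S ≡ T ⊎ ∃ λ e → e ∈ T × e ∉ S
  ≡-or-witness {S} {T} S⊆T with ⊆-or-witness T S
  ... | inj₁ T⊆S = inj₁ (Sₚ.⊆-antisym S⊆T T⊆S)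
  ... | inj₂ w   = inj₂ w

  ∉-witness : ∀ {S : Subset m} → S ≢ ⊤ → ∃ λ e → e ∉ S
  ∉-witness {S} ne with ≡-or-witness {S} {⊤} (λ _ → Sₚ.∈⊤)
  ... | inj₁ eq          = contradiction eq ne
  ... | inj₂ (e , _ , h) = e , h

  ∉⇒≢⊤ : ∀ {S : Subset m} {e} → e ∉ S → S ≢ ⊤
  ∉⇒≢⊤ e∉S refl = e∉S Sₚ.∈⊤

  ind-∈ : ∀ {S : Subset m} {i} → i ∈ S → ind S i ≡ + 1
  ind-∈ p rewrite Vecₚ.[]=⇒lookup p = refl

  ind-∉ : ∀ {S : Subset m} {i} → i ∉ S → ind S i ≡ + 0
  ind-∉ {S} {i} p with Vec.lookup S i in eq
  ... | true  = contradiction (Vecₚ.lookup⇒[]= i S eq) p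
  ... | false = refl

∣∪∣+∣∩∣ : ∀ {m} (S T : Subset m) → ∣ S ∪ T ∣ + ∣ S ∩ T ∣ ≡ ∣ S ∣ + ∣ T ∣
∣∪∣+∣∩∣ []          []          = refl
∣∪∣+∣∩∣ (true ∷ S)  (true ∷ T)  = cong suc (trans (ℕₚ.+-suc _ _) (trans (cong suc (∣∪∣+∣∩∣ S T)) (sym (ℕₚ.+-suc _ _))))
∣∪∣+∣∩∣ (true ∷ S)  (false ∷ T) = cong suc (∣∪∣+∣∩∣ S T)
∣∪∣+∣∩∣ (false ∷ S) (true ∷ T)  = trans (cong suc (∣∪∣+∣∩∣ S T)) (sym (ℕₚ.+-suc _ _))
∣∪∣+∣∩∣ (false ∷ S) (false ∷ T) = ∣∪∣+∣∩∣ S T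

module _ {m : ℕ} where

  ∅-unique : ∀ {S : Subset m} → (∀ i → i ∉ S) → S ≡ ⊥
  ∅-unique h = Sₚ.Empty-unique (λ { (i , p) → h i p })

  ∣∪∣-disjoint : ∀ (S T : Subset m) → (∀ i → i ∈ S → i ∉ T) → ∣ S ∪ T ∣ ≡ ∣ S ∣ + ∣ T ∣
  ∣∪∣-disjoint S T h = trans (sym (trans (cong (λ n → ∣ S ∪ T ∣ + n)
      (trans (cong ∣_∣ (∅-unique (λ i p → let (a , b) = Sₚ.x∈p∩q⁻ S T p in h i a b))) (Sₚ.∣⊥∣≡0 m)))
      (ℕₚ.+-identityʳ _))) (∣∪∣+∣∩∣ S T)

  ∣S∣+∣∁S∣ : ∀ (S : Subset m) → ∣ S ∣ + ∣ ∁ S ∣ ≡ m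
  ∣S∣+∣∁S∣ S = trans (sym (∣∪∣-disjoint S (∁ S) (λ i p q → ∈∁⇒∉ q p)))
                (trans (cong ∣_∣ (Sₚ.p∪∁p≡⊤ S)) (Sₚ.∣⊤∣≡n m))

  ∖-∪ : ∀ {S : Subset m} {e} → e ∈ S → (S ∖ e) ∪ ⁅ e ⁆ ≡ S
  ∖-∪ {S} {e} p = Sₚ.⊆-antisym (∪-⊆ ∖-⊆ (⁅⁆-⊆ p)) back
    where
    back : S ⊆ (S ∖ e) ∪ ⁅ e ⁆
    back {i} q with i Finₚ.≟ e
    ... | yes refl = ∈ʳ (S ∖ e) (Sₚ.x∈⁅x⁆ e)
    ... | no ne    = ∈ˡ _ (∖⁺ q ne)

  ∣∖∣ : ∀ {S : Subset m} {e} → e ∈ S → suc ∣ S ∖ e ∣ ≡ ∣ S ∣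
  ∣∖∣ {S} {e} p = begin
    suc ∣ S ∖ e ∣           ≡⟨ ℕₚ.+-comm 1 _ ⟩
    ∣ S ∖ e ∣ + 1           ≡⟨ cong (λ s → ∣ S ∖ e ∣ + s) (Sₚ.∣⁅x⁆∣≡1 e) ⟨
    ∣ S ∖ e ∣ + ∣ ⁅ e ⁆ ∣   ≡⟨ ∣∪∣-disjoint (S ∖ e) ⁅ e ⁆ (λ i q r → ∖-≢ q (Sₚ.x∈⁅y⁆⇒x≡y e r)) ⟨
    ∣ (S ∖ e) ∪ ⁅ e ⁆ ∣     ≡⟨ cong ∣_∣ (∖-∪ p) ⟩
    ∣ S ∣                   ∎
    where open ≡-Reasoning

  ∣∪⁅⁆∣ : ∀ {S : Subset m} {e} → e ∉ S → ∣ S ∪ ⁅ e ⁆ ∣ ≡ suc ∣ S ∣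
  ∣∪⁅⁆∣ {S} {e} p = trans (∣∪∣-disjoint S ⁅ e ⁆ (λ i q r → p (subst (_∈ S) (Sₚ.x∈⁅y⁆⇒x≡y e r) q)))
                     (trans (cong (λ s → ∣ S ∣ + s) (Sₚ.∣⁅x⁆∣≡1 e)) (ℕₚ.+-comm _ 1))

-- Closure and duality

module _ {m : ℕ} (N : Matroid m) where
  private
    r : Subset m → ℕ
    r = rk N

  rk-submod-⊆ : ∀ {A B C D} → C ⊆ A ∪ B → D ⊆ A → D ⊆ B → r C + r D ≤ r A + r B
  rk-submod-⊆ {A} {B} C⊆ D⊆A D⊆B =
    ℕₚ.≤-trans (ℕₚ.+-mono-≤ (rk-mono N C⊆) (rk-mono N (λ p → Sₚ.x∈p∩q⁺ (D⊆A p , D⊆B p))))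
               (rk-submod N A B)

  rk-⊥ : r ⊥ ≡ 0
  rk-⊥ = ℕₚ.n≤0⇒n≡0 (ℕₚ.≤-trans (rk-bound N ⊥) (ℕₚ.≤-reflexive (Sₚ.∣⊥∣≡0 m)))

  rk-∪⁅⁆ : ∀ S e → r (S ∪ ⁅ e ⁆) ≤ suc (r S)
  rk-∪⁅⁆ S e = begin
    r (S ∪ ⁅ e ⁆)            ≤⟨ ℕₚ.m≤m+n _ _ ⟩
    r (S ∪ ⁅ e ⁆) + r (S ∩ ⁅ e ⁆) ≤⟨ rk-submod N S ⁅ e ⁆ ⟩
    r S + r ⁅ e ⁆            ≤⟨ ℕₚ.+-monoʳ-≤ (r S) (ℕₚ.≤-trans (rk-bound N ⁅ e ⁆) (ℕₚ.≤-reflexive (Sₚ.∣⁅x⁆∣≡1 e))) ⟩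
    r S + 1                  ≡⟨ ℕₚ.+-comm (r S) 1 ⟩
    suc (r S)                ∎
    where open ℕₚ.≤-Reasoning

  -- Submodularity allows the elements of `T` to be added one at a time; `T` is traversed through
  -- its intersections with the element sets of the suffixes of `allFin m`.
  rk-absorb : ∀ {S T} → (∀ i → i ∈ T → r (S ∪ ⁅ i ⁆) ≤ r S) → r (S ∪ T) ≤ r S
  rk-absorb {S} {T} h = ℕₚ.≤-trans (rk-mono N (∪-mono id (λ {i} p → Sₚ.x∈p∩q⁺ (p , all-elems i)))) (go (allFin m))
    where
    elems : List (Fin m) → Subset m
    elems = foldr (λ i A → ⁅ i ⁆ ∪ A) ⊥
    elems-∈ : ∀ {i l} → i L∈.∈ l → i ∈ elems l
    elems-∈ {i} (here refl) = ∈ˡ _ (Sₚ.x∈⁅x⁆ i)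
    elems-∈     (there p)   = ∈ʳ _ (elems-∈ p)
    all-elems : ∀ i → i ∈ elems (allFin m)
    all-elems i = elems-∈ (L∈ₚ.∈-allFin i)
    go : ∀ l → r (S ∪ (T ∩ elems l)) ≤ r S
    go [] = rk-mono N (∪-⊆ id (λ p → ⊥-elim (Sₚ.∉⊥ (proj₂ (Sₚ.x∈p∩q⁻ T _ p)))))
    go (i ∷ l) with i Sₚ.∈? T
    ... | no i∉T = ℕₚ.≤-trans (rk-mono N (∪-mono id sub)) (go l)
      where
      sub : T ∩ elems (i ∷ l) ⊆ T ∩ elems l
      sub p with Sₚ.x∈p∩q⁻ T _ p
      ... | p₁ , p₂ with ∈-∪ ⁅ i ⁆ (elems l) p₂
      ... | inj₁ q = contradiction (subst (_∈ T) (Sₚ.x∈⁅y⁆⇒x≡y i q) p₁) i∉T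
      ... | inj₂ q = Sₚ.x∈p∩q⁺ (p₁ , q)
    ... | yes i∈T = ℕₚ.+-cancelʳ-≤ (r S) _ _ (ℕₚ.≤-trans
        (rk-submod-⊆ {S ∪ (T ∩ elems l)} {S ∪ ⁅ i ⁆} sub (∈ˡ _) (∈ˡ _))
        (ℕₚ.+-mono-≤ (go l) (h i i∈T)))
      where
      sub : S ∪ (T ∩ elems (i ∷ l)) ⊆ (S ∪ (T ∩ elems l)) ∪ (S ∪ ⁅ i ⁆)
      sub p with ∈-∪ S _ p
      ... | inj₁ q = ∈ˡ _ (∈ˡ _ q)
      ... | inj₂ q with Sₚ.x∈p∩q⁻ T _ q
      ... | q₁ , q₂ with ∈-∪ ⁅ i ⁆ (elems l) q₂
      ... | inj₁ s = ∈ʳ _ (∈ʳ S s)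
      ... | inj₂ s = ∈ˡ _ (∈ʳ S (Sₚ.x∈p∩q⁺ (q₁ , s)))

  cl : Subset m → Subset m
  cl S = Vec.tabulate (λ i → does (r (S ∪ ⁅ i ⁆) ℕₚ.≤? r S))

  ∈-cl⁺ : ∀ {S i} → r (S ∪ ⁅ i ⁆) ≤ r S → i ∈ cl S
  ∈-cl⁺ {S} {i} h = Vecₚ.lookup⇒[]= i (cl S)
    (trans (Vecₚ.lookup∘tabulate _ i) (dec-true (r (S ∪ ⁅ i ⁆) ℕₚ.≤? r S) h))

  ∈-cl⁻ : ∀ {S i} → i ∈ cl S → r (S ∪ ⁅ i ⁆) ≤ r S
  ∈-cl⁻ {S} {i} p = ℕₚ.≤ᵇ⇒≤ _ _ (subst Bool.T (trans (sym (Vecₚ.[]=⇒lookup p)) (Vecₚ.lookup∘tabulate _ i)) tt)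

  ⊆-cl : ∀ {S} → S ⊆ cl S
  ⊆-cl {S} p = ∈-cl⁺ (rk-mono N (∪-⊆ id (⁅⁆-⊆ p)))

  rk-cl : ∀ S → r (cl S) ≡ r S
  rk-cl S = ℕₚ.≤-antisym (ℕₚ.≤-trans (rk-mono N (∈ʳ S)) (rk-absorb (λ _ → ∈-cl⁻))) (rk-mono N ⊆-cl)

  flat-cl : ∀ S → Flat N (cl S)
  flat-cl S i i∉ = begin
    suc (r (cl S))         ≡⟨ cong suc (rk-cl S) ⟩
    suc (r S)              ≤⟨ ℕₚ.≰⇒> (i∉ ∘ ∈-cl⁺) ⟩
    r (S ∪ ⁅ i ⁆)          ≤⟨ rk-mono N (∪-mono ⊆-cl id) ⟩
    r (cl S ∪ ⁅ i ⁆)       ∎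
    where open ℕₚ.≤-Reasoning

  flat-⊤ : Flat N ⊤
  flat-⊤ i i∉ = contradiction Sₚ.∈⊤ i∉

  module _ {F : Subset m} (flat : Flat N F) where

    flat-< : ∀ {T e} → F ⊆ T → e ∈ T → e ∉ F → r F < r T
    flat-< F⊆T e∈T e∉F = ℕₚ.≤-trans (flat _ e∉F) (rk-mono N (∪-⊆ F⊆T (⁅⁆-⊆ e∈T)))

    flat-rk-≡ : ∀ {T} → F ⊆ T → r T ≤ r F → F ≡ T
    flat-rk-≡ F⊆T h with ≡-or-witness F⊆T
    ... | inj₁ eq             = eq
    ... | inj₂ (e , p , q)    = contradiction (flat-< F⊆T p q) (ℕₚ.≤⇒≯ h)

    -- Otherwise submodularity for `F` and `S ∪ ⁅ e ⁆` would bound the rank of `F ∪ ⁅ e ⁆` by that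
    -- of `F`.
    flat-absorb : ∀ {S e} → S ⊆ F → r (S ∪ ⁅ e ⁆) ≤ r S → e ∈ F
    flat-absorb {S} {e} S⊆F h = decidable-stable (e Sₚ.∈? F) λ e∉F →
      ℕₚ.<-irrefl refl (ℕₚ.<-≤-trans (flat e e∉F) (ℕₚ.+-cancelʳ-≤ (r S) _ _
        (ℕₚ.≤-trans (rk-submod-⊆ {F} {S ∪ ⁅ e ⁆} (∪-mono id (∈ʳ S)) S⊆F (∈ˡ _)) (ℕₚ.+-monoʳ-≤ (r F) h))))

    cl-⊆ : ∀ {S} → S ⊆ F → cl S ⊆ F
    cl-⊆ S⊆F p = flat-absorb S⊆F (∈-cl⁻ p)

    rk-cl-∪⁅⁆ : ∀ {e} → e ∉ F → r (cl (F ∪ ⁅ e ⁆)) ≡ suc (r F)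
    rk-cl-∪⁅⁆ {e} e∉F = trans (rk-cl _) (ℕₚ.≤-antisym (rk-∪⁅⁆ F e) (flat e e∉F))

  rk-cover : ∀ {S T e} → S ⊆ T → r (S ∪ ⁅ e ⁆) ≤ r S → r (T ∪ ⁅ e ⁆) ≤ r T
  rk-cover {S} {T} {e} S⊆T h = ℕₚ.+-cancelʳ-≤ (r S) _ _ (ℕₚ.≤-trans
    (rk-submod-⊆ {T} {S ∪ ⁅ e ⁆} (∪-mono id (∈ʳ S)) S⊆T (∈ˡ _)) (ℕₚ.+-monoʳ-≤ (r T) h))

-- The dual rank formula with the subtraction moved across. The relation is symmetric, which lets
-- later lemmas be applied with `M` and `N` exchanged.
IsDual : ∀ {m} → Matroid m → Matroid m → Set
IsDual {m} M N = ∀ S → rk N S + rk M ⊤ ≡ ∣ S ∣ + rk M (∁ S)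

module _ {m : ℕ} {M N : Matroid m} (dual : IsDual M N) where
  private
    r s : Subset m → ℕ
    r = rk M
    s = rk N

  ∁⊤ : ∁ ⊤ ≡ ⊥ {m}
  ∁⊤ = ∅-unique (λ i p → ∈∁⇒∉ p Sₚ.∈⊤)

  rk-⊤+rk-⊤ : s ⊤ + r ⊤ ≡ m
  rk-⊤+rk-⊤ = begin
    s ⊤ + r ⊤          ≡⟨ dual ⊤ ⟩
    ∣ ⊤ {m} ∣ + r (∁ ⊤) ≡⟨ cong₂ _+_ (Sₚ.∣⊤∣≡n m) (trans (cong r ∁⊤) (rk-⊥ M)) ⟩
    m + 0              ≡⟨ ℕₚ.+-identityʳ m ⟩
    m                  ∎
    where open ≡-Reasoning

  dual-sym : IsDual N M
  dual-sym S = ℕₚ.+-cancelʳ-≡ (r ⊤) _ _ (begin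
    r S + s ⊤ + r ⊤               ≡⟨ ℕₚ.+-assoc (r S) _ _ ⟩
    r S + (s ⊤ + r ⊤)             ≡⟨ cong (λ z → r S + z) rk-⊤+rk-⊤ ⟩
    r S + m                       ≡⟨ cong (λ z → r S + z) (sym (∣S∣+∣∁S∣ S)) ⟩
    r S + (∣ S ∣ + ∣ ∁ S ∣)       ≡⟨ lem (r S) (∣ S ∣) (∣ ∁ S ∣) ⟩
    ∣ S ∣ + (∣ ∁ S ∣ + r S)       ≡⟨ cong (λ z → ∣ S ∣ + (∣ ∁ S ∣ + r z)) (sym (∁∁ S)) ⟩
    ∣ S ∣ + (∣ ∁ S ∣ + r (∁ (∁ S))) ≡⟨ cong (λ z → ∣ S ∣ + z) (sym (dual (∁ S))) ⟩
    ∣ S ∣ + (s (∁ S) + r ⊤)       ≡⟨ sym (ℕₚ.+-assoc ∣ S ∣ _ _) ⟩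
    ∣ S ∣ + s (∁ S) + r ⊤         ∎)
    where
    open ≡-Reasoning
    lem : ∀ a b c → a + (b + c) ≡ b + (c + a)
    lem = ℕRing.solve-∀

  -- M/F restricted to D is a quotient of the dual of N/G restricted to D.
  rk-span-≤ : ∀ {F G D} → (∀ i → i ∈ D → i ∉ G) → (∀ i → i ∉ F → i ∉ G → i ∈ D) →
    r (F ∪ D) + s (G ∪ D) ≤ ∣ D ∣ + (r F + s G)
  rk-span-≤ {F} {G} {D} disj cov = ar (s (G ∪ D)) (s G) (r ⊤) (∣ G ∣) (∣ D ∣) (r (∁ (G ∪ D))) (r (∁ G)) (r (F ∪ D)) (r F)
    (trans (dual (G ∪ D)) (cong (_+ r (∁ (G ∪ D))) (∣∪∣-disjoint G D (λ i p q → disj i q p)))) (dual G)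
    (rk-submod-⊆ M {F} {∁ G} (∪-mono id (λ {i} p → ∉⇒∈∁ (disj i p)))
      (λ {i} p → decidable-stable (i Sₚ.∈? F)
         (λ i∉F → ∈∁⇒∉ p ([ ∈ˡ D , ∈ʳ G ]′ (pick i i∉F))))
      (∁-anti (∈ˡ D)))
    where
    pick : ∀ i → i ∉ F → i ∈ G ⊎ i ∈ D
    pick i i∉F with i Sₚ.∈? G
    ... | yes p = inj₁ p
    ... | no q  = inj₂ (cov i i∉F q)
    ar : ∀ a b t g d x y u v → a + t ≡ g + d + x → b + t ≡ g + y → u + x ≤ v + y → u + a ≤ d + (v + b)
    ar a b t g d x y u v e₁ e₂ h = lin≤ 0 (ℕₚ.+-mono-≤ h (ℕₚ.+-mono-≤ (ℕₚ.≤-reflexive e₁) (ℕₚ.≤-reflexive (sym e₂))))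
      (id₁ a b t g d x y u v)
      where
      id₁ : ∀ a b t g d x y u v → u + a + (v + y + (g + d + x + (b + t))) ≡ d + (v + b) + (u + x + (a + t + (g + y)))
      id₁ = ℕRing.solve-∀

  -- Orthogonality: an element e outside the closure of F is in the dual closure of E - F - e, hence
  -- of every set containing it.
  dual-absorb : ∀ {F e T} → r F < r (F ∪ ⁅ e ⁆) → e ∉ T → (∀ i → i ∉ F → i ≢ e → i ∈ T) →
    s (T ∪ ⁅ e ⁆) ≤ s T
  dual-absorb {F} {e} {T} lt e∉T cov = ar (s (T ∪ ⁅ e ⁆)) (s T) (r ⊤) (∣ T ∣) (r (∁ (T ∪ ⁅ e ⁆))) (r (∁ T)) (r (F ∪ ⁅ e ⁆)) (r F)
    (trans (dual _) (cong (_+ r (∁ (T ∪ ⁅ e ⁆))) (∣∪⁅⁆∣ e∉T))) (dual T) lt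
    (rk-submod-⊆ M {F} {∁ T} (∪-mono id (⁅⁆-⊆ (∉⇒∈∁ e∉T)))
      (λ {i} p → decidable-stable (i Sₚ.∈? F) (λ i∉F → ∈∁⇒∉ p (∈ˡ _ (cov i i∉F
         (λ { refl → ∈∁⇒∉ p (∈ʳ T (Sₚ.x∈⁅x⁆ e)) })))))
      (∁-anti (∈ˡ _)))
    where
    ar : ∀ a b t g x y u v → a + t ≡ suc g + x → b + t ≡ g + y → suc v ≤ u → u + x ≤ v + y → a ≤ b
    ar a b t g x y u v e₁ e₂ h₁ h₂ = lin≤ 0 (ℕₚ.+-mono-≤ (ℕₚ.+-mono-≤ h₁ h₂) (ℕₚ.+-mono-≤ (ℕₚ.≤-reflexive e₁) (ℕₚ.≤-reflexive (sym e₂))))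
      (id₁ a b t g x y u v)
      where
      id₁ : ∀ a b t g x y u v → a + (u + (v + y) + (suc g + x + (b + t))) ≡ b + (suc v + (u + x) + (a + t + (g + y)))
      id₁ = ℕRing.solve-∀

  -- Compare the dual rank formulas at E - F and E - F + e: the cardinality grows by one and the
  -- dual rank does not, so the rank of the complement must drop.
  dual-coloop : ∀ {F e} → e ∈ F → s (∁ F ∪ ⁅ e ⁆) ≤ s (∁ F) → r (F ∖ e) < r F
  dual-coloop {F} {e} e∈F h = ar (s (∁ F ∪ ⁅ e ⁆)) (s (∁ F)) (r ⊤) (∣ ∁ F ∣) (r (F ∖ e)) (r F)
    (trans (dual _) (cong₂ _+_ (∣∪⁅⁆∣ (λ p → ∈∁⇒∉ p e∈F)) (cong r eq)))
    (trans (dual _) (cong (λ z → ∣ ∁ F ∣ + r z) (∁∁ F))) h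
    where
    eq : ∁ (∁ F ∪ ⁅ e ⁆) ≡ F ∖ e
    eq = Sₚ.⊆-antisym
      (λ {i} p → ∖⁺ (decidable-stable (i Sₚ.∈? F) (λ q → ∈∁⇒∉ p (∈ˡ _ (∉⇒∈∁ q))))
                    (λ { refl → ∈∁⇒∉ p (∈ʳ (∁ F) (Sₚ.x∈⁅x⁆ e)) }))
      (λ {i} p → ∉⇒∈∁ (∉-∪ (λ q → ∈∁⇒∉ q (∖-⊆ p)) (λ q → ∖-≢ p (Sₚ.x∈⁅y⁆⇒x≡y e q))))
    ar : ∀ a b t g x y → a + t ≡ suc g + x → b + t ≡ g + y → a ≤ b → suc x ≤ y
    ar a b t g x y e₁ e₂ h = lin≤ 0 (ℕₚ.+-mono-≤ h (ℕₚ.+-mono-≤ (ℕₚ.≤-reflexive (sym e₁)) (ℕₚ.≤-reflexive e₂)))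
      (id₁ a b t g x y)
      where
      id₁ : ∀ a b t g x y → suc x + (b + (a + t + (g + y))) ≡ y + (a + (suc g + x + (b + t)))
      id₁ = ℕRing.solve-∀

-- The beta invariant

sgn-suc : ∀ k → sgn (suc k) ≡ - sgn k
sgn-suc k = ℤₚ.-1*i≡-i (sgn k)

-- Recursion on the bit vector instead of a filtered list, so that the sum can be split at an
-- element of `D`.
∑⊆ : ∀ {m} → Subset m → (Subset m → ℤ) → ℤ
∑⊆ []          f = f []
∑⊆ (true ∷ D)  f = ∑⊆ D (f ∘ (true ∷_)) +ℤ ∑⊆ D (f ∘ (false ∷_))
∑⊆ (false ∷ D) f = ∑⊆ D (f ∘ (false ∷_))

∑⊆-cong : ∀ {m} (D : Subset m) {f g : Subset m → ℤ} → (∀ X → X ⊆ D → f X ≡ g X) → ∑⊆ D f ≡ ∑⊆ D g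
∑⊆-cong []          h = h [] id
∑⊆-cong (true ∷ D)  h = cong₂ _+ℤ_ (∑⊆-cong D (λ X p → h _ (Sₚ.s⊆s p))) (∑⊆-cong D (λ X p → h _ (Sₚ.out⊆ p)))
∑⊆-cong (false ∷ D) h = ∑⊆-cong D (λ X p → h _ (Sₚ.out⊆ p))

∑⊆-zero : ∀ {m} (D : Subset m) {f : Subset m → ℤ} → (∀ X → X ⊆ D → f X ≡ + 0) → ∑⊆ D f ≡ + 0
∑⊆-zero []          h = h [] id
∑⊆-zero (true ∷ D)  h = cong₂ _+ℤ_ (∑⊆-zero D (λ X p → h _ (Sₚ.s⊆s p))) (∑⊆-zero D (λ X p → h _ (Sₚ.out⊆ p)))
∑⊆-zero (false ∷ D) h = ∑⊆-zero D (λ X p → h _ (Sₚ.out⊆ p))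

∑⊆-- : ∀ {m} (D : Subset m) (f g : Subset m → ℤ) → ∑⊆ D (λ X → f X -ℤ g X) ≡ ∑⊆ D f -ℤ ∑⊆ D g
∑⊆-- []          f g = refl
∑⊆-- (true ∷ D)  f g = trans (cong₂ _+ℤ_ (∑⊆-- D _ _) (∑⊆-- D _ _)) (lem (∑⊆ D (f ∘ (true ∷_))) (∑⊆ D (g ∘ (true ∷_))) _ _)
  where
  lem : ∀ a b c d → a -ℤ b +ℤ (c -ℤ d) ≡ a +ℤ c -ℤ (b +ℤ d)
  lem = ℤRing.solve-∀
∑⊆-- (false ∷ D) f g = ∑⊆-- D _ _

∑⊆-split : ∀ {m} (D : Subset m) {e} → e ∈ D → (f : Subset m → ℤ) →
  ∑⊆ D f ≡ ∑⊆ (D ∖ e) (λ X → f X +ℤ f (X ∪ ⁅ e ⁆))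
∑⊆-split {suc m} (true ∷ D) {zero} here f = begin
  ∑⊆ D (f ∘ (true ∷_)) +ℤ ∑⊆ D (f ∘ (false ∷_))
    ≡⟨ ∑⊆-+ D ⟩
  ∑⊆ D (λ X → f (false ∷ X) +ℤ f (true ∷ X))
    ≡⟨ ∑⊆-cong D (λ X _ → cong (λ Y → f (false ∷ X) +ℤ f (true ∷ Y)) (sym (Sₚ.∪-identityʳ X))) ⟩
  ∑⊆ D (λ X → f (false ∷ X) +ℤ f (true ∷ (X ∪ ⊥)))
    ≡⟨ cong (λ E → ∑⊆ E (λ X → f (false ∷ X) +ℤ f (true ∷ (X ∪ ⊥)))) (sym D∖) ⟩
  ∑⊆ (D ∩ ∁ ⊥) (λ X → f (false ∷ X) +ℤ f (true ∷ (X ∪ ⊥))) ∎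
  where
  open ≡-Reasoning
  D∖ : D ∩ ∁ ⊥ ≡ D
  D∖ = Sₚ.⊆-antisym (λ p → proj₁ (Sₚ.x∈p∩q⁻ D _ p)) (λ p → Sₚ.x∈p∩q⁺ (p , ∉⇒∈∁ Sₚ.∉⊥))
  ∑⊆-+ : ∀ {k} (E : Subset k) {f g : Subset k → ℤ} → ∑⊆ E f +ℤ ∑⊆ E g ≡ ∑⊆ E (λ X → g X +ℤ f X)
  ∑⊆-+ [] {f} {g} = ℤₚ.+-comm (f []) (g [])
  ∑⊆-+ (true ∷ E) {f} {g} = trans
    (lem (∑⊆ E (f ∘ (true ∷_))) (∑⊆ E (f ∘ (false ∷_))) (∑⊆ E (g ∘ (true ∷_))) (∑⊆ E (g ∘ (false ∷_))))
    (cong₂ _+ℤ_ (∑⊆-+ E) (∑⊆-+ E))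
    where
    lem : ∀ a b c d → a +ℤ b +ℤ (c +ℤ d) ≡ a +ℤ c +ℤ (b +ℤ d)
    lem = ℤRing.solve-∀
  ∑⊆-+ (false ∷ E) = ∑⊆-+ E
∑⊆-split {suc m} (true ∷ D)  {suc e} (there p) f = cong₂ _+ℤ_ (∑⊆-split D p _) (∑⊆-split D p _)
∑⊆-split {suc m} (false ∷ D) {suc e} (there p) f = ∑⊆-split D p _

∑-filter : ∀ {A : Set} {P : A → Set} (P? : ∀ x → Dec (P x)) (L : List A) (f : A → ℤ) →
  ∑ (filter P? L) f ≡ ∑ L (λ x → if does (P? x) then f x else + 0)
∑-filter P? []      f = refl
∑-filter P? (x ∷ L) f with does (P? x)
... | true  = cong (f x +ℤ_) (∑-filter P? L f)
... | false = trans (∑-filter P? L f) (sym (ℤₚ.+-identityˡ _))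

∑-subsetsOf : ∀ {m} (D : Subset m) (f : Subset m → ℤ) →
  ∑ (filter (Sₚ._⊆? D) (allSubsets m)) f ≡ ∑⊆ D f
∑-subsetsOf {m} D f = trans (∑-filter (Sₚ._⊆? D) (allSubsets m) f) (go D f)
  where
  open ≡-Reasoning
  go : ∀ {m} (D : Subset m) f → ∑ (allSubsets m) (λ X → if does (X Sₚ.⊆? D) then f X else + 0) ≡ ∑⊆ D f
  go [] f = ℤₚ.+-identityʳ _
  go {suc m} (b ∷ D) f = trans (∑-++ (map (true ∷_) (allSubsets m)) _ _)
    (trans (cong₂ _+ℤ_ (∑-map (allSubsets m) (true ∷_) _) (trans (∑-map (allSubsets m) (false ∷_) _) (go D (f ∘ (false ∷_))))) (fin b))
    where
    fin : ∀ b → ∑ (allSubsets m) (λ X → if does ((true ∷ X) Sₚ.⊆? (b ∷ D)) then f (true ∷ X) else + 0)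
              +ℤ ∑⊆ D (f ∘ (false ∷_)) ≡ ∑⊆ (b ∷ D) f
    fin true  = cong (_+ℤ ∑⊆ D (f ∘ (false ∷_))) (go D (f ∘ (true ∷_)))
    fin false = trans (cong (_+ℤ ∑⊆ D (f ∘ (false ∷_))) (∑-zero (allSubsets m) (λ _ → refl))) (ℤₚ.+-identityˡ _)

module _ {m : ℕ} (N : Matroid m) where
  private
    r : Subset m → ℕ
    r = rk N

  private
    T : List ℤ → ℤ
    T l = sumℤ (tailSums N (⊥ {m}) ⊤ l)

    tailSums-≡ : ∀ A B l → tailSums N A B l ≡ tailSums N (⊥ {m}) ⊤ l
    tailSums-≡ A B []      = refl
    tailSums-≡ A B (a ∷ l) = cong (sumℤ l ∷_) (tailSums-≡ A B l)

    T-∑ : ∀ {X E : Set} (L : List X) (es : List E) (h : X → E → ℤ) →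
      T (map (λ e → ∑ L (λ x → h x e)) es) ≡ ∑ L (λ x → T (map (h x) es))
    T-∑ L []       h = sym (∑-zero L (λ _ → refl))
    T-∑ L (e ∷ es) h = trans (cong₂ _+ℤ_ (∑-swap es L (λ e x → h x e)) (T-∑ L es h)) (sym (∑-+ L _ _))

    sum-spike : ∀ v s n → v < n → sumℤ (List.applyUpTo (λ e → if v ℕ.≡ᵇ e then s else + 0) n) ≡ s
    sum-spike zero    s (suc n) _       = trans (cong (s +ℤ_) (zeros n)) (ℤₚ.+-identityʳ s)
      where
      zeros : ∀ n → sumℤ (List.applyUpTo (λ _ → + 0) n) ≡ + 0
      zeros zero    = refl
      zeros (suc n) = trans (ℤₚ.+-identityˡ _) (zeros n)
    sum-spike (suc v) s (suc n) (s≤s p) = trans (ℤₚ.+-identityˡ _) (sum-spike v s n p)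

    -- The coefficient of a monomial of degree v occurs in exactly v of the tail sums, so `T`
    -- computes the derivative at 1.
    T-spike : ∀ v s n → v < n → T (List.applyUpTo (λ e → if v ℕ.≡ᵇ e then s else + 0) n) ≡ s *ℤ + v
    T-spike zero    s (suc n) _       = trans (zeros (suc n)) (sym (ℤₚ.*-zeroʳ s))
      where
      sumzeros : ∀ n → sumℤ (List.applyUpTo (λ _ → + 0) n) ≡ + 0
      sumzeros zero    = refl
      sumzeros (suc n) = trans (ℤₚ.+-identityˡ _) (sumzeros n)
      zeros' : ∀ n → T (List.applyUpTo (λ _ → + 0) n) ≡ + 0
      zeros' zero    = refl
      zeros' (suc n) = cong₂ _+ℤ_ (sumzeros n) (zeros' n)
      zeros : ∀ n → T (List.applyUpTo (λ e → if zero ℕ.≡ᵇ e then s else + 0) n) ≡ + 0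
      zeros zero    = refl
      zeros (suc n) = cong₂ _+ℤ_ (sumzeros n) (zeros' n)
    T-spike (suc v) s (suc n) (s≤s p) = trans (cong₂ _+ℤ_ (sum-spike v s n p) (T-spike v s n p)) (lem s (+ v))
      where
      lem : ∀ s v → s +ℤ s *ℤ v ≡ s *ℤ (+ 1 +ℤ v)
      lem = ℤRing.solve-∀

  -- The derivative at 1 of the characteristic polynomial of the minor B/A.
  χ′ : Subset m → Subset m → ℤ
  χ′ A B = ∑⊆ (B ∩ ∁ A) (λ X → sgn ∣ X ∣ *ℤ (+ r B -ℤ + r (X ∪ A)))

  private
    ground-⊆ : ∀ {A B X : Subset m} → A ⊆ B → X ⊆ B ∩ ∁ A → X ∪ A ⊆ B
    ground-⊆ {A} {B} A⊆B p = ∪-⊆ (λ q → proj₁ (Sₚ.x∈p∩q⁻ B _ (p q))) A⊆B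

  reducedChiAt1-χ′ : ∀ {A B} → A ⊆ B → reducedChiAt1 N A B ≡ χ′ A B
  reducedChiAt1-χ′ {A} {B} A⊆B = begin
    reducedChiAt1 N A B
      ≡⟨ cong sumℤ (tailSums-≡ A B (chi N A B)) ⟩
    T (map (chiCoeff N A B) (upTo (suc R)))
      ≡⟨ T-∑ L (upTo (suc R)) (λ X e → if (R ∸ ρ X) ℕ.≡ᵇ e then sgn ∣ X ∣ else + 0) ⟩
    ∑ L (λ X → T (map (λ e → if (R ∸ ρ X) ℕ.≡ᵇ e then sgn ∣ X ∣ else + 0) (upTo (suc R))))
      ≡⟨ ∑-cong L (λ X → trans (cong T (Listₚ.map-upTo _ (suc R)))
           (T-spike (R ∸ ρ X) (sgn ∣ X ∣) (suc R) (s≤s (ℕₚ.m∸n≤m R (ρ X))))) ⟩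
    ∑ L (λ X → sgn ∣ X ∣ *ℤ + (R ∸ ρ X))
      ≡⟨ ∑-subsetsOf (B ∩ ∁ A) (λ X → sgn ∣ X ∣ *ℤ + (R ∸ ρ X)) ⟩
    ∑⊆ (B ∩ ∁ A) (λ X → sgn ∣ X ∣ *ℤ + (R ∸ ρ X))
      ≡⟨ ∑⊆-cong (B ∩ ∁ A) (λ X p → cong (sgn ∣ X ∣ *ℤ_) (corank X p)) ⟩
    χ′ A B ∎
    where
    open ≡-Reasoning
    R = minorRank N A B
    ρ = minorRk N A B
    L = minorSubsets N A B
    -- The truncated subtractions are exact because `r A ≤ r (X ∪ A)` and `r (X ∪ A) ≤ r B`.
    corank : ∀ X → X ⊆ B ∩ ∁ A → + (R ∸ ρ X) ≡ + r B -ℤ + r (X ∪ A)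
    corank X p = begin
      + (R ∸ ρ X)                          ≡⟨ cong +_ (ℕₚ.∸-+-assoc (r B) (r A) (ρ X)) ⟩
      + (r B ∸ (r A + (r (X ∪ A) ∸ r A)))  ≡⟨ cong (λ z → + (r B ∸ z)) (ℕₚ.m+[n∸m]≡n (rk-mono N (∈ʳ X))) ⟩
      + (r B ∸ r (X ∪ A))                  ≡⟨ ℤₚ.⊖-≥ (rk-mono N (ground-⊆ A⊆B p)) ⟨
      r B ℤ.⊖ r (X ∪ A)                    ≡⟨ ℤₚ.m-n≡m⊖n (r B) (r (X ∪ A)) ⟨
      + r B -ℤ + r (X ∪ A)                 ∎

  beta-χ′ : ∀ {A B} → A ⊆ B → beta N A B ≡ sgn ((r B ∸ r A) ∸ 1) *ℤ χ′ A B
  beta-χ′ {A} {B} A⊆B = cong (sgn ((r B ∸ r A) ∸ 1) *ℤ_) (reducedChiAt1-χ′ A⊆B)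

  private
    beta-0 : ∀ {A B} → A ⊆ B → χ′ A B ≡ + 0 → beta N A B ≡ + 0
    beta-0 {A} {B} A⊆B h = trans (beta-χ′ A⊆B) (trans (cong (sgn ((r B ∸ r A) ∸ 1) *ℤ_) h) (ℤₚ.*-zeroʳ (sgn ((r B ∸ r A) ∸ 1))))

  private
    ground-∈ : ∀ {A B : Subset m} {e} → e ∈ B → e ∉ A → e ∈ B ∩ ∁ A
    ground-∈ p q = Sₚ.x∈p∩q⁺ (p , ∉⇒∈∁ q)

    sgn-∪⁅⁆ : ∀ (X : Subset m) e → e ∉ X → sgn ∣ X ∪ ⁅ e ⁆ ∣ ≡ - sgn ∣ X ∣
    sgn-∪⁅⁆ X e p = trans (cong sgn (∣∪⁅⁆∣ p)) (sgn-suc ∣ X ∣)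

  -- Pairs each X avoiding e with X + e: the signs are opposite, and e moves from the subset into
  -- the contracted set.
  χ′-split : ∀ {A B e} → e ∈ B → e ∉ A → χ′ A B ≡
    ∑⊆ ((B ∩ ∁ A) ∖ e) (λ X → sgn ∣ X ∣ *ℤ (+ r B -ℤ + r (X ∪ A)) -ℤ sgn ∣ X ∣ *ℤ (+ r B -ℤ + r (X ∪ (A ∪ ⁅ e ⁆))))
  χ′-split {A} {B} {e} e∈B e∉A = trans (∑⊆-split (B ∩ ∁ A) (ground-∈ e∈B e∉A) _) (∑⊆-cong ((B ∩ ∁ A) ∖ e) (λ X p →
    cong (sgn ∣ X ∣ *ℤ (+ r B -ℤ + r (X ∪ A)) +ℤ_)
      (trans (cong₂ (λ s k → s *ℤ (+ r B -ℤ + r k)) (sgn-∪⁅⁆ X e (λ q → ∉-∖ (p q))) (assoc X))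
             (sym (ℤₚ.neg-distribˡ-* (sgn ∣ X ∣) (+ r B -ℤ + r (X ∪ (A ∪ ⁅ e ⁆))))))))
    where
    assoc : ∀ X → (X ∪ ⁅ e ⁆) ∪ A ≡ X ∪ (A ∪ ⁅ e ⁆)
    assoc X = trans (Sₚ.∪-assoc X ⁅ e ⁆ A) (cong (X ∪_) (Sₚ.∪-comm ⁅ e ⁆ A))

  -- The ranks over A do not see a loop, so the two terms of each pair cancel.
  beta-loop : ∀ {A B e} → A ⊆ B → e ∈ B → e ∉ A → r (A ∪ ⁅ e ⁆) ≤ r A → beta N A B ≡ + 0
  beta-loop {A} {B} {e} A⊆B e∈B e∉A h = beta-0 A⊆B
    (trans (χ′-split e∈B e∉A) (∑⊆-zero ((B ∩ ∁ A) ∖ e) (λ X p → ℤₚ.i≡j⇒i-j≡0 (cong (λ k → sgn ∣ X ∣ *ℤ (+ r B -ℤ + k)) (same X)))))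
    where
    same : ∀ X → r (X ∪ A) ≡ r (X ∪ (A ∪ ⁅ e ⁆))
    same X = ℕₚ.≤-antisym (rk-mono N (∪-mono id (∈ˡ _)))
      (ℕₚ.≤-trans (ℕₚ.≤-reflexive (cong r (sym (Sₚ.∪-assoc X A _)))) (rk-cover N (∈ʳ X) h))

  -- For a coloop the two ranks of a pair differ by one, which leaves an alternating sum of signs;
  -- pairing again along `e'` kills it. The second element is essential: a lone coloop has beta
  -- invariant 1.
  beta-coloop : ∀ {A B e e'} → A ⊆ B → e ∈ B → e ∉ A → e' ∈ B → e' ∉ A → e' ≢ e → r (B ∖ e) < r B →
    beta N A B ≡ + 0
  beta-coloop {A} {B} {e} {e'} A⊆B e∈B e∉A e'∈B e'∉A ne h = beta-0 A⊆B
    (begin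
      χ′ A B
        ≡⟨ χ′-split e∈B e∉A ⟩
      ∑⊆ ((B ∩ ∁ A) ∖ e) (λ X → sgn ∣ X ∣ *ℤ (+ r B -ℤ + r (X ∪ A)) -ℤ sgn ∣ X ∣ *ℤ (+ r B -ℤ + r (X ∪ (A ∪ ⁅ e ⁆))))
        ≡⟨ ∑⊆-cong ((B ∩ ∁ A) ∖ e) (λ X p → trans (cong (λ k → sgn ∣ X ∣ *ℤ (+ r B -ℤ + r (X ∪ A)) -ℤ sgn ∣ X ∣ *ℤ (+ r B -ℤ + k)) (up X p))
             (lem (sgn ∣ X ∣) (+ r B) (+ r (X ∪ A)))) ⟩
      ∑⊆ ((B ∩ ∁ A) ∖ e) (λ X → sgn ∣ X ∣)
        ≡⟨ ∑⊆-split ((B ∩ ∁ A) ∖ e) (∖⁺ (ground-∈ e'∈B e'∉A) ne) (λ X → sgn ∣ X ∣) ⟩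
      ∑⊆ (((B ∩ ∁ A) ∖ e) ∖ e') (λ X → sgn ∣ X ∣ +ℤ sgn ∣ X ∪ ⁅ e' ⁆ ∣)
        ≡⟨ ∑⊆-zero (((B ∩ ∁ A) ∖ e) ∖ e') (λ X p → trans (cong (sgn ∣ X ∣ +ℤ_) (sgn-∪⁅⁆ X e' (λ q → ∉-∖ (p q)))) (ℤₚ.+-inverseʳ (sgn ∣ X ∣))) ⟩
      + 0 ∎)
    where
    open ≡-Reasoning
    lem : ∀ s b x → s *ℤ (b -ℤ x) -ℤ s *ℤ (b -ℤ (+ 1 +ℤ x)) ≡ s
    lem = ℤRing.solve-∀
    up : ∀ X → X ⊆ (B ∩ ∁ A) ∖ e → r (X ∪ (A ∪ ⁅ e ⁆)) ≡ suc (r (X ∪ A))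
    up X p = trans (cong r (sym (Sₚ.∪-assoc X A _)))
      (ℕₚ.≤-antisym (rk-∪⁅⁆ N (X ∪ A) e) (ℕₚ.≰⇒> λ le → ℕₚ.<⇒≱ h
        (subst (λ z → r z ≤ r (B ∖ e)) (∖-∪ e∈B) (rk-cover N {X ∪ A} {B ∖ e} {e} sub le))))
      where
      sub : X ∪ A ⊆ B ∖ e
      sub = ∪-⊆ (λ q → ∖⁺ (proj₁ (Sₚ.x∈p∩q⁻ B _ (∖-⊆ (p q)))) (∖-≢ (p q)))
                (λ {i} q → ∖⁺ (A⊆B q) (λ { refl → e∉A q }))

  -- The derivatives subtract, deletion minus contraction. The minus sign is absorbed by the sign of
  -- `beta`, because contracting e lowers the rank by one and deleting it does not.
  beta-del-con : ∀ {A B e} → A ⊆ B → e ∈ B → e ∉ A → r A < r (A ∪ ⁅ e ⁆) → r B ≤ r (B ∖ e) →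
    beta N A B ≡ beta N A (B ∖ e) +ℤ beta N (A ∪ ⁅ e ⁆) B
  beta-del-con {A} {B} {e} A⊆B e∈B e∉A nl nc = begin
    beta N A B
      ≡⟨ beta-χ′ A⊆B ⟩
    sgn ((r B ∸ r A) ∸ 1) *ℤ χ′ A B
      ≡⟨ cong (sgn ((r B ∸ r A) ∸ 1) *ℤ_) (trans (χ′-split e∈B e∉A) (∑⊆-- ((B ∩ ∁ A) ∖ e) f g)) ⟩
    sgn ((r B ∸ r A) ∸ 1) *ℤ (∑⊆ ((B ∩ ∁ A) ∖ e) f -ℤ ∑⊆ ((B ∩ ∁ A) ∖ e) g)
      ≡⟨ cong (sgn ((r B ∸ r A) ∸ 1) *ℤ_) (cong₂ _-ℤ_ del con) ⟩
    sgn ((r B ∸ r A) ∸ 1) *ℤ (χ′ A (B ∖ e) -ℤ χ′ (A ∪ ⁅ e ⁆) B)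
      ≡⟨ lem (sgn ((r B ∸ r A) ∸ 1)) (χ′ A (B ∖ e)) (χ′ (A ∪ ⁅ e ⁆) B) ⟩
    sgn ((r B ∸ r A) ∸ 1) *ℤ χ′ A (B ∖ e) +ℤ - sgn ((r B ∸ r A) ∸ 1) *ℤ χ′ (A ∪ ⁅ e ⁆) B
      ≡⟨ cong₂ _+ℤ_ (cong (λ b → sgn ((b ∸ r A) ∸ 1) *ℤ χ′ A (B ∖ e)) rB) signs ⟩
    sgn ((r (B ∖ e) ∸ r A) ∸ 1) *ℤ χ′ A (B ∖ e) +ℤ sgn ((r B ∸ r (A ∪ ⁅ e ⁆)) ∸ 1) *ℤ χ′ (A ∪ ⁅ e ⁆) B
      ≡⟨ cong₂ _+ℤ_ (beta-χ′ A⊆B∖e) (beta-χ′ Ae⊆B) ⟨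
    beta N A (B ∖ e) +ℤ beta N (A ∪ ⁅ e ⁆) B ∎
    where
    open ≡-Reasoning
    f g : Subset m → ℤ
    f X = sgn ∣ X ∣ *ℤ (+ r B -ℤ + r (X ∪ A))
    g X = sgn ∣ X ∣ *ℤ (+ r B -ℤ + r (X ∪ (A ∪ ⁅ e ⁆)))
    lem : ∀ s a b → s *ℤ (a -ℤ b) ≡ s *ℤ a +ℤ - s *ℤ b
    lem = ℤRing.solve-∀
    A⊆B∖e : A ⊆ B ∖ e
    A⊆B∖e q = ∖⁺ (A⊆B q) (λ { refl → e∉A q })
    Ae⊆B : A ∪ ⁅ e ⁆ ⊆ B
    Ae⊆B = ∪-⊆ A⊆B (⁅⁆-⊆ e∈B)
    rB : r B ≡ r (B ∖ e)
    rB = ℕₚ.≤-antisym nc (rk-mono N ∖-⊆)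
    ground-del : (B ∩ ∁ A) ∖ e ≡ (B ∖ e) ∩ ∁ A
    ground-del = Sₚ.⊆-antisym
      (λ p → let (a , b) = Sₚ.x∈p∩q⁻ B _ (∖-⊆ p) in Sₚ.x∈p∩q⁺ (∖⁺ a (∖-≢ p) , b))
      (λ p → let (a , b) = Sₚ.x∈p∩q⁻ (B ∖ e) _ p in ∖⁺ (Sₚ.x∈p∩q⁺ (∖-⊆ a , b)) (∖-≢ a))
    ground-con : (B ∩ ∁ A) ∖ e ≡ B ∩ ∁ (A ∪ ⁅ e ⁆)
    ground-con = Sₚ.⊆-antisym
      (λ p → let (a , b) = Sₚ.x∈p∩q⁻ B _ (∖-⊆ p) in
        Sₚ.x∈p∩q⁺ (a , ∉⇒∈∁ (∉-∪ (∈∁⇒∉ b) (λ q → ∖-≢ p (Sₚ.x∈⁅y⁆⇒x≡y e q)))))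
      (λ p → let (a , b) = Sₚ.x∈p∩q⁻ B _ p in
        ∖⁺ (Sₚ.x∈p∩q⁺ (a , ∉⇒∈∁ (λ q → ∈∁⇒∉ b (∈ˡ _ q)))) (λ { refl → ∈∁⇒∉ b (∈ʳ A (Sₚ.x∈⁅x⁆ e)) }))
    del : ∑⊆ ((B ∩ ∁ A) ∖ e) f ≡ χ′ A (B ∖ e)
    del = trans (cong (λ D → ∑⊆ D f) ground-del)
                (cong (λ b → ∑⊆ ((B ∖ e) ∩ ∁ A) (λ X → sgn ∣ X ∣ *ℤ (+ b -ℤ + r (X ∪ A)))) rB)
    con : ∑⊆ ((B ∩ ∁ A) ∖ e) g ≡ χ′ (A ∪ ⁅ e ⁆) B
    con = cong (λ D → ∑⊆ D g) ground-con
    rAe : r (A ∪ ⁅ e ⁆) ≡ suc (r A)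
    rAe = ℕₚ.≤-antisym (rk-∪⁅⁆ N A e) nl
    con-0 : r B ≤ r (A ∪ ⁅ e ⁆) → χ′ (A ∪ ⁅ e ⁆) B ≡ + 0
    con-0 le = ∑⊆-zero (B ∩ ∁ (A ∪ ⁅ e ⁆)) (λ X p → trans (cong (λ k → sgn ∣ X ∣ *ℤ (+ r B -ℤ + k))
        (ℕₚ.≤-antisym (rk-mono N (ground-⊆ Ae⊆B p)) (ℕₚ.≤-trans le (rk-mono N (∈ʳ X)))))
      (trans (cong (sgn ∣ X ∣ *ℤ_) (ℤₚ.+-inverseʳ (+ r B))) (ℤₚ.*-zeroʳ (sgn ∣ X ∣))))
    -- The truncated `∸ 1` fails to flip the sign exactly when the contraction has rank 0, and then
    -- `con-0` makes its derivative vanish.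
    flip : ∀ k → k ≡ r B ∸ suc (r A) → - sgn ((r B ∸ r A) ∸ 1) *ℤ χ′ (A ∪ ⁅ e ⁆) B
                                     ≡ sgn (k ∸ 1) *ℤ χ′ (A ∪ ⁅ e ⁆) B
    flip zero    eq = trans (cong (- s *ℤ_) z) (trans (ℤₚ.*-zeroʳ (- s)) (sym (trans (cong (sgn 0 *ℤ_) z) (ℤₚ.*-zeroʳ (sgn 0)))))
      where
      s = sgn ((r B ∸ r A) ∸ 1)
      z = con-0 (ℕₚ.≤-trans (ℕₚ.m∸n≡0⇒m≤n (sym eq)) (ℕₚ.≤-reflexive (sym rAe)))
    flip (suc k) eq = cong (_*ℤ χ′ (A ∪ ⁅ e ⁆) B) (trans (cong (λ z → - sgn z) (trans (ℕₚ.∸-+-assoc (r B) (r A) 1)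
        (trans (cong (r B ∸_) (ℕₚ.+-comm (r A) 1)) (sym eq))))
      (trans (cong -_ (sgn-suc k)) (ℤₚ.neg-involutive _)))
    signs : - sgn ((r B ∸ r A) ∸ 1) *ℤ χ′ (A ∪ ⁅ e ⁆) B ≡ sgn ((r B ∸ r (A ∪ ⁅ e ⁆)) ∸ 1) *ℤ χ′ (A ∪ ⁅ e ⁆) B
    signs = trans (flip (r B ∸ suc (r A)) refl) (cong (λ z → sgn ((r B ∸ z) ∸ 1) *ℤ χ′ (A ∪ ⁅ e ⁆) B) (sym rAe))

  beta-single : ∀ {A e} → r A < r (A ∪ ⁅ e ⁆) → beta N A (A ∪ ⁅ e ⁆) ≡ + 1
  beta-single {A} {e} nl = begin
    beta N A (A ∪ ⁅ e ⁆)
      ≡⟨ beta-χ′ (∈ˡ _) ⟩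
    sgn ((r (A ∪ ⁅ e ⁆) ∸ r A) ∸ 1) *ℤ χ′ A (A ∪ ⁅ e ⁆)
      ≡⟨ cong₂ (λ k c → sgn k *ℤ c) (trans (cong (λ z → (z ∸ r A) ∸ 1) rAe) (cong (_∸ 1) (trans (ℕₚ.+-∸-assoc 1 (ℕₚ.≤-refl {r A})) (cong suc (ℕₚ.n∸n≡0 (r A))))))
           (trans (χ′-split (∈ʳ A (Sₚ.x∈⁅x⁆ e)) e∉A) (trans (cong (λ D → ∑⊆ D f) ground) (∑⊆-⊥ m f))) ⟩
    + 1 *ℤ f ⊥
      ≡⟨ ℤₚ.*-identityˡ _ ⟩
    f ⊥
      ≡⟨ f-⊥ ⟩
    + 1 ∎
    where
    open ≡-Reasoning
    rAe : r (A ∪ ⁅ e ⁆) ≡ suc (r A)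
    rAe = ℕₚ.≤-antisym (rk-∪⁅⁆ N A e) nl
    e∉A : e ∉ A
    e∉A p = ℕₚ.<⇒≱ nl (rk-mono N (∪-⊆ id (⁅⁆-⊆ p)))
    f : Subset m → ℤ
    f X = sgn ∣ X ∣ *ℤ (+ r (A ∪ ⁅ e ⁆) -ℤ + r (X ∪ A)) -ℤ sgn ∣ X ∣ *ℤ (+ r (A ∪ ⁅ e ⁆) -ℤ + r (X ∪ (A ∪ ⁅ e ⁆)))
    ∑⊆-⊥ : ∀ k (f : Subset k → ℤ) → ∑⊆ ⊥ f ≡ f ⊥
    ∑⊆-⊥ zero    f = refl
    ∑⊆-⊥ (suc k) f = ∑⊆-⊥ k _
    ground : ((A ∪ ⁅ e ⁆) ∩ ∁ A) ∖ e ≡ ⊥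
    ground = ∅-unique λ i p → let (a , b) = Sₚ.x∈p∩q⁻ (A ∪ ⁅ e ⁆) _ (∖-⊆ p) in
      [ ∈∁⇒∉ b , (λ q → ∖-≢ p (Sₚ.x∈⁅y⁆⇒x≡y e q)) ]′ (∈-∪ A _ a)
    lem : ∀ a → + 1 *ℤ (+ 1 +ℤ a -ℤ a) -ℤ + 1 *ℤ (+ 1 +ℤ a -ℤ (+ 1 +ℤ a)) ≡ + 1
    lem = ℤRing.solve-∀
    f-⊥ : f ⊥ ≡ + 1
    f-⊥ rewrite Sₚ.∪-identityˡ A | Sₚ.∪-identityˡ (A ∪ ⁅ e ⁆) | Sₚ.∣⊥∣≡0 m | rAe = lem (+ r A)

  -- Serves to replace a contracted set by its closure, which changes no rank of the form
  -- `r (X ∪ A)`.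
  beta-cong : ∀ {A B A' B'} → A ⊆ B → A' ⊆ B' → B ∩ ∁ A ≡ B' ∩ ∁ A' → (∀ X → r (X ∪ A) ≡ r (X ∪ A')) →
    r B ≡ r B' → beta N A B ≡ beta N A' B'
  beta-cong {A} {B} {A'} {B'} p q ground rA rB = begin
    beta N A B
      ≡⟨ beta-χ′ p ⟩
    sgn ((r B ∸ r A) ∸ 1) *ℤ χ′ A B
      ≡⟨ cong₂ (λ b a → sgn ((b ∸ a) ∸ 1) *ℤ χ′ A B) rB rA⊥ ⟩
    sgn ((r B' ∸ r A') ∸ 1) *ℤ χ′ A B
      ≡⟨ cong (sgn ((r B' ∸ r A') ∸ 1) *ℤ_) (trans (∑⊆-cong (B ∩ ∁ A) (λ X _ → cong₂ (λ b a → sgn ∣ X ∣ *ℤ (+ b -ℤ + a)) rB (rA X)))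
                             (cong (λ D → ∑⊆ D (λ X → sgn ∣ X ∣ *ℤ (+ r B' -ℤ + r (X ∪ A')))) ground)) ⟩
    sgn ((r B' ∸ r A') ∸ 1) *ℤ χ′ A' B'
      ≡⟨ beta-χ′ q ⟨
    beta N A' B' ∎
    where
    open ≡-Reasoning
    rA⊥ : r A ≡ r A'
    rA⊥ = trans (cong r (sym (Sₚ.∪-identityˡ A))) (trans (rA ⊥) (cong r (Sₚ.∪-identityˡ A')))

-- Steps between biflats

module _ {m : ℕ} (M : Matroid m) where
  private
    r : Subset m → ℕ
    r = rk M

    -- The dual rank shifted by `r ⊤`: monotonicity and submodularity are proved in this form, free
    -- of truncated subtraction, and shifted back afterwards.
    f : Subset m → ℕ
    f S = ∣ S ∣ + r (∁ S)

    rk-∪-≤ : ∀ {A C} B → C ⊆ A ∪ B → r C ≤ r A + ∣ B ∣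
    rk-∪-≤ {A} {C} B h = ℕₚ.≤-trans (ℕₚ.m≤m+n (r C) _)
      (ℕₚ.≤-trans (rk-submod-⊆ M {A} {B} {C} {⊥} h (λ p → contradiction p Sₚ.∉⊥) (λ p → contradiction p Sₚ.∉⊥))
        (ℕₚ.+-monoʳ-≤ (r A) (rk-bound M B)))

    r⊤≤f : ∀ S → r ⊤ ≤ f S
    r⊤≤f S = ℕₚ.≤-trans (rk-∪-≤ {∁ S} S (λ {i} _ → cov i)) (ℕₚ.≤-reflexive (ℕₚ.+-comm (r (∁ S)) ∣ S ∣))
      where
      cov : ∀ i → i ∈ ∁ S ∪ S
      cov i with i Sₚ.∈? S
      ... | yes q = ∈ʳ (∁ S) q
      ... | no q  = ∈ˡ _ (∉⇒∈∁ q)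

    f-mono : ∀ {S T} → S ⊆ T → f S ≤ f T
    f-mono {S} {T} S⊆T = ℕₚ.≤-trans (ℕₚ.+-monoʳ-≤ ∣ S ∣ (rk-∪-≤ {∁ T} (T ∩ ∁ S) cov))
      (ℕₚ.≤-trans (ℕₚ.≤-reflexive (lem (∣ S ∣) (r (∁ T)) (∣ T ∩ ∁ S ∣)))
        (ℕₚ.+-monoˡ-≤ (r (∁ T)) (ℕₚ.≤-trans
          (ℕₚ.≤-reflexive (sym (∣∪∣-disjoint S (T ∩ ∁ S) (λ i p q → ∈∁⇒∉ (proj₂ (Sₚ.x∈p∩q⁻ T _ q)) p))))
          (Sₚ.p⊆q⇒∣p∣≤∣q∣ (∪-⊆ S⊆T (λ p → proj₁ (Sₚ.x∈p∩q⁻ T _ p)))))))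
      where
      lem : ∀ a b c → a + (b + c) ≡ a + c + b
      lem = ℕRing.solve-∀
      cov : ∁ S ⊆ ∁ T ∪ (T ∩ ∁ S)
      cov {i} p with i Sₚ.∈? T
      ... | yes q = ∈ʳ (∁ T) (Sₚ.x∈p∩q⁺ (q , p))
      ... | no q  = ∈ˡ _ (∉⇒∈∁ q)

    f-submod : ∀ S T → f (S ∪ T) + f (S ∩ T) ≤ f S + f T
    f-submod S T = begin
      f (S ∪ T) + f (S ∩ T)
        ≡⟨ lem (∣ S ∪ T ∣) _ (∣ S ∩ T ∣) _ ⟩
      ∣ S ∪ T ∣ + ∣ S ∩ T ∣ + (r (∁ (S ∩ T)) + r (∁ (S ∪ T)))
        ≤⟨ ℕₚ.+-mono-≤ (ℕₚ.≤-reflexive (∣∪∣+∣∩∣ S T)) (rk-submod-⊆ M cov (∁-anti (∈ˡ T)) (∁-anti (∈ʳ S))) ⟩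
      ∣ S ∣ + ∣ T ∣ + (r (∁ S) + r (∁ T))
        ≡⟨ lem' (∣ S ∣) (∣ T ∣) _ _ ⟩
      f S + f T ∎
      where
      open ℕₚ.≤-Reasoning
      lem : ∀ a b c d → a + b + (c + d) ≡ a + c + (d + b)
      lem = ℕRing.solve-∀
      lem' : ∀ a b c d → a + b + (c + d) ≡ a + c + (b + d)
      lem' = ℕRing.solve-∀
      cov : ∁ (S ∩ T) ⊆ ∁ S ∪ ∁ T
      cov {i} p with i Sₚ.∈? S
      ... | yes q = ∈ʳ (∁ S) (∉⇒∈∁ (λ z → ∈∁⇒∉ p (Sₚ.x∈p∩q⁺ (q , z))))
      ... | no q  = ∈ˡ _ (∉⇒∈∁ q)

  dualRk-+ : ∀ S → dualRk M S + r ⊤ ≡ ∣ S ∣ + r (∁ S)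
  dualRk-+ S = ℕₚ.m∸n+n≡m (r⊤≤f S)

  dualMatroid : Matroid m
  dualMatroid = record
    { rk        = dualRk M
    ; rk-bound  = λ S → ℕₚ.m≤n+o⇒m∸n≤o (∣ S ∣ + r (∁ S)) (r ⊤) {∣ S ∣}
        (ℕₚ.≤-trans (ℕₚ.+-monoʳ-≤ ∣ S ∣ (rk-mono M (λ _ → Sₚ.∈⊤))) (ℕₚ.≤-reflexive (ℕₚ.+-comm ∣ S ∣ (r ⊤))))
    ; rk-mono   = λ S⊆T → ℕₚ.∸-monoˡ-≤ (r ⊤) (f-mono S⊆T)
    ; rk-submod = λ S T → sub (dualRk M (S ∪ T)) (dualRk M (S ∩ T)) (dualRk M S) (dualRk M T) (r ⊤)
        (subst₂ _≤_ (sym (cong₂ _+_ (dualRk-+ (S ∪ T)) (dualRk-+ (S ∩ T)))) (sym (cong₂ _+_ (dualRk-+ S) (dualRk-+ T))) (f-submod S T))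
    }
    where
    sub : ∀ a b c d t → (a + t) + (b + t) ≤ (c + t) + (d + t) → a + b ≤ c + d
    sub a b c d t h = lin≤ 0 h (lem a b c d t)
      where
      lem : ∀ a b c d t → a + b + ((c + t) + (d + t)) ≡ c + d + ((a + t) + (b + t))
      lem = ℕRing.solve-∀

  dualMatroid-isDual : IsDual M dualMatroid
  dualMatroid-isDual = dualRk-+

module Steps {m : ℕ} (M N : Matroid m) (dual : IsDual M N) where
  private
    r s : Subset m → ℕ
    r = rk M
    s = rk N

  infix 4 _≼_ _≺_

  -- A record rather than a product, so that unification recovers both pairs from the type.
  record _≼_ (x y : BF m) : Set where
    constructor _,_
    field
      ≼₁ : proj₁ x ⊆ proj₁ y
      ≼₂ : proj₂ y ⊆ proj₂ x

  open _≼_ public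

  _≺_ : BF m → BF m → Set
  x ≺ y = x ≼ y × x ≢ y

  ≼-refl : ∀ {x} → x ≼ x
  ≼-refl = id , id

  ≼-trans : ∀ {x y z} → x ≼ y → y ≼ z → x ≼ z
  ≼-trans (a , b) (c , d) = (λ p → c (a p)) , (λ p → b (d p))

  ≼-antisym : ∀ {x y} → x ≼ y → y ≼ x → x ≡ y
  ≼-antisym (a , b) (c , d) = cong₂ _,_ (Sₚ.⊆-antisym a c) (Sₚ.⊆-antisym d b)

  -- Nonemptiness is left out, so that the ends ∅|E and E|∅ of a chain are treated like its members.
  record Vertex (x : BF m) : Set where
    field
      flatM : Flat M (proj₁ x)
      flatN : Flat N (proj₂ x)
      cover : ∀ i → i ∉ proj₁ x → i ∈ proj₂ x

  open Vertex public

  -- The complement of ⋃ (F ∩ G) over a flag is the disjoint union of the sets D over its steps.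
  D : BF m → BF m → Subset m
  D x y = ∁ (proj₁ x ∪ proj₂ y)

  ∈D⁺ : ∀ x y {e} → e ∉ proj₁ x → e ∉ proj₂ y → e ∈ D x y
  ∈D⁺ x y p q = ∉⇒∈∁ (∉-∪ p q)

  ∈D⁻₁ : ∀ x y {e} → e ∈ D x y → e ∉ proj₁ x
  ∈D⁻₁ x y p q = ∈∁⇒∉ p (∈ˡ _ q)

  ∈D⁻₂ : ∀ x y {e} → e ∈ D x y → e ∉ proj₂ y
  ∈D⁻₂ x y p q = ∈∁⇒∉ p (∈ʳ (proj₁ x) q)

  -- The length of the interval from x to y in the product of one lattice of flats with the opposite
  -- of the other, hence additive along chains.
  size : BF m → BF m → ℕ
  size x y = (r (proj₁ y) + s (proj₂ x)) ∸ (r (proj₁ x) + s (proj₂ y))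

  size-+ : ∀ {x y} → x ≼ y → size x y + (r (proj₁ x) + s (proj₂ y)) ≡ r (proj₁ y) + s (proj₂ x)
  size-+ h = ℕₚ.m∸n+n≡m (ℕₚ.+-mono-≤ (rk-mono M (≼₁ h)) (rk-mono N (≼₂ h)))

  size-split : ∀ {x y z} → x ≼ y → y ≼ z → size x z ≡ size x y + size y z
  size-split {x} {y} {z} p q = ar (r (proj₁ x)) (r (proj₁ y)) (r (proj₁ z)) (s (proj₂ x)) (s (proj₂ y)) (s (proj₂ z))
      (size x z) (size x y) (size y z) (size-+ (≼-trans p q)) (size-+ p) (size-+ q)
    where
    ar : ∀ a b c d e f u v w → u + (a + f) ≡ c + d → v + (a + e) ≡ b + d → w + (b + f) ≡ c + e → u ≡ v + w
    ar a b c d e f u v w h₁ h₂ h₃ = ℕₚ.+-cancelʳ-≡ (a + f + (b + e)) u (v + w) (begin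
      u + (a + f + (b + e))         ≡⟨ l₁ u (a + f) (b + e) ⟩
      (u + (a + f)) + (b + e)       ≡⟨ cong (_+ (b + e)) h₁ ⟩
      c + d + (b + e)               ≡⟨ l₂ c d b e ⟩
      (b + d) + (c + e)             ≡⟨ cong₂ _+_ (sym h₂) (sym h₃) ⟩
      v + (a + e) + (w + (b + f))   ≡⟨ l₃ v w a b e f ⟩
      v + w + (a + f + (b + e))     ∎)
      where
      open ≡-Reasoning
      l₁ : ∀ a b c → a + (b + c) ≡ a + b + c
      l₁ = ℕRing.solve-∀
      l₂ : ∀ a b c d → a + b + (c + d) ≡ c + b + (a + d)
      l₂ = ℕRing.solve-∀
      l₃ : ∀ v w a b e f → v + (a + e) + (w + (b + f)) ≡ v + w + (a + f + (b + e))
      l₃ = ℕRing.solve-∀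

  size-≥ : ∀ {x y} a b → x ≼ y → a + r (proj₁ x) ≤ r (proj₁ y) → b + s (proj₂ y) ≤ s (proj₂ x) → a + b ≤ size x y
  size-≥ {x} {y} a b h p q = ar a b (r (proj₁ x)) (r (proj₁ y)) (s (proj₂ y)) (s (proj₂ x)) (size x y) (size-+ h) p q
    where
    ar : ∀ a b c d e f z → z + (c + e) ≡ d + f → a + c ≤ d → b + e ≤ f → a + b ≤ z
    ar a b c d e f z h p q = lin≤ 0 (ℕₚ.+-mono-≤ (ℕₚ.+-mono-≤ p q) (ℕₚ.≤-reflexive (sym h))) (lem a b c d e f z)
      where
      lem : ∀ a b c d e f z → a + b + (d + f + (z + (c + e))) ≡ z + (a + c + (b + e) + (d + f))
      lem = ℕRing.solve-∀

  size-≤ : ∀ {x y} k → x ≼ y → r (proj₁ y) + s (proj₂ x) ≤ k + (r (proj₁ x) + s (proj₂ y)) → size x y ≤ k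
  size-≤ {x} {y} k h le = ℕₚ.+-cancelʳ-≤ (r (proj₁ x) + s (proj₂ y)) _ _ (ℕₚ.≤-trans (ℕₚ.≤-reflexive (size-+ h)) le)

  ∈D⇒∈₁ : ∀ x {y e} → Vertex y → e ∈ D x y → e ∈ proj₁ y
  ∈D⇒∈₁ x {y} {e} vy p = decidable-stable (e Sₚ.∈? _) (λ q → ∈D⁻₂ x y p (cover vy _ q))

  ∈D⇒∈₂ : ∀ {x} y {e} → Vertex x → e ∈ D x y → e ∈ proj₂ x
  ∈D⇒∈₂ {x} y vx p = cover vx _ (∈D⁻₁ x y p)

  ≺⇒1≤size : ∀ {x y} → Vertex x → Vertex y → x ≺ y → 1 ≤ size x y
  ≺⇒1≤size {x} {y} vx vy (h , ne) with ≡-or-witness (≼₁ h) | ≡-or-witness (≼₂ h)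
  ... | inj₁ p | inj₁ q           = contradiction (cong₂ _,_ p (sym q)) ne
  ... | inj₂ (e , p , q) | _      = size-≥ 1 0 h (flat-< M (flatM vx) (≼₁ h) p q) (rk-mono N (≼₂ h))
  ... | inj₁ _ | inj₂ (e , p , q) = size-≥ 0 1 h (rk-mono M (≼₁ h)) (flat-< N (flatN vy) (≼₂ h) p q)

  module _ {x y : BF m} {e : Fin m} (vx : Vertex x) (vy : Vertex y) (x≼y : x ≼ y) where

    D⇒<₁ : e ∈ D x y → r (proj₁ x) < r (proj₁ y)
    D⇒<₁ e∈D = flat-< M (flatM vx) (≼₁ x≼y) (∈D⇒∈₁ x vy e∈D) (∈D⁻₁ x y e∈D)

    D⇒<₂ : e ∈ D x y → s (proj₂ y) < s (proj₂ x)
    D⇒<₂ e∈D = flat-< N (flatN vy) (≼₂ x≼y) (∈D⇒∈₂ y vx e∈D) (∈D⁻₂ x y e∈D)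

    D⇒2≤size : e ∈ D x y → 2 ≤ size x y
    D⇒2≤size e∈D = size-≥ 1 1 x≼y (D⇒<₁ e∈D) (D⇒<₂ e∈D)

  module _ {x y : BF m} (x≼y : x ≼ y) (k : ℕ) (size≤ : size x y ≤ suc k) where
    private
      ar : ∀ k a b c d z → z + (a + d) ≡ b + c → z ≤ suc k → suc a ≤ b → c ≤ k + d
      ar k a b c d z h p q = lin≤ 0 (ℕₚ.+-mono-≤ (ℕₚ.+-mono-≤ p q) (ℕₚ.≤-reflexive (sym h))) (lem k a b c d z)
        where
        lem : ∀ k a b c d z → c + (suc k + b + (z + (a + d))) ≡ k + d + (z + suc a + (b + c))
        lem = ℕRing.solve-∀
      ar' : ∀ k a b c d z → z + (a + d) ≡ b + c → z ≤ suc k → d ≤ c → b ≤ suc k + a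
      ar' k a b c d z h p q = lin≤ 0 (ℕₚ.+-mono-≤ (ℕₚ.+-mono-≤ p q) (ℕₚ.≤-reflexive (sym h))) (lem k a b c d z)
        where
        lem : ∀ k a b c d z → b + (suc k + c + (z + (a + d))) ≡ suc k + a + (z + d + (b + c))
        lem = ℕRing.solve-∀
      swapped : ∀ a b c d z → z + (a + d) ≡ b + c → z + (d + a) ≡ c + b
      swapped a b c d z h = trans (cong (λ t → z + t) (ℕₚ.+-comm d a)) (trans h (ℕₚ.+-comm b c))

    -- The two rank differences share the size, so a rise of the first rank leaves at most `k` for
    -- the second.
    size-<₁ : r (proj₁ x) < r (proj₁ y) → s (proj₂ x) ≤ k + s (proj₂ y)
    size-<₁ lt = ar k (r (proj₁ x)) (r (proj₁ y)) (s (proj₂ x)) (s (proj₂ y)) (size x y) (size-+ x≼y) size≤ lt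

    size-<₂ : s (proj₂ y) < s (proj₂ x) → r (proj₁ y) ≤ k + r (proj₁ x)
    size-<₂ lt = ar k (s (proj₂ y)) (s (proj₂ x)) (r (proj₁ y)) (r (proj₁ x)) (size x y)
      (swapped (r (proj₁ x)) (r (proj₁ y)) (s (proj₂ x)) (s (proj₂ y)) (size x y) (size-+ x≼y)) size≤ lt

    size-≤₁ : r (proj₁ y) ≤ suc k + r (proj₁ x)
    size-≤₁ = ar' k (r (proj₁ x)) (r (proj₁ y)) (s (proj₂ x)) (s (proj₂ y)) (size x y) (size-+ x≼y) size≤ (rk-mono N (≼₂ x≼y))

    size-≤₂ : s (proj₂ x) ≤ suc k + s (proj₂ y)
    size-≤₂ = ar' k (s (proj₂ y)) (s (proj₂ x)) (r (proj₁ y)) (r (proj₁ x)) (size x y)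
      (swapped (r (proj₁ x)) (r (proj₁ y)) (s (proj₂ x)) (s (proj₂ y)) (size x y) (size-+ x≼y)) size≤ (rk-mono M (≼₁ x≼y))

  data Good (x y : BF m) : Set where
    single : (∀ e → e ∉ D x y) → size x y ≡ 1 → Good x y
    spans  : ∀ {e} → e ∈ D x y → r (proj₁ y) ≤ r (proj₁ x ∪ D x y) → s (proj₂ x) ≤ s (proj₂ y ∪ D x y) → Good x y

  Tight : BF m → BF m → Set
  Tight x y = Good x y × (Nonempty (D x y) → size x y ≡ ∣ D x y ∣)

  good-size : ∀ {x y e} → x ≼ y → e ∈ D x y → Good x y → size x y ≤ ∣ D x y ∣
  good-size h e∈D (single d _) = contradiction e∈D (d _)
  good-size {x} {y} h _ (spans _ p q) = size-≤ _ h (ℕₚ.≤-trans (ℕₚ.+-mono-≤ p q)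
    (rk-span-≤ {M = M} {N} dual (λ i p → ∈D⁻₂ x y p) (λ i p q → ∈D⁺ x y p q)))

  module _ {x ρ y : BF m} {e : Fin m} (vx : Vertex x) (vρ : Vertex ρ) (vy : Vertex y) (x≼ρ : x ≼ ρ) (ρ≼y : ρ ≼ y)
           (e∈D : e ∈ D x y) (e∈₁ : e ∈ proj₁ ρ) (e∈₂ : e ∈ proj₂ ρ) where

    inner-<₁ : r (proj₁ x) < r (proj₁ ρ)
    inner-<₁ = flat-< M (flatM vx) (≼₁ x≼ρ) e∈₁ (∈D⁻₁ x y e∈D)

    inner-<₂ : s (proj₂ y) < s (proj₂ ρ)
    inner-<₂ = flat-< N (flatN vy) (≼₂ ρ≼y) e∈₂ (∈D⁻₂ x y e∈D)

    D-subˡ : D x ρ ⊆ D x y ∖ e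
    D-subˡ p = ∖⁺ (∈D⁺ x y (∈D⁻₁ x ρ p) (λ q → ∈D⁻₂ x ρ p (≼₂ ρ≼y q))) (λ { refl → ∈D⁻₂ x ρ p e∈₂ })

    D-subʳ : D ρ y ⊆ D x y ∖ e
    D-subʳ p = ∖⁺ (∈D⁺ x y (λ q → ∈D⁻₁ ρ y p (≼₁ x≼ρ q)) (∈D⁻₂ ρ y p)) (λ { refl → ∈D⁻₁ ρ y p e∈₁ })

    -- Both halves miss e, and they are disjoint because the elements of `D x ρ` lie in the first
    -- set of `ρ`.
    ∣D∣-split : suc (∣ D x ρ ∣ + ∣ D ρ y ∣) ≤ ∣ D x y ∣
    ∣D∣-split = begin
      suc (∣ D x ρ ∣ + ∣ D ρ y ∣) ≡⟨ cong suc (∣∪∣-disjoint (D x ρ) (D ρ y) disj) ⟨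
      suc ∣ D x ρ ∪ D ρ y ∣       ≤⟨ s≤s (Sₚ.p⊆q⇒∣p∣≤∣q∣ (∪-⊆ D-subˡ D-subʳ)) ⟩
      suc ∣ D x y ∖ e ∣           ≡⟨ ∣∖∣ e∈D ⟩
      ∣ D x y ∣                   ∎
      where
      open ℕₚ.≤-Reasoning
      disj : ∀ i → i ∈ D x ρ → i ∉ D ρ y
      disj i p q = ∈D⁻₁ ρ y q (∈D⇒∈₁ x vρ p)

    private
      -- Transitivity of spanning: `Z` spans `B` over `A` and `Z'` spans `C` over `B`, so a set `W`
      -- containing both spans `C` over `A`.
      chase : ∀ (K : Matroid m) {A B C W} → A ⊆ B →
        (∃ λ Z → Z ⊆ W × Z ⊆ B × rk K B ≤ rk K (A ∪ Z)) →
        (∃ λ Z → Z ⊆ W × rk K C ≤ rk K (B ∪ Z)) → rk K C ≤ rk K (A ∪ W)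
      chase K {A} {B} {C} {W} A⊆B (Z , Z⊆W , Z⊆B , h) (Z' , Z'⊆W , h') = begin
        rk K C             ≤⟨ h' ⟩
        rk K (B ∪ Z')      ≤⟨ rk-mono K (∪-mono id (λ p → ∈ʳ A (Z'⊆W p))) ⟩
        rk K (B ∪ (A ∪ W)) ≤⟨ ℕₚ.+-cancelʳ-≤ (rk K B) _ _ (ℕₚ.≤-trans
          (ℕₚ.+-monoʳ-≤ (rk K (B ∪ (A ∪ W))) h)
          (ℕₚ.≤-trans (rk-submod-⊆ K {B} {A ∪ W} id (∪-⊆ A⊆B Z⊆B) (∪-mono id Z⊆W))
            (ℕₚ.≤-reflexive (ℕₚ.+-comm (rk K B) _)))) ⟩
        rk K (A ∪ W)       ∎
        where open ℕₚ.≤-Reasoning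

      e⊆D : ⁅ e ⁆ ⊆ D x y
      e⊆D = ⁅⁆-⊆ e∈D

      ⊥-sub : ∀ {S : Subset m} → ⊥ ⊆ S
      ⊥-sub p = contradiction p Sₚ.∉⊥

    -- In a half with empty D the element e does the spanning. Such a half has size 1; since e is in
    -- both sets of `ρ`, the lower half spends it on the rank of `M` and the upper half on the rank
    -- of `N`. Then e spans this rise, and the other rank does not change.
    good-join : Good x ρ → Good ρ y → Good x y
    good-join gˡ gʳ = spans e∈D (chase M (≼₁ x≼ρ) (Mˡ gˡ) (Mʳ gʳ)) (chase N (≼₂ ρ≼y) (Nˡ gʳ) (Nʳ gˡ))
      where
      Mˡ : Good x ρ → ∃ λ Z → Z ⊆ D x y × Z ⊆ proj₁ ρ × r (proj₁ ρ) ≤ r (proj₁ x ∪ Z)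
      Mˡ (single _ eq)  = ⁅ e ⁆ , e⊆D , ⁅⁆-⊆ e∈₁ , ℕₚ.≤-trans (size-≤₁ x≼ρ 0 (ℕₚ.≤-reflexive eq)) (flatM vx e (∈D⁻₁ x y e∈D))
      Mˡ (spans _ h _)  = D x ρ , (λ p → ∖-⊆ (D-subˡ p)) , (λ p → ∈D⇒∈₁ x vρ p) , h
      Mʳ : Good ρ y → ∃ λ Z → Z ⊆ D x y × r (proj₁ y) ≤ r (proj₁ ρ ∪ Z)
      Mʳ (single _ eq)  = ⊥ , ⊥-sub , ℕₚ.≤-trans (size-<₂ ρ≼y 0 (ℕₚ.≤-reflexive eq) inner-<₂) (rk-mono M (∈ˡ _))
      Mʳ (spans _ h _)  = D ρ y , (λ p → ∖-⊆ (D-subʳ p)) , h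
      Nˡ : Good ρ y → ∃ λ Z → Z ⊆ D x y × Z ⊆ proj₂ ρ × s (proj₂ ρ) ≤ s (proj₂ y ∪ Z)
      Nˡ (single _ eq)  = ⁅ e ⁆ , e⊆D , ⁅⁆-⊆ e∈₂ , ℕₚ.≤-trans (size-≤₂ ρ≼y 0 (ℕₚ.≤-reflexive eq)) (flatN vy e (∈D⁻₂ x y e∈D))
      Nˡ (spans _ _ h)  = D ρ y , (λ p → ∖-⊆ (D-subʳ p)) , (λ p → ∈D⇒∈₂ y vρ p) , h
      Nʳ : Good x ρ → ∃ λ Z → Z ⊆ D x y × s (proj₂ x) ≤ s (proj₂ ρ ∪ Z)
      Nʳ (single _ eq)  = ⊥ , ⊥-sub , ℕₚ.≤-trans (size-<₁ x≼ρ 0 (ℕₚ.≤-reflexive eq) inner-<₁) (rk-mono N (∈ˡ _))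
      Nʳ (spans _ _ h)  = D x ρ , (λ p → ∖-⊆ (D-subˡ p)) , h

-- Flags of biflats as chains from ∅|E to E|∅

module Chains {m : ℕ} (M : Matroid m) (M-⊥ : Flat M ⊥) (N-⊥ : CoFlat M ⊥) (e₀ : Fin m) where

  N : Matroid m
  N = dualMatroid M

  dual : IsDual M N
  dual = dualMatroid-isDual M

  open Steps M N dual public

  Step : Set
  Step = BF m × BF m

  bot top : BF m
  bot = ⊥ , ⊤
  top = ⊤ , ⊥

  vertex-bot : Vertex bot
  vertex-bot = record { flatM = M-⊥ ; flatN = flat-⊤ N ; cover = λ _ _ → Sₚ.∈⊤ }

  vertex-top : Vertex top
  vertex-top = record { flatM = flat-⊤ M ; flatN = N-⊥ ; cover = λ _ p → contradiction Sₚ.∈⊤ p }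

  bot-≼ : ∀ {x} → bot ≼ x
  bot-≼ = (λ p → contradiction p Sₚ.∉⊥) , (λ _ → Sₚ.∈⊤)

  ≼-top : ∀ {x} → x ≼ top
  ≼-top = (λ _ → Sₚ.∈⊤) , (λ p → contradiction p Sₚ.∉⊥)

  bot≢top : bot ≢ top
  bot≢top eq = Sₚ.∉⊥ (subst (e₀ ∈_) (sym (cong proj₁ eq)) Sₚ.∈⊤)

  ≺-≼-trans : ∀ {x y z} → x ≺ y → y ≼ z → x ≺ z
  ≺-≼-trans (a , ne) b = ≼-trans a b , λ { refl → ne (≼-antisym a b) }

  ≼-≺-trans : ∀ {x y z} → x ≼ y → y ≺ z → x ≺ z
  ≼-≺-trans a (b , ne) = ≼-trans a b , λ { refl → ne (≼-antisym b a) }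

  -- τ is a chain strictly between bot and top in any order, and L the set of its consecutive pairs, with
  -- bot and top adjoined.
  data Built : List (BF m) → List Step → Set where
    base   : Built [] ((bot , top) ∷ [])
    insert : ∀ {τ L x y ρ rest} → Built τ L → L ↭ (x , y) ∷ rest → Vertex ρ → x ≺ ρ → ρ ≺ y →
             Built (ρ ∷ τ) ((x , ρ) ∷ (ρ , y) ∷ rest)

  record IsStep (st : Step) : Set where
    constructor isStep
    field
      source : Vertex (proj₁ st)
      target : Vertex (proj₂ st)
      less   : proj₁ st ≺ proj₂ st

    less≼ : proj₁ st ≼ proj₂ st
    less≼ = proj₁ less

  open IsStep public

  built-steps : ∀ {τ L} → Built τ L → All IsStep L
  built-steps base = isStep vertex-bot vertex-top (bot-≼ , bot≢top) ∷ []
  built-steps (insert b p vρ l u) with ↭ₚ.All-resp-↭ p (built-steps b)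
  ... | isStep vx vy _ ∷ hs = isStep vx vρ l ∷ isStep vρ vy u ∷ hs

  Ordered : Step → Step → Set
  Ordered (x , y) (x' , y') = y ≼ x' ⊎ y' ≼ x

  Ordered-sym : ∀ {st st'} → Ordered st st' → Ordered st' st
  Ordered-sym (inj₁ h) = inj₂ h
  Ordered-sym (inj₂ h) = inj₁ h

  -- The steps are intervals stacked on one another; hence a biflat inserted into one of them stays
  -- outside all the others.
  built-ordered : ∀ {τ L} → Built τ L → AllPairs Ordered L
  built-ordered base = [] ∷ []
  built-ordered (insert {x = x} {y} {ρ} b p vρ l u) with AllPairs-↭ (λ {s} {t} → Ordered-sym {s} {t}) p (built-ordered b)
  ... | h ∷ hs = (inj₁ ≼-refl ∷ All.map lower h) ∷ (All.map upper h ∷ hs)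
    where
    lower : ∀ {st} → Ordered (x , y) st → Ordered (x , ρ) st
    lower (inj₁ z) = inj₁ (≼-trans (proj₁ u) z)
    lower (inj₂ z) = inj₂ z
    upper : ∀ {st} → Ordered (x , y) st → Ordered (ρ , y) st
    upper (inj₁ z) = inj₁ z
    upper (inj₂ z) = inj₂ (≼-trans z (proj₁ l))

  Outside : BF m → Step → Set
  Outside t (x , y) = t ≼ x ⊎ y ≼ t

  built-outside : ∀ {τ L} → Built τ L → All (λ t → All (Outside t) L) τ
  built-outside base = []
  built-outside (insert {x = x} {y} {ρ} b p vρ l u)
    with AllPairs-↭ (λ {s} {t} → Ordered-sym {s} {t}) p (built-ordered b)
  ... | h ∷ _ = (inj₂ ≼-refl ∷ inj₁ ≼-refl ∷ All.map new h) ∷ All.map (λ o → old (↭ₚ.All-resp-↭ p o)) (built-outside b)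
    where
    new : ∀ {st} → Ordered (x , y) st → Outside ρ st
    new (inj₁ z) = inj₁ (≼-trans (proj₁ u) z)
    new (inj₂ z) = inj₂ (≼-trans z (proj₁ l))
    old : ∀ {t rest} → All (Outside t) ((x , y) ∷ rest) → All (Outside t) ((x , ρ) ∷ (ρ , y) ∷ rest)
    old (inj₁ z ∷ hs) = inj₁ z ∷ inj₁ (≼-trans z (proj₁ l)) ∷ hs
    old (inj₂ z ∷ hs) = inj₂ (≼-trans (proj₁ u) z) ∷ inj₂ z ∷ hs

  built-ends : ∀ {τ L} → Built τ L →
    All (λ st → (proj₁ st ≡ bot ⊎ proj₁ st L∈.∈ τ) × (proj₂ st ≡ top ⊎ proj₂ st L∈.∈ τ)) L
  built-ends base = (inj₁ refl , inj₁ refl) ∷ []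
  built-ends (insert b p vρ l u) with ↭ₚ.All-resp-↭ p (built-ends b)
  ... | (hx , hy) ∷ hs = (weaken hx , inj₂ (here refl)) ∷ (inj₂ (here refl) , weaken hy) ∷
                          All.map (λ (a , b) → weaken a , weaken b) hs
    where
    weaken : ∀ {z w ρ τ} → z ≡ w ⊎ z L∈.∈ τ → z ≡ w ⊎ z L∈.∈ (ρ ∷ τ)
    weaken (inj₁ e) = inj₁ e
    weaken (inj₂ q) = inj₂ (there q)

  record Inner (t : BF m) : Set where
    constructor inner
    field
      vertex : Vertex t
      bot≺   : bot ≺ t
      ≺top   : t ≺ top

  built-inner : ∀ {τ L} → Built τ L → All Inner τ
  built-inner base = []
  built-inner (insert b p vρ l u) = inner vρ (≼-≺-trans bot-≼ l) (≺-≼-trans u ≼-top) ∷ built-inner b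

  Apart : BF m → BF m → Set
  Apart x y = x ≢ y × Comparable x y

  built-apart : ∀ {τ L} → Built τ L → AllPairs Apart τ
  built-apart base = []
  built-apart (insert {x = x} {y} {ρ} b p vρ l u) =
    All.map (λ o → apart (All.head (↭ₚ.All-resp-↭ p o))) (built-outside b) ∷ built-apart b
    where
    apart : ∀ {t} → Outside t (x , y) → Apart ρ t
    apart (inj₁ h) = (λ { refl → proj₂ l (≼-antisym (proj₁ l) h) })
                   , inj₂ (≼₁ (≼-trans h (proj₁ l)) , ≼₂ (≼-trans h (proj₁ l)))
    apart (inj₂ h) = (λ { refl → proj₂ u (≼-antisym (proj₁ u) h) })
                   , inj₁ (≼₁ (≼-trans (proj₁ u) h) , ≼₂ (≼-trans (proj₁ u) h))

  built-length : ∀ {τ L} → Built τ L → length L ≡ suc (length τ)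
  built-length base = refl
  built-length (insert b p vρ l u) = cong suc (trans (sym (↭ₚ.↭-length p)) (built-length b))

  sizes : List Step → ℕ
  sizes L = ∑ℕ L (λ st → size (proj₁ st) (proj₂ st))

  built-sizes : ∀ {τ L} → Built τ L → sizes L ≡ m
  built-sizes base = begin
    (rk M ⊤ + rk N ⊤) ∸ (rk M ⊥ + rk N ⊥) + 0 ≡⟨ ℕₚ.+-identityʳ _ ⟩
    (rk M ⊤ + rk N ⊤) ∸ (rk M ⊥ + rk N ⊥)     ≡⟨ cong ((rk M ⊤ + rk N ⊤) ∸_) (cong₂ _+_ (rk-⊥ M) (rk-⊥ N)) ⟩
    rk M ⊤ + rk N ⊤                           ≡⟨ ℕₚ.+-comm (rk M ⊤) _ ⟩
    rk N ⊤ + rk M ⊤                           ≡⟨ rk-⊤+rk-⊤ {M = M} {N} dual ⟩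
    m                                         ∎
    where open ≡-Reasoning
  built-sizes {L = L} (insert {x = x} {y} {ρ} {rest} b p vρ l u) = trans
    (trans (sym (ℕₚ.+-assoc (size x ρ) _ _)) (cong (_+ sizes rest) (sym (size-split (proj₁ l) (proj₁ u)))))
    (trans (sym (∑ℕ-↭ _ p)) (built-sizes b))

  -- States member by member that e is outside the union of the sets F ∩ G; this form is stable
  -- under permutation and under dropping members.
  Gap : Fin m → List (BF m) → Set
  Gap e = All (λ t → ¬ (e ∈ proj₁ t × e ∈ proj₂ t))

  gap⁺ : ∀ {e} τ → e ∉ unionFG τ → Gap e τ
  gap⁺ []      h = []
  gap⁺ (t ∷ τ) h = (λ p → h (∈ˡ _ (Sₚ.x∈p∩q⁺ p))) ∷ gap⁺ τ (λ p → h (∈ʳ (proj₁ t ∩ proj₂ t) p))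

  gap⁻ : ∀ {e} τ → Gap e τ → e ∉ unionFG τ
  gap⁻ []      h        p = Sₚ.∉⊥ p
  gap⁻ (t ∷ τ) (h ∷ hs) p = [ (λ q → h (Sₚ.x∈p∩q⁻ _ _ q)) , gap⁻ τ hs ]′ (∈-∪ (proj₁ t ∩ proj₂ t) (unionFG τ) p)

  -- When `ρ` is inserted into the step whose D contains e, one of the two sets of `ρ` misses e, and
  -- this decides which half inherits e.
  gap-step : ∀ {τ L e} → Built τ L → Gap e τ → ∃ λ st → st L∈.∈ L × e ∈ D (proj₁ st) (proj₂ st)
  gap-step base [] = (bot , top) , here refl , ∈D⁺ bot top Sₚ.∉⊥ Sₚ.∉⊥
  gap-step {e = e} (insert {x = x} {y} {ρ} b p vρ l u) (h ∷ hs) with gap-step b hs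
  ... | st , st∈ , e∈D with ↭ₚ.∈-resp-↭ p st∈
  ... | there q   = st , there (there q) , e∈D
  ... | here refl with e Sₚ.∈? proj₁ ρ
  ... | yes e∈ρ = (x , ρ) , here refl , ∈D⁺ x ρ (∈D⁻₁ x y e∈D) (λ z → h (e∈ρ , z))
  ... | no e∉ρ  = (ρ , y) , there (here refl) , ∈D⁺ ρ y e∉ρ (∈D⁻₂ x y e∈D)

  step-gap : ∀ {τ L x y e} → Built τ L → (x , y) L∈.∈ L → e ∈ D x y → Gap e τ
  step-gap {x = x} {y} b st∈ e∈D = All.map (λ o → go (All.lookup o st∈)) (built-outside b)
    where
    go : ∀ {t} → Outside t (x , y) → ¬ (_ ∈ proj₁ t × _ ∈ proj₂ t)
    go (inj₁ h) (p , _) = ∈D⁻₁ x y e∈D (≼₁ h p)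
    go (inj₂ h) (_ , q) = ∈D⁻₂ x y e∈D (≼₂ h q)

  Beside : BF m → BF m → Set
  Beside ρ t = ρ ≢ t × (ρ ≼ t ⊎ t ≼ ρ)

  beside : ∀ {ρ t} → Apart ρ t → Beside ρ t
  beside (ne , inj₁ (a , b)) = ne , inj₁ (a , b)
  beside (ne , inj₂ (a , b)) = ne , inj₂ (a , b)

  locate : ∀ {τ L ρ} → Built τ L → Inner ρ → All (Beside ρ) τ →
    ∃ λ st → st L∈.∈ L × proj₁ st ≺ ρ × ρ ≺ proj₂ st
  locate base (inner _ l u) [] = _ , here refl , l , u
  locate {ρ = ρ'} (insert {x = x} {y} {ρ} b p vρ l u) i ((ne , c) ∷ cs) with locate b i cs
  ... | st , st∈ , lo , hi with ↭ₚ.∈-resp-↭ p st∈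
  ... | there q   = st , there (there q) , lo , hi
  ... | here refl with c
  ... | inj₁ h = (x , ρ) , here refl , lo , (h , ne)
  ... | inj₂ h = (ρ , y) , there (here refl) , (h , ne ∘ sym) , hi

  -- The first set of `x` and the second set of `y` miss e, so `ρ` can be neither below `x` nor
  -- above `y`; comparability leaves only the interior of the step.
  gap-between : ∀ {τ L x y e ρ} → Built τ L → (x , y) L∈.∈ L → e ∈ D x y → Inner ρ → All (Beside ρ) τ →
    e ∈ proj₁ ρ → e ∈ proj₂ ρ → x ≺ ρ × ρ ≺ y
  gap-between {x = x} {y} {ρ = ρ} b st∈ e∈D (inner _ lo hi) cs e∈₁ e∈₂ with All.lookup (built-ends b) st∈
  ... | ex , ey = below ex , above ey
    where
    below : x ≡ bot ⊎ x L∈.∈ _ → x ≺ ρ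
    below (inj₁ refl) = lo
    below (inj₂ x∈) with All.lookup cs x∈
    ... | ne , inj₁ h = contradiction (≼₁ h e∈₁) (∈D⁻₁ x y e∈D)
    ... | ne , inj₂ h = h , ne ∘ sym
    above : y ≡ top ⊎ y L∈.∈ _ → ρ ≺ y
    above (inj₁ refl) = hi
    above (inj₂ y∈) with All.lookup cs y∈
    ... | ne , inj₁ h = h , ne
    ... | ne , inj₂ h = contradiction (≼₂ h e∈₂) (∈D⁻₂ x y e∈D)

  biflat⇒inner : ∀ {t} → Biflat M t → Inner t
  biflat⇒inner {F , G} (fF , fG , (i , i∈F) , (j , j∈G) , _ , F∪G≡⊤) = inner
    (record { flatM = fF ; flatN = fG
            ; cover = λ i i∉F → [ (λ p → contradiction p i∉F) , id ]′ (∈-∪ F G (subst (i ∈_) (sym F∪G≡⊤) Sₚ.∈⊤)) })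
    (bot-≼ , λ { refl → Sₚ.∉⊥ i∈F }) (≼-top , λ { refl → Sₚ.∉⊥ j∈G })

  -- The element e excludes E|E, and an empty set on either side would by covering turn the pair
  -- into an end of the chain.
  inner⇒biflat : ∀ {t e} → Inner t → ¬ (e ∈ proj₁ t × e ∈ proj₂ t) → Biflat M t
  inner⇒biflat {F , G} {e} (inner v (_ , lo) (_ , hi)) h =
    flatM v , flatN v , nonempty₁ , nonempty₂ ,
    (λ { (refl , refl) → h (Sₚ.∈⊤ , Sₚ.∈⊤) }) ,
    Sₚ.⊆-antisym (λ _ → Sₚ.∈⊤) (λ {i} _ → cov i)
    where
    cov : ∀ i → i ∈ F ∪ G
    cov i with i Sₚ.∈? F
    ... | yes p = ∈ˡ _ p
    ... | no p  = ∈ʳ F (cover v i p)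
    nonempty₁ : NonEmpty F
    nonempty₁ with Sₚ.nonempty? F
    ... | yes p = p
    ... | no p  = contradiction (cong₂ _,_ (sym F≡⊥) (Sₚ.⊆-antisym (λ {i} _ → cover v i (λ q → p (i , q))) (λ _ → Sₚ.∈⊤))) lo
      where
      F≡⊥ : F ≡ ⊥
      F≡⊥ = ∅-unique (λ i q → p (i , q))
    nonempty₂ : NonEmpty G
    nonempty₂ with Sₚ.nonempty? G
    ... | yes p = p
    ... | no p  = contradiction (cong₂ _,_
          (Sₚ.⊆-antisym (λ _ → Sₚ.∈⊤) (λ {i} _ → decidable-stable (i Sₚ.∈? F) (λ q → p (i , cover v i q))))
          (∅-unique (λ i q → p (i , q)))) hi

  biflag⇒built : ∀ {τ} → All (Biflat M) τ → AllPairs Apart τ → ∃ λ L → Built τ L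
  biflag⇒built [] [] = _ , base
  biflag⇒built (h ∷ hs) (c ∷ cs) with biflag⇒built hs cs
  ... | L , b with locate b (biflat⇒inner h) (All.map beside c)
  ... | st , st∈ , lo , hi with extract st∈
  ... | rest , p = _ , insert b p (Inner.vertex (biflat⇒inner h)) lo hi

  built⇒biflag : ∀ {τ L e} → Built τ L → Gap e τ → IsBiflag M τ
  built⇒biflag {τ} b g = zipAll (built-inner b) g , built-apart b , ∉⇒≢⊤ (gap⁻ τ g)
    where
    zipAll : ∀ {τ} → All Inner τ → Gap _ τ → All (Biflat M) τ
    zipAll []       []       = []
    zipAll (i ∷ is) (h ∷ hs) = inner⇒biflat i h ∷ zipAll is hs

  biflag-gap : ∀ {τ} → IsBiflag M τ → ∃ λ e → Gap e τ
  biflag-gap {τ} (_ , _ , ne) with ∉-witness ne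
  ... | e , e∉ = e , gap⁺ τ e∉

-- The piecewise linear functions δ_j on rays

foldr-⊔-≤ : ∀ {A : Set} (g : A → ℤ) {b₀ b} l → b₀ ℤ.≤ b → (∀ i → g i ℤ.≤ b) →
  foldr (λ i acc → acc ℤ.⊔ g i) b₀ l ℤ.≤ b
foldr-⊔-≤ g []      h hs = h
foldr-⊔-≤ g (i ∷ l) h hs = ℤₚ.⊔-lub (foldr-⊔-≤ g l h hs) (hs i)

≤-foldr-⊔ : ∀ {A : Set} (g : A → ℤ) b₀ {i l} → i L∈.∈ l → g i ℤ.≤ foldr (λ i acc → acc ℤ.⊔ g i) b₀ l
≤-foldr-⊔ g b₀ {i} {_ ∷ l} (here refl) = ℤₚ.i≤j⊔i (foldr (λ i acc → acc ℤ.⊔ g i) b₀ l) (g i)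
≤-foldr-⊔ g b₀ {i} {k ∷ l} (there p)   = ℤₚ.≤-trans (≤-foldr-⊔ g b₀ p) (ℤₚ.i≤i⊔j (foldr (λ i acc → acc ℤ.⊔ g i) b₀ l) (g k))

-- Each element lies in F or G and some element lies in only one of them, so the minimum of the sum
-- of the two indicators is 1.
δray-biflat : ∀ {m} (M : Matroid m) (j : Fin m) {ρ} → Biflat M ρ →
  δray j ρ ≡ ind (proj₁ ρ) j +ℤ ind (proj₂ ρ) j -ℤ + 1
δray-biflat {m} M j {F , G} (_ , _ , _ , _ , ne , F∪G≡⊤) = ℤₚ.≤-antisym
  (foldr-⊔-≤ (λ i → v j -ℤ v i) (allFin m) (le j) le)
  (ℤₚ.≤-trans (ℤₚ.≤-reflexive (cong (λ z → v j -ℤ z) (sym v-i₀))) (≤-foldr-⊔ (λ i → v j -ℤ v i) _ (L∈ₚ.∈-allFin i₀)))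
  where
  v : Fin m → ℤ
  v i = ind F i +ℤ ind G i
  w : ∃ λ i → i ∉ F ∩ G
  w = ∉-witness (λ eq → ne (all₁ eq , all₂ eq))
    where
    all₁ : F ∩ G ≡ ⊤ → F ≡ ⊤
    all₁ eq = Sₚ.⊆-antisym (λ _ → Sₚ.∈⊤) (λ {i} p → proj₁ (Sₚ.x∈p∩q⁻ F G (subst (i ∈_) (sym eq) p)))
    all₂ : F ∩ G ≡ ⊤ → G ≡ ⊤
    all₂ eq = Sₚ.⊆-antisym (λ _ → Sₚ.∈⊤) (λ {i} p → proj₂ (Sₚ.x∈p∩q⁻ F G (subst (i ∈_) (sym eq) p)))
  i₀ : Fin m
  i₀ = proj₁ w
  in-∪ : ∀ i → i ∈ F ⊎ i ∈ G
  in-∪ i = ∈-∪ F G (subst (i ∈_) (sym F∪G≡⊤) Sₚ.∈⊤)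
  le : ∀ i → v j -ℤ v i ℤ.≤ v j -ℤ + 1
  le i = ℤₚ.+-monoʳ-≤ (v j) (ℤₚ.neg-mono-≤ (1≤v i))
    where
    1≤v : ∀ i → + 1 ℤ.≤ v i
    1≤v i with i Sₚ.∈? F | i Sₚ.∈? G
    ... | yes p | yes q rewrite ind-∈ p | ind-∈ q = ℤ.+≤+ (s≤s z≤n)
    ... | yes p | no q  rewrite ind-∈ p | ind-∉ q = ℤₚ.≤-refl
    ... | no p  | yes q rewrite ind-∉ p | ind-∈ q = ℤₚ.≤-refl
    ... | no p  | no q  = ⊥-elim ([ p , q ]′ (in-∪ i))
  v-i₀ : v i₀ ≡ + 1
  v-i₀ with i₀ Sₚ.∈? F | i₀ Sₚ.∈? G
  ... | yes p | yes q = contradiction (Sₚ.x∈p∩q⁺ (p , q)) (proj₂ w)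
  ... | yes p | no q  rewrite ind-∈ p | ind-∉ q = refl
  ... | no p  | yes q rewrite ind-∉ p | ind-∈ q = refl
  ... | no p  | no q  = ⊥-elim ([ p , q ]′ (in-∪ i₀))

module _ {m : ℕ} (M : Matroid m) {e : Fin m} {ρ : BF m} (bf : Biflat M ρ) where

  δray-in : e ∈ proj₁ ρ → e ∈ proj₂ ρ → δray e ρ ≡ + 1
  δray-in p q rewrite δray-biflat M e bf | ind-∈ p | ind-∈ q = refl

  δray-out : ¬ (e ∈ proj₁ ρ × e ∈ proj₂ ρ) → δray e ρ ≡ + 0
  δray-out h with e Sₚ.∈? proj₁ ρ | e Sₚ.∈? proj₂ ρ
  ... | yes p | yes q = contradiction (p , q) h
  ... | yes p | no q  rewrite δray-biflat M e bf | ind-∈ p | ind-∉ q = refl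
  ... | no p  | yes q rewrite δray-biflat M e bf | ind-∉ p | ind-∈ q = refl
  ... | no p  | no q  = ⊥-elim ([ p , q ]′ (∈-∪ (proj₁ ρ) (proj₂ ρ)
                          (subst (e ∈_) (sym (proj₂ (proj₂ (proj₂ (proj₂ (proj₂ bf)))))) Sₚ.∈⊤)))

-- On biflats the functions δ_j differ by functions linear on N_{E,E}, which vanish on the
-- relation between the rays; hence the defining expression of the cap product is independent of j.
module _ {m : ℕ} (M : Matroid m) {I : Set} (L : List (BF m)) (c : BF m → ℤ) (L' : List I) (a : I → ℤ) (t : I → BF m)
         (c-biflat : ∀ ρ → c ρ ≢ + 0 → Biflat M ρ) (t-biflat : ∀ i → Biflat M (t i)) (λ₁ λ₂ : ℤ)
         (eq₁ : ∀ i → ∑ L (λ ρ → c ρ *ℤ ind (proj₁ ρ) i) -ℤ ∑ L' (λ k → a k *ℤ ind (proj₁ (t k)) i) ≡ λ₁)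
         (eq₂ : ∀ i → ∑ L (λ ρ → c ρ *ℤ ind (proj₂ ρ) i) -ℤ ∑ L' (λ k → a k *ℤ ind (proj₂ (t k)) i) ≡ λ₂) where

  private
    linear : ∀ {A : Set} (K : List A) (b : A → ℤ) (u : A → BF m) j →
      (∀ x → b x *ℤ δray j (u x) ≡ b x *ℤ (ind (proj₁ (u x)) j +ℤ ind (proj₂ (u x)) j -ℤ + 1)) →
      ∑ K (λ x → b x *ℤ δray j (u x)) ≡
      ∑ K (λ x → b x *ℤ ind (proj₁ (u x)) j) +ℤ ∑ K (λ x → b x *ℤ ind (proj₂ (u x)) j) -ℤ ∑ K b
    linear K b u j h = begin
      ∑ K (λ x → b x *ℤ δray j (u x))
        ≡⟨ ∑-cong K (λ x → trans (h x) (lem (b x) (ind (proj₁ (u x)) j) (ind (proj₂ (u x)) j))) ⟩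
      ∑ K (λ x → b x *ℤ ind (proj₁ (u x)) j +ℤ b x *ℤ ind (proj₂ (u x)) j -ℤ b x)
        ≡⟨ ∑-- K _ _ ⟩
      ∑ K (λ x → b x *ℤ ind (proj₁ (u x)) j +ℤ b x *ℤ ind (proj₂ (u x)) j) -ℤ ∑ K b
        ≡⟨ cong (_-ℤ ∑ K b) (∑-+ K _ _) ⟩
      ∑ K (λ x → b x *ℤ ind (proj₁ (u x)) j) +ℤ ∑ K (λ x → b x *ℤ ind (proj₂ (u x)) j) -ℤ ∑ K b ∎
      where
      open ≡-Reasoning
      lem : ∀ b p q → b *ℤ (p +ℤ q -ℤ + 1) ≡ b *ℤ p +ℤ b *ℤ q -ℤ b
      lem = ℤRing.solve-∀

    δ-value : ∀ j → ∑ L (λ ρ → c ρ *ℤ δray j ρ) -ℤ ∑ L' (λ k → a k *ℤ δray j (t k)) ≡ λ₁ +ℤ λ₂ -ℤ (∑ L c -ℤ ∑ L' a)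
    δ-value j = begin
      ∑ L (λ ρ → c ρ *ℤ δray j ρ) -ℤ ∑ L' (λ k → a k *ℤ δray j (t k))
        ≡⟨ cong₂ _-ℤ_ (linear L c id j on-c) (linear L' a t j (λ k → cong (a k *ℤ_) (δray-biflat M j (t-biflat k)))) ⟩
      (x +ℤ y -ℤ ∑ L c) -ℤ (x' +ℤ y' -ℤ ∑ L' a)
        ≡⟨ lem x y (∑ L c) x' y' (∑ L' a) ⟩
      (x -ℤ x') +ℤ (y -ℤ y') -ℤ (∑ L c -ℤ ∑ L' a)
        ≡⟨ cong₂ (λ p q → p +ℤ q -ℤ (∑ L c -ℤ ∑ L' a)) (eq₁ j) (eq₂ j) ⟩
      λ₁ +ℤ λ₂ -ℤ (∑ L c -ℤ ∑ L' a) ∎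
      where
      open ≡-Reasoning
      x y x' y' : ℤ
      x = ∑ L (λ ρ → c ρ *ℤ ind (proj₁ ρ) j)
      y = ∑ L (λ ρ → c ρ *ℤ ind (proj₂ ρ) j)
      x' = ∑ L' (λ k → a k *ℤ ind (proj₁ (t k)) j)
      y' = ∑ L' (λ k → a k *ℤ ind (proj₂ (t k)) j)
      lem : ∀ x y c x' y' a → (x +ℤ y -ℤ c) -ℤ (x' +ℤ y' -ℤ a) ≡ (x -ℤ x') +ℤ (y -ℤ y') -ℤ (c -ℤ a)
      lem = ℤRing.solve-∀
      on-c : ∀ ρ → c ρ *ℤ δray j ρ ≡ c ρ *ℤ (ind (proj₁ ρ) j +ℤ ind (proj₂ ρ) j -ℤ + 1)
      on-c ρ with c ρ ℤₚ.≟ + 0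
      ... | yes c≡0 rewrite c≡0 = refl
      ... | no c≢0 = cong (c ρ *ℤ_) (δray-biflat M j (c-biflat ρ c≢0))

  δ-independent : ∀ j j' → ∑ L (λ ρ → c ρ *ℤ δray j ρ) -ℤ ∑ L' (λ k → a k *ℤ δray j (t k)) ≡
                           ∑ L (λ ρ → c ρ *ℤ δray j' ρ) -ℤ ∑ L' (λ k → a k *ℤ δray j' (t k))
  δ-independent j j' = trans (δ-value j) (sym (δ-value j'))

-- Spans of rays modulo e_E and f_E

∑-allFin-suc : ∀ n (f : Fin (suc n) → ℤ) → ∑ (allFin (suc n)) f ≡ f zero +ℤ ∑ (allFin n) (f ∘ suc)
∑-allFin-suc n f = cong (λ l → f zero +ℤ sumℤ l) (trans (Listₚ.map-tabulate suc f) (sym (Listₚ.map-tabulate id (f ∘ suc))))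

module _ {m : ℕ} where

  -- The vector (v , w) is a combination of the rays of the flag up to multiples of e_E and f_E. The
  -- coefficients are peeled off ray by ray, so that a relation over `t ∷ τ` restricts to one over
  -- `τ`.
  Span : List (BF m) → (Fin m → ℤ) → (Fin m → ℤ) → Set
  Span []      v w = Σ ℤ λ λ₁ → Σ ℤ λ λ₂ → (∀ i → v i ≡ λ₁) × (∀ i → w i ≡ λ₂)
  Span (t ∷ τ) v w = Σ ℤ λ α → Span τ (λ i → v i -ℤ α *ℤ ind (proj₁ t) i) (λ i → w i -ℤ α *ℤ ind (proj₂ t) i)

  span-cong : ∀ τ {v w v' w'} → (∀ i → v i ≡ v' i) → (∀ i → w i ≡ w' i) → Span τ v w → Span τ v' w'
  span-cong []      p q (a , b , h , h') = a , b , (λ i → trans (sym (p i)) (h i)) , (λ i → trans (sym (q i)) (h' i))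
  span-cong (t ∷ τ) p q (α , s) = α , span-cong τ (λ i → cong (_-ℤ α *ℤ ind (proj₁ t) i) (p i))
                                                  (λ i → cong (_-ℤ α *ℤ ind (proj₂ t) i) (q i)) s

  span-+ : ∀ τ {v w v' w'} → Span τ v w → Span τ v' w' → Span τ (λ i → v i +ℤ v' i) (λ i → w i +ℤ w' i)
  span-+ []      (a , b , h , h') (a' , b' , k , k') =
    a +ℤ a' , b +ℤ b' , (λ i → cong₂ _+ℤ_ (h i) (k i)) , (λ i → cong₂ _+ℤ_ (h' i) (k' i))
  span-+ (t ∷ τ) {v} {w} {v'} {w'} (α , s) (β , s') = α +ℤ β , span-cong τ
    (λ i → lem (v i) (v' i) α β (ind (proj₁ t) i)) (λ i → lem (w i) (w' i) α β (ind (proj₂ t) i)) (span-+ τ s s')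
    where
    lem : ∀ v v' α β x → (v -ℤ α *ℤ x) +ℤ (v' -ℤ β *ℤ x) ≡ (v +ℤ v') -ℤ (α +ℤ β) *ℤ x
    lem = ℤRing.solve-∀

  span-* : ∀ τ k {v w} → Span τ v w → Span τ (λ i → k *ℤ v i) (λ i → k *ℤ w i)
  span-* []      k (a , b , h , h') = k *ℤ a , k *ℤ b , (λ i → cong (k *ℤ_) (h i)) , (λ i → cong (k *ℤ_) (h' i))
  span-* (t ∷ τ) k {v} {w} (α , s) = k *ℤ α , span-cong τ
    (λ i → lem k (v i) α (ind (proj₁ t) i)) (λ i → lem k (w i) α (ind (proj₂ t) i)) (span-* τ k s)
    where
    lem : ∀ k v α x → k *ℤ (v -ℤ α *ℤ x) ≡ k *ℤ v -ℤ k *ℤ α *ℤ x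
    lem = ℤRing.solve-∀

  span-const : ∀ τ a b → Span τ (λ _ → a) (λ _ → b)
  span-const []      a b = a , b , (λ _ → refl) , (λ _ → refl)
  span-const (t ∷ τ) a b = + 0 , span-cong τ (λ _ → lem a) (λ _ → lem b) (span-const τ a b)
    where
    lem : ∀ a → a ≡ a +ℤ + 0
    lem a = sym (ℤₚ.+-identityʳ a)

  span-∈ : ∀ {t τ} → t L∈.∈ τ → Span τ (ind (proj₁ t)) (ind (proj₂ t))
  span-∈ {t} {_ ∷ τ} (here refl) = + 1 , span-cong τ (λ i → lem (ind (proj₁ t) i)) (λ i → lem (ind (proj₂ t) i)) (span-const τ (+ 0) (+ 0))
    where
    lem : ∀ a → + 0 ≡ a -ℤ + 1 *ℤ a
    lem = ℤRing.solve-∀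
  span-∈ {t} {u ∷ τ} (there p) = + 0 , span-cong τ (λ i → lem (ind (proj₁ t) i)) (λ i → lem (ind (proj₂ t) i)) (span-∈ p)
    where
    lem : ∀ a → a ≡ a +ℤ + 0
    lem a = sym (ℤₚ.+-identityʳ a)

  span-∑ : ∀ {A : Set} τ (L : List A) {v w : A → Fin m → ℤ} → (∀ x → Span τ (v x) (w x)) →
    Span τ (λ i → ∑ L (λ x → v x i)) (λ i → ∑ L (λ x → w x i))
  span-∑ τ []      h = span-const τ (+ 0) (+ 0)
  span-∑ τ (x ∷ L) h = span-+ τ (h x) (span-∑ τ L h)

  coeff : ∀ τ {v w} → Span τ v w → Fin (length τ) → ℤ
  coeff (t ∷ τ) (α , s) zero    = α
  coeff (t ∷ τ) (α , s) (suc i) = coeff τ s i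

  λ₁-of λ₂-of : ∀ τ {v w} → Span τ v w → ℤ
  λ₁-of []      (a , b , _) = a
  λ₁-of (t ∷ τ) (α , s)     = λ₁-of τ s
  λ₂-of []      (a , b , _) = b
  λ₂-of (t ∷ τ) (α , s)     = λ₂-of τ s

  private
    shift : ∀ v x y → v -ℤ (x +ℤ y) ≡ (v -ℤ x) -ℤ y
    shift = ℤRing.solve-∀

  span-eq₁ : ∀ τ {v w} (s : Span τ v w) i →
    v i -ℤ ∑ (allFin (length τ)) (λ t → coeff τ s t *ℤ ind (proj₁ (List.lookup τ t)) i) ≡ λ₁-of τ s
  span-eq₁ []      {v} (a , b , h , h') i = trans (ℤₚ.+-identityʳ (v i)) (h i)
  span-eq₁ (t ∷ τ) {v} {w} (α , s) i = trans
    (cong (v i -ℤ_) (∑-allFin-suc (length τ) f))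
    (trans (shift (v i) (f zero) (∑ (allFin (length τ)) (f ∘ suc))) (span-eq₁ τ s i))
    where
    f : Fin (suc (length τ)) → ℤ
    f k = coeff (t ∷ τ) {v} {w} (α , s) k *ℤ ind (proj₁ (List.lookup (t ∷ τ) k)) i

  span-eq₂ : ∀ τ {v w} (s : Span τ v w) i →
    w i -ℤ ∑ (allFin (length τ)) (λ t → coeff τ s t *ℤ ind (proj₂ (List.lookup τ t)) i) ≡ λ₂-of τ s
  span-eq₂ []      {v} {w} (a , b , h , h') i = trans (ℤₚ.+-identityʳ (w i)) (h' i)
  span-eq₂ (t ∷ τ) {v} {w} (α , s) i = trans
    (cong (w i -ℤ_) (∑-allFin-suc (length τ) f))
    (trans (shift (w i) (f zero) (∑ (allFin (length τ)) (f ∘ suc))) (span-eq₂ τ s i))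
    where
    f : Fin (suc (length τ)) → ℤ
    f k = coeff (t ∷ τ) {v} {w} (α , s) k *ℤ ind (proj₂ (List.lookup (t ∷ τ) k)) i

-- Inserting a biflat into a tight step

rk-∪-cl : ∀ {m} (K : Matroid m) X S → rk K (X ∪ cl K S) ≡ rk K (X ∪ S)
rk-∪-cl K X S = ℕₚ.≤-antisym
  (ℕₚ.≤-trans (rk-mono K (∪-mono (∈ˡ S) id)) (rk-absorb K (λ i p → rk-cover K (∈ʳ X) (∈-cl⁻ K p))))
  (rk-mono K (∪-mono id (⊆-cl K)))

∈⇒1≤∣∣ : ∀ {m} {S : Subset m} {e} → e ∈ S → 1 ≤ ∣ S ∣
∈⇒1≤∣∣ p = ℕₚ.≤-trans (s≤s z≤n) (ℕₚ.≤-reflexive (∣∖∣ p))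

1≤∣∣⇒nonempty : ∀ {m} {S : Subset m} → 1 ≤ ∣ S ∣ → ∃ λ e → e ∈ S
1≤∣∣⇒nonempty {m} {S} h with Sₚ.nonempty? S
... | yes p = p
... | no p  = contradiction (ℕₚ.≤-trans h (ℕₚ.≤-reflexive (trans (cong ∣_∣ (∅-unique (λ i q → p (i , q)))) (Sₚ.∣⊥∣≡0 m)))) λ ()

module Refine {m : ℕ} (M N : Matroid m) (dual : IsDual M N) where
  open Steps M N dual

  private
    r s : Subset m → ℕ
    r = rk M
    s = rk N

  -- The value 1 for empty D has to be imposed: `beta` would give 0 there, its only summand being a
  -- corank 0.
  w : BF m × BF m → ℤ
  w (x , y) = if does (Sₚ.nonempty? (D x y)) then beta M (proj₁ x) (proj₁ x ∪ D x y) else + 1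

  w-empty : ∀ x y → (∀ e → e ∉ D x y) → w (x , y) ≡ + 1
  w-empty x y h rewrite dec-false (Sₚ.nonempty? (D x y)) (λ (e , p) → h e p) = refl

  w-nonempty : ∀ x y {e} → e ∈ D x y → w (x , y) ≡ beta M (proj₁ x) (proj₁ x ∪ D x y)
  w-nonempty x y p rewrite dec-true (Sₚ.nonempty? (D x y)) (_ , p) = refl

  module _ {x y : BF m} {e : Fin m} (vx : Vertex x) (vy : Vertex y) (x≼y : x ≼ y) (e∈D : e ∈ D x y) where
    private
      F G F' G' Δ : Subset m
      F  = proj₁ x
      G  = proj₂ x
      F' = proj₁ y
      G' = proj₂ y
      Δ  = D x y

      e∉F : e ∉ F
      e∉F = ∈D⁻₁ x y e∈D
      e∉G' : e ∉ G'
      e∉G' = ∈D⁻₂ x y e∈D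
      e∈F' : e ∈ F'
      e∈F' = ∈D⇒∈₁ x vy e∈D
      e∈G : e ∈ G
      e∈G = ∈D⇒∈₂ y vx e∈D
      Δ⊆F' : Δ ⊆ F'
      Δ⊆F' p = ∈D⇒∈₁ x vy p
      F<Fe : r F < r (F ∪ ⁅ e ⁆)
      F<Fe = flatM vx e e∉F
      G<Ge : s G' < s (G' ∪ ⁅ e ⁆)
      G<Ge = flatN vy e e∉G'
      F∪Δ⊆F' : F ∪ Δ ⊆ F'
      F∪Δ⊆F' = ∪-⊆ (≼₁ x≼y) Δ⊆F'

    -- Inserting ρ₁ contracts e, inserting ρ₂ deletes it.
    ρ₁ ρ₂ : BF m
    ρ₁ = cl M (F ∪ ⁅ e ⁆) , G
    ρ₂ = F' , cl N (G' ∪ ⁅ e ⁆)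

    vertex-ρ₁ : Vertex ρ₁
    vertex-ρ₁ = record { flatM = flat-cl M _ ; flatN = flatN vx ; cover = λ i h → cover vx i (λ p → h (⊆-cl M (∈ˡ _ p))) }

    vertex-ρ₂ : Vertex ρ₂
    vertex-ρ₂ = record { flatM = flatM vy ; flatN = flat-cl N _ ; cover = λ i h → ⊆-cl N (∈ˡ _ (cover vy i h)) }

    e∈ρ₁ : e ∈ proj₁ ρ₁
    e∈ρ₁ = ⊆-cl M (∈ʳ F (Sₚ.x∈⁅x⁆ e))

    e∈ρ₂ : e ∈ proj₂ ρ₂
    e∈ρ₂ = ⊆-cl N (∈ʳ G' (Sₚ.x∈⁅x⁆ e))

    x≺ρ₁ : x ≺ ρ₁
    x≺ρ₁ = ((λ p → ⊆-cl M (∈ˡ _ p)) , id) , (λ eq → e∉F (subst (λ z → e ∈ proj₁ z) (sym eq) e∈ρ₁))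

    ρ₁≺y : ρ₁ ≺ y
    ρ₁≺y = (cl-⊆ M (flatM vy) (∪-⊆ (≼₁ x≼y) (⁅⁆-⊆ e∈F')) , ≼₂ x≼y) , (λ eq → e∉G' (subst (λ z → e ∈ proj₂ z) eq e∈G))

    x≺ρ₂ : x ≺ ρ₂
    x≺ρ₂ = (≼₁ x≼y , cl-⊆ N (flatN vx) (∪-⊆ (≼₂ x≼y) (⁅⁆-⊆ e∈G))) , (λ eq → e∉F (subst (λ z → e ∈ proj₁ z) (sym eq) e∈F'))

    ρ₂≺y : ρ₂ ≺ y
    ρ₂≺y = (id , (λ p → ⊆-cl N (∈ˡ _ p))) , (λ eq → e∉G' (subst (λ z → e ∈ proj₂ z) eq e∈ρ₂))

    D-xρ₁ : ∀ i → i ∉ D x ρ₁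
    D-xρ₁ i p = ∈D⁻₂ x ρ₁ p (cover vx i (∈D⁻₁ x ρ₁ p))

    D-ρ₂y : ∀ i → i ∉ D ρ₂ y
    D-ρ₂y i p = ∈D⁻₂ ρ₂ y p (cover vy i (∈D⁻₁ ρ₂ y p))

    size-xρ₁ : size x ρ₁ ≡ 1
    size-xρ₁ = ℕₚ.≤-antisym
      (size-≤ 1 (proj₁ x≺ρ₁) (ℕₚ.≤-reflexive (cong (_+ s G) (rk-cl-∪⁅⁆ M (flatM vx) e∉F))))
      (≺⇒1≤size vx vertex-ρ₁ x≺ρ₁)

    size-ρ₂y : size ρ₂ y ≡ 1
    size-ρ₂y = ℕₚ.≤-antisym
      (size-≤ 1 (proj₁ ρ₂≺y) (ℕₚ.≤-reflexive (trans (cong (λ z → r F' + z) (rk-cl-∪⁅⁆ N (flatN vy) e∉G')) (ℕₚ.+-suc _ _))))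
      (≺⇒1≤size vertex-ρ₂ vy ρ₂≺y)

    tight-xρ₁ : Tight x ρ₁
    tight-xρ₁ = single D-xρ₁ size-xρ₁ , λ (i , p) → contradiction p (D-xρ₁ i)

    tight-ρ₂y : Tight ρ₂ y
    tight-ρ₂y = single D-ρ₂y size-ρ₂y , λ (i , p) → contradiction p (D-ρ₂y i)

    size-via-ρ₁ : size x y ≡ suc (size ρ₁ y)
    size-via-ρ₁ = trans (size-split (proj₁ x≺ρ₁) (proj₁ ρ₁≺y)) (cong (_+ size ρ₁ y) size-xρ₁)

    size-via-ρ₂ : size x y ≡ suc (size x ρ₂)
    size-via-ρ₂ = trans (size-split (proj₁ x≺ρ₂) (proj₁ ρ₂≺y)) (trans (cong (λ z → size x ρ₂ + z) size-ρ₂y) (ℕₚ.+-comm _ 1))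

    -- A gap makes both ranks rise, so within size 2 each rises by one and e alone spans both sides.
    good-2 : size x y ≤ 2 → Good x y
    good-2 h = spans e∈D
      (ℕₚ.≤-trans (size-<₂ x≼y 1 h (D⇒<₂ vx vy x≼y e∈D)) (ℕₚ.≤-trans F<Fe (rk-mono M (∪-mono id (⁅⁆-⊆ e∈D)))))
      (ℕₚ.≤-trans (size-<₁ x≼y 1 h (D⇒<₁ vx vy x≼y e∈D)) (ℕₚ.≤-trans G<Ge (rk-mono N (∪-mono id (⁅⁆-⊆ e∈D)))))

    -- Each rank rises by one, so the closure of F + e is already F' and the dual closure of G' + e
    -- is already G.
    size-2⇒ρ₁≡ρ₂ : size x y ≤ 2 → ρ₁ ≡ ρ₂
    size-2⇒ρ₁≡ρ₂ h = cong₂ _,_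
      (flat-rk-≡ M (flat-cl M _) (≼₁ (proj₁ ρ₁≺y))
        (ℕₚ.≤-trans (size-<₂ x≼y 1 h (D⇒<₂ vx vy x≼y e∈D)) (ℕₚ.≤-reflexive (sym (rk-cl-∪⁅⁆ M (flatM vx) e∉F)))))
      (sym (flat-rk-≡ N (flat-cl N _) (≼₂ (proj₁ x≺ρ₂))
        (ℕₚ.≤-trans (size-<₁ x≼y 1 h (D⇒<₁ vx vy x≼y e∈D)) (ℕₚ.≤-reflexive (sym (rk-cl-∪⁅⁆ N (flatN vy) e∉G'))))))

    ρ₁≡ρ₂⇒size-2 : ρ₁ ≡ ρ₂ → size x y ≡ 2
    ρ₁≡ρ₂⇒size-2 eq = trans size-via-ρ₁ (cong suc (trans (cong (λ z → size z y) eq) size-ρ₂y))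

    module _ (tight : Tight x y) where
      private
        size≡ : size x y ≡ ∣ Δ ∣
        size≡ = proj₂ tight (e , e∈D)

        spanM : r F' ≤ r (F ∪ Δ)
        spanM with proj₁ tight
        ... | single h _  = contradiction e∈D (h e)
        ... | spans _ h _ = h

        spanN : s G ≤ s (G' ∪ Δ)
        spanN with proj₁ tight
        ... | single h _  = contradiction e∈D (h e)
        ... | spans _ _ h = h

        ∣Δ∖e∣ : suc ∣ Δ ∖ e ∣ ≡ ∣ Δ ∣
        ∣Δ∖e∣ = ∣∖∣ e∈D

        abstract
          -- Tightness turns the lower bound 2 for the size into a lower bound for the cardinality
          -- of `Δ`.
          other : ∃ λ i → i ∈ Δ ∖ e
          other = 1≤∣∣⇒nonempty (ℕ.s≤s⁻¹ (ℕₚ.≤-trans (D⇒2≤size vx vy x≼y e∈D) (ℕₚ.≤-reflexive (trans size≡ (sym ∣Δ∖e∣)))))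

        F∪Δ∖e : (F ∪ Δ) ∖ e ≡ F ∪ (Δ ∖ e)
        F∪Δ∖e = Sₚ.⊆-antisym
          (λ {i} p → [ ∈ˡ _ , (λ q → ∈ʳ F (∖⁺ q (∖-≢ p))) ]′ (∈-∪ F Δ (∖-⊆ p)))
          (∪-⊆ (λ q → ∖⁺ (∈ˡ _ q) (λ { refl → e∉F q })) (λ q → ∖⁺ (∈ʳ F (∖-⊆ q)) (∖-≢ q)))

        add-back : ∀ {A : Subset m} → A ∪ Δ ⊆ (A ∪ (Δ ∖ e)) ∪ ⁅ e ⁆
        add-back {A} p with ∈-∪ A Δ p
        ... | inj₁ q = ∈ˡ _ (∈ˡ _ q)
        ... | inj₂ q with ∈-∪ (Δ ∖ e) ⁅ e ⁆ (subst (_ ∈_) (sym (∖-∪ e∈D)) q)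
        ... | inj₁ z = ∈ˡ _ (∈ʳ A z)
        ... | inj₂ z = ∈ʳ (A ∪ (Δ ∖ e)) z

        -- The flat G' does not contain e, and all other elements outside G' are in F or in `Δ`;
        -- orthogonality puts e into the closure of F ∪ (Δ - e).
        spanM∖e : r F' ≤ r (F ∪ (Δ ∖ e))
        spanM∖e = ℕₚ.≤-trans spanM (ℕₚ.≤-trans (rk-mono M add-back)
          (dual-absorb {M = N} {M} (dual-sym {M = M} {N} dual) G<Ge (∉-∪ e∉F ∉-∖)
            (λ i i∉G' i≢e → cov i i∉G' i≢e)))
          where
          cov : ∀ i → i ∉ G' → i ≢ e → i ∈ F ∪ (Δ ∖ e)
          cov i i∉G' i≢e with i Sₚ.∈? F
          ... | yes p = ∈ˡ _ p
          ... | no p  = ∈ʳ F (∖⁺ (∈D⁺ x y p i∉G') i≢e)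

        spanN∖e : s G ≤ s (G' ∪ (Δ ∖ e))
        spanN∖e = ℕₚ.≤-trans spanN (ℕₚ.≤-trans (rk-mono N add-back)
          (dual-absorb {M = M} {N} dual F<Fe (∉-∪ e∉G' ∉-∖)
            (λ i i∉F i≢e → cov i i∉F i≢e)))
          where
          cov : ∀ i → i ∉ F → i ≢ e → i ∈ G' ∪ (Δ ∖ e)
          cov i i∉F i≢e with i Sₚ.∈? G'
          ... | yes p = ∈ˡ _ p
          ... | no p  = ∈ʳ G' (∖⁺ (∈D⁺ x y i∉F p) i≢e)

      -- The element e is no loop over the flat F, and by `spanM∖e` it is no coloop.
      w-del-con : w (x , y) ≡ beta M F (F ∪ (Δ ∖ e)) +ℤ beta M (F ∪ ⁅ e ⁆) (F ∪ Δ)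
      w-del-con = trans (w-nonempty x y e∈D) (trans
        (beta-del-con M {F} {F ∪ Δ} {e} (∈ˡ _) (∈ʳ F e∈D) e∉F F<Fe
          (ℕₚ.≤-trans (rk-mono M F∪Δ⊆F') (ℕₚ.≤-trans spanM∖e (ℕₚ.≤-reflexive (cong r (sym F∪Δ∖e))))))
        (cong (λ B → beta M F B +ℤ beta M (F ∪ ⁅ e ⁆) (F ∪ Δ)) F∪Δ∖e))

      -- Here `Δ` consists of two parallel elements over F: deleting e leaves a single nonloop,
      -- contracting e leaves a loop.
      w-2 : size x y ≤ 2 → w (x , y) ≡ + 1
      w-2 h = trans w-del-con (cong₂ _+ℤ_ del con)
        where
        e' : Fin m
        e' = proj₁ other
        e'∈Δ : e' ∈ Δ
        e'∈Δ = ∖-⊆ (proj₂ other)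
        e'≢e : e' ≢ e
        e'≢e = ∖-≢ (proj₂ other)
        e'∉F : e' ∉ F
        e'∉F = ∈D⁻₁ x y e'∈Δ
        F'≤ : r F' ≤ suc (r F)
        F'≤ = size-<₂ x≼y 1 h (D⇒<₂ vx vy x≼y e∈D)
        only : Δ ∖ e ≡ ⁅ e' ⁆
        only = Sₚ.⊆-antisym back (⁅⁆-⊆ (proj₂ other))
          where
          back : Δ ∖ e ⊆ ⁅ e' ⁆
          back {i} p with i Finₚ.≟ e'
          ... | yes refl = Sₚ.x∈⁅x⁆ i
          ... | no ne    = ⊥-elim (ℕₚ.<⇒≱ (ℕₚ.n<1+n 2) (begin
            3                               ≤⟨ s≤s (s≤s (∈⇒1≤∣∣ (∖⁺ p ne))) ⟩
            suc (suc ∣ (Δ ∖ e) ∖ e' ∣)      ≡⟨ cong suc (∣∖∣ (proj₂ other)) ⟩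
            suc ∣ Δ ∖ e ∣                   ≡⟨ trans ∣Δ∖e∣ (sym size≡) ⟩
            size x y                        ≤⟨ h ⟩
            2                               ∎))
            where open ℕₚ.≤-Reasoning
        del : beta M F (F ∪ (Δ ∖ e)) ≡ + 1
        del = trans (cong (λ Z → beta M F (F ∪ Z)) only) (beta-single M (flatM vx e' e'∉F))
        con : beta M (F ∪ ⁅ e ⁆) (F ∪ Δ) ≡ + 0
        con = beta-loop M {e = e'} (∪-mono id (⁅⁆-⊆ e∈D)) (∈ʳ F e'∈Δ)
          (∉-∪ e'∉F (λ q → e'≢e (Sₚ.x∈⁅y⁆⇒x≡y e q)))
          (ℕₚ.≤-trans (rk-mono M (∪-⊆ (∪-⊆ (≼₁ x≼y) (⁅⁆-⊆ e∈F')) (⁅⁆-⊆ (Δ⊆F' e'∈Δ)))) (ℕₚ.≤-trans F'≤ F<Fe))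

      -- A half with empty D has size 1, and this is spent on the rank that e raises. One set of `ρ`
      -- is therefore a closure obtained by adding e, and the other agrees with that of the nearer
      -- end. Two halves with gaps contradict the cardinality of `Δ`.
      refine-unique : ∀ {ρ} → Vertex ρ → x ≼ ρ → ρ ≼ y → e ∈ proj₁ ρ → e ∈ proj₂ ρ → Good x ρ → Good ρ y →
        ρ ≡ ρ₁ ⊎ ρ ≡ ρ₂
      refine-unique {ρ} vρ x≼ρ ρ≼y e∈₁ e∈₂ (single _ eq) _ = inj₁ (sym (cong₂ _,_
        (flat-rk-≡ M (flat-cl M _) (cl-⊆ M (flatM vρ) (∪-⊆ (≼₁ x≼ρ) (⁅⁆-⊆ e∈₁)))
          (ℕₚ.≤-trans (size-≤₁ x≼ρ 0 (ℕₚ.≤-reflexive eq)) (ℕₚ.≤-reflexive (sym (rk-cl-∪⁅⁆ M (flatM vx) e∉F)))))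
        (sym (flat-rk-≡ N (flatN vρ) (≼₂ x≼ρ)
          (size-<₁ x≼ρ 0 (ℕₚ.≤-reflexive eq) (inner-<₁ vx vρ vy x≼ρ ρ≼y e∈D e∈₁ e∈₂))))))
      refine-unique {ρ} vρ x≼ρ ρ≼y e∈₁ e∈₂ (spans _ _ _) (single _ eq) = inj₂ (sym (cong₂ _,_
        (sym (flat-rk-≡ M (flatM vρ) (≼₁ ρ≼y)
          (size-<₂ ρ≼y 0 (ℕₚ.≤-reflexive eq) (inner-<₂ vx vρ vy x≼ρ ρ≼y e∈D e∈₁ e∈₂))))
        (flat-rk-≡ N (flat-cl N _) (cl-⊆ N (flatN vρ) (∪-⊆ (≼₂ ρ≼y) (⁅⁆-⊆ e∈₂)))
          (ℕₚ.≤-trans (size-≤₂ ρ≼y 0 (ℕₚ.≤-reflexive eq)) (ℕₚ.≤-reflexive (sym (rk-cl-∪⁅⁆ N (flatN vy) e∉G')))))))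
      refine-unique {ρ} vρ x≼ρ ρ≼y e∈₁ e∈₂ gˡ@(spans p _ _) gʳ@(spans q _ _) = contradiction (begin
        suc (size x y)                 ≡⟨ cong suc (size-split x≼ρ ρ≼y) ⟩
        suc (size x ρ + size ρ y)      ≤⟨ s≤s (ℕₚ.+-mono-≤ (good-size x≼ρ p gˡ) (good-size ρ≼y q gʳ)) ⟩
        suc (∣ D x ρ ∣ + ∣ D ρ y ∣)    ≤⟨ ∣D∣-split vx vρ vy x≼ρ ρ≼y e∈D e∈₁ e∈₂ ⟩
        ∣ Δ ∣                          ≡⟨ size≡ ⟨
        size x y                       ∎) (ℕₚ.<-irrefl refl)
        where open ℕₚ.≤-Reasoning

      private
        too-small : ∀ {S e'} → S ⊆ Δ ∖ e → e' ∈ Δ ∖ e → e' ∉ S → suc (suc ∣ S ∣) ≤ size x y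
        too-small {S} {e'} S⊆ e'∈ e'∉S = begin
          suc (suc ∣ S ∣)             ≤⟨ s≤s (s≤s (Sₚ.p⊆q⇒∣p∣≤∣q∣ {q = (Δ ∖ e) ∖ e'} (λ p → ∖⁺ (S⊆ p) (λ { refl → e'∉S p })))) ⟩
          suc (suc ∣ (Δ ∖ e) ∖ e' ∣)  ≡⟨ cong suc (∣∖∣ e'∈) ⟩
          suc ∣ Δ ∖ e ∣               ≡⟨ trans ∣Δ∖e∣ (sym size≡) ⟩
          size x y                    ∎
          where open ℕₚ.≤-Reasoning

      -- The cases differ by an element `i` of Δ - e parallel to e over F. Contracting e makes it a
      -- loop, and it leaves D together with e although the size drops only by one.
      refine-ρ₁ : ρ₁ ≢ ρ₂ →
        (Tight ρ₁ y × w (ρ₁ , y) ≡ beta M (F ∪ ⁅ e ⁆) (F ∪ Δ)) ⊎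
        (¬ Good ρ₁ y × beta M (F ∪ ⁅ e ⁆) (F ∪ Δ) ≡ + 0)
      refine-ρ₁ ne with Finₚ.any? (λ i → (i Sₚ.∈? Δ ∖ e) ×-dec (i Sₚ.∈? cl M (F ∪ ⁅ e ⁆)))
      ... | yes (i , i∈ , i∈cl) = inj₂ (bad , beta-loop M {e = i} (∪-mono id (⁅⁆-⊆ e∈D)) (∈ʳ F (∖-⊆ i∈))
              (∉-∪ (∈D⁻₁ x y (∖-⊆ i∈)) (λ q → ∖-≢ i∈ (Sₚ.x∈⁅y⁆⇒x≡y e q))) (∈-cl⁻ M i∈cl))
        where
        bad : ¬ Good ρ₁ y
        bad (single _ eq) = ne (size-2⇒ρ₁≡ρ₂ (ℕₚ.≤-reflexive (trans size-via-ρ₁ (cong suc eq))))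
        bad g@(spans p _ _) = ℕₚ.<-irrefl refl (ℕₚ.≤-trans (s≤s (s≤s (good-size (proj₁ ρ₁≺y) p g)))
          (ℕₚ.≤-trans (too-small (D-subʳ vx vertex-ρ₁ vy (proj₁ x≺ρ₁) (proj₁ ρ₁≺y) e∈D e∈ρ₁ e∈G) i∈ (λ q → ∈D⁻₁ ρ₁ y q i∈cl))
            (ℕₚ.≤-reflexive size-via-ρ₁)))
      ... | no none = inj₁ ((spans D₁∋ span₁ span₂ , λ _ → sizes₁) , trans (w-nonempty ρ₁ y D₁∋) weight)
        where
        P : Subset m
        P = cl M (F ∪ ⁅ e ⁆)
        D₁ : D ρ₁ y ≡ Δ ∖ e
        D₁ = Sₚ.⊆-antisym (D-subʳ vx vertex-ρ₁ vy (proj₁ x≺ρ₁) (proj₁ ρ₁≺y) e∈D e∈ρ₁ e∈G)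
          (λ p → ∈D⁺ ρ₁ y (λ q → none (_ , p , q)) (∈D⁻₂ x y (∖-⊆ p)))
        D₁∋ : proj₁ other ∈ D ρ₁ y
        D₁∋ = subst (proj₁ other ∈_) (sym D₁) (proj₂ other)
        F∪Δ⊆ : F ∪ Δ ⊆ P ∪ D ρ₁ y
        F∪Δ⊆ {i} p with i Finₚ.≟ e
        ... | yes refl = ∈ˡ _ e∈ρ₁
        ... | no i≢e   = [ (λ q → ∈ˡ _ (⊆-cl M (∈ˡ _ q))) , (λ q → ∈ʳ P (subst (_ ∈_) (sym D₁) (∖⁺ q i≢e))) ]′ (∈-∪ F Δ p)
        span₁ : r F' ≤ r (P ∪ D ρ₁ y)
        span₁ = ℕₚ.≤-trans spanM (rk-mono M F∪Δ⊆)
        span₂ : s G ≤ s (G' ∪ D ρ₁ y)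
        span₂ = ℕₚ.≤-trans spanN∖e (ℕₚ.≤-reflexive (cong (λ Z → s (G' ∪ Z)) (sym D₁)))
        sizes₁ : size ρ₁ y ≡ ∣ D ρ₁ y ∣
        sizes₁ = ℕₚ.suc-injective (trans (sym size-via-ρ₁) (trans size≡ (trans (sym ∣Δ∖e∣) (cong (λ Z → suc ∣ Z ∣) (sym D₁)))))
        weight : beta M P (P ∪ D ρ₁ y) ≡ beta M (F ∪ ⁅ e ⁆) (F ∪ Δ)
        weight = beta-cong M (∈ˡ _) (∪-mono id (⁅⁆-⊆ e∈D))
          (Sₚ.⊆-antisym
            (λ p → let (a , b) = Sₚ.x∈p∩q⁻ (P ∪ D ρ₁ y) _ p in
              [ (λ q → contradiction q (∈∁⇒∉ b))
              , (λ q → let z = subst (_ ∈_) D₁ q in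
                   Sₚ.x∈p∩q⁺ (∈ʳ F (∖-⊆ z) , ∉⇒∈∁ (λ u → ∈∁⇒∉ b (⊆-cl M u)))) ]′ (∈-∪ P (D ρ₁ y) a))
            (λ {i} p → let (a , b) = Sₚ.x∈p∩q⁻ (F ∪ Δ) _ p in
              [ (λ q → contradiction (∈ˡ _ q) (∈∁⇒∉ b))
              , (λ q → let z = subst (i ∈_) (sym D₁) (∖⁺ q (λ { refl → ∈∁⇒∉ b (∈ʳ F (Sₚ.x∈⁅x⁆ e)) })) in
                   Sₚ.x∈p∩q⁺ (∈ʳ P z , ∉⇒∈∁ (∈D⁻₁ ρ₁ y z))) ]′ (∈-∪ F Δ a)))
          (λ X → rk-∪-cl M X (F ∪ ⁅ e ⁆))
          (ℕₚ.≤-antisym (ℕₚ.≤-trans (rk-mono M (∪-⊆ (≼₁ (proj₁ ρ₁≺y)) (λ p → ∈D⇒∈₁ ρ₁ vy p))) spanM) (rk-mono M F∪Δ⊆))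

      -- The dual situation: an element `i` of Δ - e in the dual closure of G' + e is in series with
      -- e, and deleting e makes it a coloop.
      refine-ρ₂ : ρ₁ ≢ ρ₂ →
        (Tight x ρ₂ × w (x , ρ₂) ≡ beta M F (F ∪ (Δ ∖ e))) ⊎
        (¬ Good x ρ₂ × beta M F (F ∪ (Δ ∖ e)) ≡ + 0)
      refine-ρ₂ ne with Finₚ.any? (λ i → (i Sₚ.∈? Δ ∖ e) ×-dec (i Sₚ.∈? cl N (G' ∪ ⁅ e ⁆)))
      ... | yes (i , i∈ , i∈cl) = inj₂ (bad , coloop)
        where
        bad : ¬ Good x ρ₂
        bad (single _ eq) = ne (size-2⇒ρ₁≡ρ₂ (ℕₚ.≤-reflexive (trans size-via-ρ₂ (cong suc eq))))
        bad g@(spans p _ _) = ℕₚ.<-irrefl refl (ℕₚ.≤-trans (s≤s (s≤s (good-size (proj₁ x≺ρ₂) p g)))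
          (ℕₚ.≤-trans (too-small (D-subˡ vx vertex-ρ₂ vy (proj₁ x≺ρ₂) (proj₁ ρ₂≺y) e∈D e∈F' e∈ρ₂) i∈ (λ q → ∈D⁻₂ x ρ₂ q i∈cl))
            (ℕₚ.≤-reflexive size-via-ρ₂)))
        Δ₁ : Subset m
        Δ₁ = (Δ ∖ e) ∖ i
        ∣Δ₁∣ : suc (suc ∣ Δ₁ ∣) ≡ size x y
        ∣Δ₁∣ = trans (cong suc (∣∖∣ i∈)) (trans ∣Δ∖e∣ (sym size≡))
        -- Distinct `ρ₁` and `ρ₂` exclude size 2, so `Δ` has a third element, as `beta-coloop`
        -- requires.
        third : ∃ λ i' → i' ∈ Δ₁
        third = 1≤∣∣⇒nonempty (ℕₚ.≮⇒≥ (λ lt → ne (size-2⇒ρ₁≡ρ₂ (ℕₚ.≤-trans (ℕₚ.≤-reflexive (sym ∣Δ₁∣)) (s≤s lt)))))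
        G₁ : Subset m
        G₁ = (G' ∪ ⁅ e ⁆) ∪ ⁅ i ⁆
        ineq : r (F ∪ Δ₁) + s (G₁ ∪ Δ₁) ≤ ∣ Δ₁ ∣ + (r F + s G₁)
        ineq = rk-span-≤ {M = M} {N} dual
          (λ k p → ∉-∪ (∉-∪ (∈D⁻₂ x y (∖-⊆ (∖-⊆ p))) (λ q → ∖-≢ (∖-⊆ p) (Sₚ.x∈⁅y⁆⇒x≡y e q))) (λ q → ∖-≢ p (Sₚ.x∈⁅y⁆⇒x≡y i q)))
          (λ k p q → ∖⁺ (∖⁺ (∈D⁺ x y p (λ z → q (∈ˡ _ (∈ˡ _ z)))) (λ { refl → q (∈ˡ _ (∈ʳ G' (Sₚ.x∈⁅x⁆ k))) }))
                        (λ { refl → q (∈ʳ (G' ∪ ⁅ e ⁆) (Sₚ.x∈⁅x⁆ k)) }))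
        G≤ : s G ≤ s (G₁ ∪ Δ₁)
        G≤ = ℕₚ.≤-trans spanN (rk-mono N (∪-⊆ (λ q → ∈ˡ _ (∈ˡ _ (∈ˡ _ q))) sub))
          where
          sub : Δ ⊆ G₁ ∪ Δ₁
          sub {k} p with k Finₚ.≟ e | k Finₚ.≟ i
          ... | yes refl | _        = ∈ˡ _ (∈ˡ _ (∈ʳ G' (Sₚ.x∈⁅x⁆ k)))
          ... | no _     | yes refl = ∈ˡ _ (∈ʳ (G' ∪ ⁅ e ⁆) (Sₚ.x∈⁅x⁆ k))
          ... | no a     | no b     = ∈ʳ G₁ (∖⁺ (∖⁺ p a) b)
        G₁≤ : s G₁ ≤ suc (s G')
        G₁≤ = ℕₚ.≤-trans (∈-cl⁻ N i∈cl) (rk-∪⁅⁆ N G' e)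
        -- In `ineq` the elements e and `i` are moved from `Δ` to the dual set. This costs two
        -- elements but raises the dual rank by at most one, which leaves the rank of F ∪ Δ₁ one
        -- short of that of F'.
        drop : r (F ∪ Δ₁) < r F'
        drop = ar (r (F ∪ Δ₁)) (s (G₁ ∪ Δ₁)) ∣ Δ₁ ∣ (r F) (s G₁) (s G) (s G') (r F') (size x y) ineq G≤ G₁≤ ∣Δ₁∣ (size-+ x≼y)
          where
          ar : ∀ a b d f g G G' F' z → a + b ≤ d + (f + g) → G ≤ b → g ≤ suc G' → suc (suc d) ≡ z → z + (f + G') ≡ F' + G → suc a ≤ F'
          ar a b d f g G G' F' z h₁ h₂ h₃ refl h₄ = lin≤ 0 (ℕₚ.+-mono-≤ (ℕₚ.+-mono-≤ h₁ h₂) (ℕₚ.+-mono-≤ h₃ (ℕₚ.≤-reflexive h₄))) (lem a b d f g G G' F')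
            where
            lem : ∀ a b d f g G G' F' → suc a + ((d + (f + g)) + b + (suc G' + (F' + G))) ≡ F' + (a + b + G + (g + (suc (suc d) + (f + G'))))
            lem = ℕRing.solve-∀
        coloop : beta M F (F ∪ (Δ ∖ e)) ≡ + 0
        coloop = beta-coloop M {e = i} {proj₁ third} (∈ˡ _) (∈ʳ F i∈) (∈D⁻₁ x y (∖-⊆ i∈))
          (∈ʳ F (∖-⊆ (proj₂ third))) (∈D⁻₁ x y (∖-⊆ (∖-⊆ (proj₂ third)))) (∖-≢ (proj₂ third))
          (ℕₚ.≤-<-trans (rk-mono M (λ p → [ ∈ˡ _ , (λ q → ∈ʳ F (∖⁺ q (∖-≢ p))) ]′ (∈-∪ F (Δ ∖ e) (∖-⊆ p))))
            (ℕₚ.<-≤-trans drop spanM∖e))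
      ... | no none = inj₁ ((spans D₂∋ span₁ span₂ , λ _ → sizes₂) , trans (w-nonempty x ρ₂ D₂∋) (cong (λ Z → beta M F (F ∪ Z)) D₂))
        where
        Q : Subset m
        Q = cl N (G' ∪ ⁅ e ⁆)
        D₂ : D x ρ₂ ≡ Δ ∖ e
        D₂ = Sₚ.⊆-antisym (D-subˡ vx vertex-ρ₂ vy (proj₁ x≺ρ₂) (proj₁ ρ₂≺y) e∈D e∈F' e∈ρ₂)
          (λ p → ∈D⁺ x ρ₂ (∈D⁻₁ x y (∖-⊆ p)) (λ q → none (_ , p , q)))
        D₂∋ : proj₁ other ∈ D x ρ₂
        D₂∋ = subst (proj₁ other ∈_) (sym D₂) (proj₂ other)
        span₁ : r F' ≤ r (F ∪ D x ρ₂)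
        span₁ = ℕₚ.≤-trans spanM∖e (ℕₚ.≤-reflexive (cong (λ Z → r (F ∪ Z)) (sym D₂)))
        span₂ : s G ≤ s (Q ∪ D x ρ₂)
        span₂ = ℕₚ.≤-trans spanN∖e (rk-mono N (∪-mono (λ p → ⊆-cl N (∈ˡ _ p)) (λ p → subst (_ ∈_) (sym D₂) p)))
        sizes₂ : size x ρ₂ ≡ ∣ D x ρ₂ ∣
        sizes₂ = ℕₚ.suc-injective (trans (sym size-via-ρ₂) (trans size≡ (trans (sym ∣Δ∖e∣) (cong (λ Z → suc ∣ Z ∣) (sym D₂)))))

-- The weights δ^p ∩ 1

∑-nonzero : ∀ {A : Set} (L : List A) {f : A → ℤ} → ∑ L f ≢ + 0 → ∃ λ x → f x ≢ + 0
∑-nonzero []      h = contradiction refl h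
∑-nonzero (x ∷ L) {f} h with f x ℤₚ.≟ + 0
... | no fx≢0  = x , fx≢0
... | yes fx≡0 = ∑-nonzero L (λ z → h (cong₂ _+ℤ_ fx≡0 z))

*-nonzeroˡ : ∀ {a b} → a *ℤ b ≢ + 0 → a ≢ + 0
*-nonzeroˡ {b = b} h refl = h refl

*-nonzeroʳ : ∀ {a b} → a *ℤ b ≢ + 0 → b ≢ + 0
*-nonzeroʳ {a} h refl = h (ℤₚ.*-zeroʳ a)

isFlat? : ∀ {m} (f : Subset m → ℕ) F → Dec (IsFlatFor f F)
isFlat? f F = Finₚ.all? (λ i → ¬? (i Sₚ.∈? F) →-dec (f F ℕₚ.<? f (F ∪ ⁅ i ⁆)))

module _ {m : ℕ} (M : Matroid m) where

  biflat? : ∀ ρ → Dec (Biflat M ρ)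
  biflat? (F , G) = isFlat? (rk M) F ×-dec isFlat? (dualRk M) G ×-dec Sₚ.nonempty? F ×-dec Sₚ.nonempty? G
    ×-dec ¬? (F ≟ˢ ⊤ ×-dec G ≟ˢ ⊤) ×-dec (F ∪ G) ≟ˢ ⊤

  comparable? : ∀ (ρ ρ' : BF m) → Dec (Comparable ρ ρ')
  comparable? (F , G) (F' , G') = ((F Sₚ.⊆? F') ×-dec (G' Sₚ.⊆? G)) ⊎-dec ((F' Sₚ.⊆? F) ×-dec (G Sₚ.⊆? G'))

  biflag? : ∀ τ → Dec (IsBiflag M τ)
  biflag? τ = All.all? biflat? τ ×-dec allPairs? (λ x y → ¬? (x ≟ᴮ y) ×-dec comparable? x y) τ
    ×-dec ¬? (unionFG τ ≟ˢ ⊤)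
    where open import Data.List.Relation.Unary.AllPairs using (allPairs?)

-- From here `n` is the dimension of the conormal fan, so the top weight is `IsTop M (suc n)`. A top
-- cone has n biflats, n + 1 steps and total size n + 2.
module Claims {m n : ℕ} (m≡2+n : m ≡ suc (suc n)) (M : Matroid m) (M-⊥ : Flat M ⊥) (N-⊥ : CoFlat M ⊥) (j : Fin m) where

  open Chains M M-⊥ N-⊥ j public
  open Refine M N dual public

  Supported : ℕ → Weight m → Set
  Supported d c = ∀ τ → c τ ≢ + 0 → IsBiflag M τ × length τ ≡ d

  vanishing⇒supported : ∀ {d} {c : Weight m} → (∀ τ → ¬ (IsBiflag M τ × length τ ≡ d) → c τ ≡ + 0) → Supported d c
  vanishing⇒supported {d} h τ c≢0 = decidable-stable (biflag? M τ ×-dec (length τ ℕₚ.≟ d)) (λ ¬p → c≢0 (h τ ¬p))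

  sizes-≥ : ∀ {L} → All IsStep L → length L ≤ sizes L
  sizes-≥ []       = z≤n
  sizes-≥ (h ∷ hs) = ℕₚ.+-mono-≤ (≺⇒1≤size (source h) (target h) (less h)) (sizes-≥ hs)

  -- All sizes are at least 1, so no single step can exceed 1 by more than the surplus `k` of the
  -- total.
  sizes-tight : ∀ {L} k → All IsStep L → sizes L ≤ k + length L → All (λ st → size (proj₁ st) (proj₂ st) ≤ suc k) L
  sizes-tight k [] _ = []
  sizes-tight {st ∷ L} k (h ∷ hs) le = ar (size (proj₁ st) (proj₂ st)) (sizes L) (length L) le (sizes-≥ hs)
    ∷ sizes-tight k hs (ar' (size (proj₁ st) (proj₂ st)) (sizes L) (length L) le (≺⇒1≤size (source h) (target h) (less h)))
    where
    ar : ∀ a b l → a + b ≤ k + suc l → l ≤ b → a ≤ suc k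
    ar a b l h₁ h₂ = lin≤ 0 (ℕₚ.+-mono-≤ h₁ h₂) (lem a b l k)
      where
      lem : ∀ a b l k → a + (k + suc l + b) ≡ suc k + (a + b + l)
      lem = ℕRing.solve-∀
    ar' : ∀ a b l → a + b ≤ k + suc l → 1 ≤ a → b ≤ k + l
    ar' a b l h₁ h₂ = lin≤ 0 (ℕₚ.+-mono-≤ h₁ h₂) (lem a b l k)
      where
      lem : ∀ a b l k → b + (k + suc l + a) ≡ k + l + (a + b + 1)
      lem = ℕRing.solve-∀

  size-1⇒good : ∀ {st} → IsStep st → size (proj₁ st) (proj₂ st) ≤ 1 → Good (proj₁ st) (proj₂ st)
  size-1⇒good h le = single
    (λ e e∈D → ℕₚ.<⇒≱ (D⇒2≤size (source h) (target h) (less≼ h) e∈D) le)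
    (ℕₚ.≤-antisym le (≺⇒1≤size (source h) (target h) (less h)))

  AllGood AllTight : List Step → Set
  AllGood  = All (λ st → Good (proj₁ st) (proj₂ st))
  AllTight = All (λ st → Tight (proj₁ st) (proj₂ st))

  tight-gap : ∀ {L} → AllTight L → length L < sizes L → ∃ λ st → st L∈.∈ L × Nonempty (D (proj₁ st) (proj₂ st))
  tight-gap ((spans e∈D _ _ , _) ∷ ts) lt = _ , here refl , _ , e∈D
  tight-gap {_ ∷ L} ((single _ eq , _) ∷ ts) lt with tight-gap ts (ℕ.s≤s⁻¹ (ℕₚ.≤-trans lt (ℕₚ.≤-reflexive (cong (_+ sizes L) eq))))
  ... | st , st∈ , ne = st , there st∈ , ne

  -- Tight steps without a gap have size 1, but the total size exceeds the number of steps. The gap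
  -- found here is also what makes the chain a flag of biflats.
  tight-step : ∀ {τ L} → Built τ L → length τ ≤ n → AllTight L → ∃ λ st → st L∈.∈ L × Nonempty (D (proj₁ st) (proj₂ st))
  tight-step {τ} {L} b le ts = tight-gap ts (ℕₚ.≤-trans (s≤s (ℕₚ.≤-trans (ℕₚ.≤-reflexive (built-length b)) (s≤s le))) (ℕₚ.≤-reflexive (sym (trans (built-sizes b) m≡2+n))))

  w-small : ∀ {st} → IsStep st → Tight (proj₁ st) (proj₂ st) → size (proj₁ st) (proj₂ st) ≤ 2 → w st ≡ + 1
  w-small {x , y} h (single d _ , _)         le = w-empty x y d
  w-small {x , y} h t@(spans e∈D _ _ , _) le = w-2 (source h) (target h) (less≼ h) e∈D t le

  module _ {c₀ : Weight m} (isTop : IsTop M (suc n) c₀) where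

    supported-powCap : ∀ p {c} → PowCap M (δray j) p n c₀ c → Supported (n ∸ p) c
    supported-powCap zero    pc τ c≢0 = vanishing⇒supported (λ σ → proj₂ (isTop σ)) τ (λ z → c≢0 (trans (pc τ) z))
    supported-powCap (suc p) (c₁ , pc , cap) τ c≢0 with vanishing⇒supported (λ σ → proj₂ (cap σ)) τ c≢0
    ... | bf , len = bf , trans len (trans (ℕₚ.∸-+-assoc n p 1) (cong (n ∸_) (ℕₚ.+-comm p 1)))

    -- Any e in the gap of τ may replace j, and δ_e vanishes on the rays of τ.
    cap-gap : ∀ {d d' c₁ c τ e} → Supported d' c₁ → IsCap M (δray j) d c₁ c → IsBiflag M τ → length τ ≡ d ∸ 1 →
      Gap e τ → c τ ≡ ∑ (allPairs m) (λ ρ → c₁ (ρ ∷ τ) *ℤ δray e ρ)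
    cap-gap {c₁ = c₁} {c} {τ} {e} supp cap bf len gap with proj₁ (cap τ) (bf , len)
    ... | a , λ₁ , λ₂ , eq₁ , eq₂ , eq = begin
      c τ
        ≡⟨ eq ⟩
      ∑ (allPairs m) (λ ρ → c₁ (ρ ∷ τ) *ℤ δray j ρ) -ℤ ∑ (allFin (length τ)) (λ t → a t *ℤ δray j (List.lookup τ t))
        ≡⟨ δ-independent M (allPairs m) (λ ρ → c₁ (ρ ∷ τ)) (allFin (length τ)) a (List.lookup τ)
             (λ ρ c≢0 → All.head (proj₁ (proj₁ (supp (ρ ∷ τ) c≢0)))) bf-lookup λ₁ λ₂ eq₁ eq₂ j e ⟩
      ∑ (allPairs m) (λ ρ → c₁ (ρ ∷ τ) *ℤ δray e ρ) -ℤ ∑ (allFin (length τ)) (λ t → a t *ℤ δray e (List.lookup τ t))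
        ≡⟨ cong (λ z → ∑ (allPairs m) (λ ρ → c₁ (ρ ∷ τ) *ℤ δray e ρ) -ℤ z) (∑-zero (allFin (length τ)) (λ t →
             trans (cong (a t *ℤ_) (δray-out M (bf-lookup t) (All.lookup gap (L∈ₚ.∈-lookup t)))) (ℤₚ.*-zeroʳ (a t)))) ⟩
      ∑ (allPairs m) (λ ρ → c₁ (ρ ∷ τ) *ℤ δray e ρ) +ℤ + 0
        ≡⟨ ℤₚ.+-identityʳ _ ⟩
      ∑ (allPairs m) (λ ρ → c₁ (ρ ∷ τ) *ℤ δray e ρ) ∎
      where
      open ≡-Reasoning
      bf-lookup : ∀ t → Biflat M (List.lookup τ t)
      bf-lookup t = All.lookup (proj₁ bf) (L∈ₚ.∈-lookup t)

    term-between : ∀ {d c τ L x y e ρ} → Supported d c → Built τ L → (x , y) L∈.∈ L → e ∈ D x y →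
      c (ρ ∷ τ) *ℤ δray e ρ ≢ + 0 → Vertex ρ × x ≺ ρ × ρ ≺ y × e ∈ proj₁ ρ × e ∈ proj₂ ρ × c (ρ ∷ τ) ≢ + 0
    term-between {c = c} {τ} {e = e} {ρ} supp b st∈ e∈D t≢0 =
      Inner.vertex in-ρ , proj₁ between , proj₂ between , proj₁ e∈ , proj₂ e∈ , c≢0
      where
      c≢0 : c (ρ ∷ τ) ≢ + 0
      c≢0 = *-nonzeroˡ t≢0
      bf : IsBiflag M (ρ ∷ τ)
      bf = proj₁ (supp (ρ ∷ τ) c≢0)
      in-ρ : Inner ρ
      in-ρ = biflat⇒inner (All.head (proj₁ bf))
      e∈ : e ∈ proj₁ ρ × e ∈ proj₂ ρ
      e∈ = decidable-stable ((e Sₚ.∈? proj₁ ρ) ×-dec (e Sₚ.∈? proj₂ ρ))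
             (λ h → *-nonzeroʳ {c (ρ ∷ τ)} t≢0 (δray-out M (All.head (proj₁ bf)) h))
      between : _
      between = gap-between b st∈ e∈D in-ρ (apart (proj₁ (proj₂ bf))) (proj₁ e∈) (proj₂ e∈)
        where
        apart : AllPairs Apart (ρ ∷ τ) → All (Beside ρ) τ
        apart (h ∷ _) = All.map beside h

    -- The total size exceeds the number of steps by one, and a step with a gap absorbs this
    -- surplus; all other steps have size 1.
    good-top : ∀ {τ L} → Built τ L → IsBiflag M τ → length τ ≡ n → AllGood L
    good-top {τ} {L} b bf len with biflag-gap bf
    ... | e , gap with gap-step b gap
    ... | st , st∈ , e∈D with extract st∈
    ... | rest , p with ↭ₚ.All-resp-↭ p (built-steps b)
    ... | h ∷ hs = ↭ₚ.All-resp-↭ (↭-sym p)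
        (good-2 (source h) (target h) (less≼ h) e∈D size≤2 ∷ goods hs (sizes-tight 0 hs rest≤))
      where
      two : 2 ≤ size (proj₁ st) (proj₂ st)
      two = D⇒2≤size (source h) (target h) (less≼ h) e∈D
      total : size (proj₁ st) (proj₂ st) + sizes rest ≡ suc (suc n)
      total = trans (sym (∑ℕ-↭ _ p)) (trans (built-sizes b) m≡2+n)
      len-rest : length rest ≡ n
      len-rest = ℕₚ.suc-injective (trans (sym (↭ₚ.↭-length p)) (trans (built-length b) (cong suc len)))
      rest≤ : sizes rest ≤ length rest
      rest≤ = lin≤ 0 (ℕₚ.+-mono-≤ two (ℕₚ.≤-reflexive total))
        (trans (lem₁ (sizes rest) (size (proj₁ st) (proj₂ st)) n) (cong (_+ (2 + (size (proj₁ st) (proj₂ st) + sizes rest))) (sym len-rest)))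
        where
        lem₁ : ∀ a b c → a + (b + suc (suc c)) ≡ c + (2 + (b + a))
        lem₁ = ℕRing.solve-∀
      size≤2 : size (proj₁ st) (proj₂ st) ≤ 2
      size≤2 = lin≤ 0 (ℕₚ.+-mono-≤ (sizes-≥ hs) (ℕₚ.≤-reflexive total))
        (trans (lem₂ (size (proj₁ st) (proj₂ st)) (sizes rest) n) (cong (λ z → 2 + (z + (size (proj₁ st) (proj₂ st) + sizes rest))) (sym len-rest)))
        where
        lem₂ : ∀ a b c → a + (b + suc (suc c)) ≡ 2 + (c + (a + b))
        lem₂ = ℕRing.solve-∀
      goods : ∀ {K} → All IsStep K → All (λ st → size (proj₁ st) (proj₂ st) ≤ 1) K → AllGood K
      goods []       []       = []
      goods (g ∷ gs) (k ∷ ks) = size-1⇒good g k ∷ goods gs ks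

    -- A nonzero cap has a nonzero summand at a chain with one more biflat, whose steps are good by
    -- induction; `good-join` merges the two new halves.
    nonzero⇒good : ∀ p {c τ L} → PowCap M (δray j) p n c₀ c → Built τ L → c τ ≢ + 0 → AllGood L
    nonzero⇒good zero pc b c≢0 with supported-powCap zero pc _ c≢0
    ... | bf , len = good-top b bf len
    nonzero⇒good (suc p) {c} {τ} {L} (c₁ , pc , cap) b c≢0 = join (extract st∈)
      where
      supp : Supported (n ∸ p) c₁
      supp = supported-powCap p pc
      bf : IsBiflag M τ × length τ ≡ n ∸ p ∸ 1
      bf = vanishing⇒supported (λ σ → proj₂ (cap σ)) τ c≢0
      gap : ∃ λ e → Gap e τ
      gap = biflag-gap (proj₁ bf)
      e : Fin m
      e = proj₁ gap
      gap-st : ∃ λ st → st L∈.∈ L × e ∈ D (proj₁ st) (proj₂ st)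
      gap-st = gap-step b (proj₂ gap)
      x y : BF m
      x = proj₁ (proj₁ gap-st)
      y = proj₂ (proj₁ gap-st)
      st∈ : (x , y) L∈.∈ L
      st∈ = proj₁ (proj₂ gap-st)
      e∈D : e ∈ D x y
      e∈D = proj₂ (proj₂ gap-st)
      term : ∃ λ ρ → c₁ (ρ ∷ τ) *ℤ δray e ρ ≢ + 0
      term = ∑-nonzero (allPairs m) (λ z → c≢0 (trans (cap-gap {n ∸ p} supp cap (proj₁ bf) (proj₂ bf) (proj₂ gap)) z))
      ρ : BF m
      ρ = proj₁ term
      between : Vertex ρ × x ≺ ρ × ρ ≺ y × e ∈ proj₁ ρ × e ∈ proj₂ ρ × c₁ (ρ ∷ τ) ≢ + 0
      between = term-between supp b st∈ e∈D (proj₂ term)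
      join : (∃ λ rest → L ↭ (x , y) ∷ rest) → AllGood L
      join (rest , q) =
        let (vρ , x≺ρ , ρ≺y , e∈₁ , e∈₂ , c₁≢0) = between
            h = All.head (↭ₚ.All-resp-↭ q (built-steps b))
            gs = nonzero⇒good p pc (insert b q vρ x≺ρ ρ≺y) c₁≢0
        in ↭ₚ.All-resp-↭ (↭-sym q) (good-join (source h) vρ (target h) (proj₁ x≺ρ) (proj₁ ρ≺y) e∈D e∈₁ e∈₂
             (All.head gs) (All.head (All.tail gs)) ∷ All.tail (All.tail gs))

    tight⇒∏ : ∀ p {c τ L} → PowCap M (δray j) p n c₀ c → Built τ L → length τ + p ≡ n → AllTight L → c τ ≡ ∏ L w
    -- At a top cone all sizes are at most 2, so every factor of the product is 1.
    tight⇒∏ zero {c} {τ} {L} pc b len ts with tight-step b (ℕₚ.≤-trans (ℕₚ.m≤m+n _ 0) (ℕₚ.≤-reflexive len)) ts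
    ... | st , st∈ , e , e∈D = trans (pc τ) (trans (proj₁ (isTop τ) (built⇒biflag b (step-gap b st∈ e∈D) , len'))
        (sym (∏-one (ones (built-steps b) ts (sizes-tight 1 (built-steps b)
           (ℕₚ.≤-reflexive (trans (trans (built-sizes b) m≡2+n) (cong suc (trans (cong suc (sym len')) (sym (built-length b))))))))))) 
      where
      len' : length τ ≡ n
      len' = trans (sym (ℕₚ.+-identityʳ _)) len
      ones : ∀ {K} → All IsStep K → AllTight K → All (λ st → size (proj₁ st) (proj₂ st) ≤ 2) K → All (λ st → w st ≡ + 1) K
      ones []       []       []       = []
      ones (h ∷ hs) (t ∷ ts) (l ∷ ls) = w-small h t l ∷ ones hs ts ls
    tight⇒∏ (suc p) {c} {τ} {L} (c₁ , pc , cap) b len ts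
      with tight-step b (ℕₚ.≤-trans (ℕₚ.m≤m+n _ (suc p)) (ℕₚ.≤-reflexive len)) ts
    ... | (x , y) , st∈ , e , e∈D with extract st∈
    ... | rest , q with ↭ₚ.All-resp-↭ q ts | ↭ₚ.All-resp-↭ q (built-steps b)
    ... | t ∷ ts' | h ∷ _ = trans c≡ (trans value (sym (∏-↭ w q)))
      where
      vx : Vertex x
      vx = source h
      vy : Vertex y
      vy = target h
      x≼y : x ≼ y
      x≼y = less≼ h
      supp : Supported (n ∸ p) c₁
      supp = supported-powCap p pc
      len' : length τ ≡ n ∸ p ∸ 1
      len' = sym (begin
        n ∸ p ∸ 1                  ≡⟨ ℕₚ.∸-+-assoc n p 1 ⟩
        n ∸ (p + 1)                ≡⟨ cong₂ _∸_ (sym len) (ℕₚ.+-comm p 1) ⟩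
        length τ + suc p ∸ suc p   ≡⟨ ℕₚ.m+n∸n≡m (length τ) (suc p) ⟩
        length τ                   ∎)
        where open ≡-Reasoning
      f : BF m → ℤ
      f ρ = c₁ (ρ ∷ τ) *ℤ δray e ρ
      c≡ : c τ ≡ ∑ (allPairs m) f
      c≡ = cap-gap {n ∸ p} supp cap (built⇒biflag b (step-gap b st∈ e∈D)) len' (step-gap b st∈ e∈D)
      ρ¹ ρ² : BF m
      ρ¹ = ρ₁ vx vy x≼y e∈D
      ρ² = ρ₂ vx vy x≼y e∈D
      v¹ = vertex-ρ₁ vx vy x≼y e∈D
      v² = vertex-ρ₂ vx vy x≼y e∈D
      Π : ℤ
      Π = ∏ rest w
      dl cn : ℤ
      dl = beta M (proj₁ x) (proj₁ x ∪ (D x y ∖ e))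
      cn = beta M (proj₁ x ∪ ⁅ e ⁆) (proj₁ x ∪ D x y)
      unique : ∀ ρ → f ρ ≢ + 0 → ρ ≡ ρ¹ ⊎ ρ ≡ ρ²
      unique ρ fρ≢0 with term-between supp b st∈ e∈D fρ≢0
      ... | vρ , x≺ρ , ρ≺y , e∈₁ , e∈₂ , c₁≢0 with nonzero⇒good p pc (insert b q vρ x≺ρ ρ≺y) c₁≢0
      ... | gˡ ∷ gʳ ∷ _ = refine-unique vx vy x≼y e∈D t vρ (proj₁ x≺ρ) (proj₁ ρ≺y) e∈₁ e∈₂ gˡ gʳ
      -- Where `c₁` vanishes, `ρ` need not be known to be a biflat and the value of `δray` is
      -- irrelevant; elsewhere the support of `c₁` makes it a biflat.
      f-at : ∀ ρ → e ∈ proj₁ ρ → e ∈ proj₂ ρ → f ρ ≡ c₁ (ρ ∷ τ)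
      f-at ρ p q with c₁ (ρ ∷ τ) ℤₚ.≟ + 0
      ... | yes z  = trans (cong (_*ℤ δray e ρ) z) (sym z)
      ... | no c≢0 = trans (cong (c₁ (ρ ∷ τ) *ℤ_) (δray-in M (All.head (proj₁ (proj₁ (supp _ c≢0)))) p q)) (ℤₚ.*-identityʳ _)
      f¹ : f ρ¹ ≡ c₁ (ρ¹ ∷ τ)
      f¹ = f-at ρ¹ (e∈ρ₁ vx vy x≼y e∈D) (∈D⇒∈₂ y vx e∈D)
      f² : f ρ² ≡ c₁ (ρ² ∷ τ)
      f² = f-at ρ² (∈D⇒∈₁ x vy e∈D) (e∈ρ₂ vx vy x≼y e∈D)
      b¹ = insert b q v¹ (x≺ρ₁ vx vy x≼y e∈D) (ρ₁≺y vx vy x≼y e∈D)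
      b² = insert b q v² (x≺ρ₂ vx vy x≼y e∈D) (ρ₂≺y vx vy x≼y e∈D)
      w¹ : w (x , ρ¹) ≡ + 1
      w¹ = w-empty x ρ¹ (D-xρ₁ vx vy x≼y e∈D)
      w² : w (ρ² , y) ≡ + 1
      w² = w-empty ρ² y (D-ρ₂y vx vy x≼y e∈D)
      t¹ = tight-xρ₁ vx vy x≼y e∈D
      t² = tight-ρ₂y vx vy x≼y e∈D
      step : ∀ {ρ} → Built (ρ ∷ τ) ((x , ρ) ∷ (ρ , y) ∷ rest) → Tight x ρ → Tight ρ y →
        c₁ (ρ ∷ τ) ≡ w (x , ρ) *ℤ (w (ρ , y) *ℤ Π)
      step b' tˡ tʳ = tight⇒∏ p pc b' (trans (sym (ℕₚ.+-suc (length τ) p)) len) (tˡ ∷ tʳ ∷ ts')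
      zero-if : ∀ {ρ} → Built (ρ ∷ τ) ((x , ρ) ∷ (ρ , y) ∷ rest) → (Good x ρ → Good ρ y → 0 ≡ 1) → c₁ (ρ ∷ τ) ≡ + 0
      zero-if {ρ} b' bad with c₁ (ρ ∷ τ) ℤₚ.≟ + 0
      ... | yes z  = z
      ... | no c≢0 with nonzero⇒good p pc b' c≢0
      ... | gˡ ∷ gʳ ∷ _ = contradiction (bad gˡ gʳ) λ ()
      value : ∑ (allPairs m) f ≡ w (x , y) *ℤ Π
      value with ρ¹ ≟ᴮ ρ²
      -- The two insertions coincide only for size 2. The common biflat is then counted once, in
      -- agreement with the factor 1 of `w-2`.
      ... | yes eq = begin
        ∑ (allPairs m) f
          ≡⟨ ∑-allPairs ρ¹ f (λ ρ ne → decidable-stable (f ρ ℤₚ.≟ + 0) (λ h → [ ne , (λ z → ne (trans z (sym eq))) ]′ (unique ρ h))) ⟩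
        f ρ¹
          ≡⟨ f¹ ⟩
        c₁ (ρ¹ ∷ τ)
          ≡⟨ step b¹ t¹ (subst (λ z → Tight z y) (sym eq) t²) ⟩
        w (x , ρ¹) *ℤ (w (ρ¹ , y) *ℤ Π)
          ≡⟨ cong₂ (λ a b → a *ℤ (b *ℤ Π)) w¹ (trans (cong (λ z → w (z , y)) eq) w²) ⟩
        + 1 *ℤ (+ 1 *ℤ Π)
          ≡⟨ ℤₚ.*-identityˡ _ ⟩
        + 1 *ℤ Π
          ≡⟨ cong (_*ℤ Π) (w-2 vx vy x≼y e∈D t (ℕₚ.≤-reflexive (ρ₁≡ρ₂⇒size-2 vx vy x≼y e∈D eq))) ⟨
        w (x , y) *ℤ Π ∎
        where open ≡-Reasoning
      ... | no ne = begin
        ∑ (allPairs m) f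
          ≡⟨ ∑-allPairs₂ ρ¹ ρ² f ne (λ ρ n¹ n² → decidable-stable (f ρ ℤₚ.≟ + 0) (λ h → [ n¹ , n² ]′ (unique ρ h))) ⟩
        f ρ¹ +ℤ f ρ²
          ≡⟨ cong₂ _+ℤ_ (trans f¹ c¹) (trans f² c²) ⟩
        cn *ℤ Π +ℤ dl *ℤ Π
          ≡⟨ lem cn dl Π ⟩
        (dl +ℤ cn) *ℤ Π
          ≡⟨ cong (_*ℤ Π) (w-del-con vx vy x≼y e∈D t) ⟨
        w (x , y) *ℤ Π ∎
        where
        open ≡-Reasoning
        lem : ∀ a b c → a *ℤ c +ℤ b *ℤ c ≡ (b +ℤ a) *ℤ c
        lem = ℤRing.solve-∀
        c¹ : c₁ (ρ¹ ∷ τ) ≡ cn *ℤ Π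
        c¹ with refine-ρ₁ vx vy x≼y e∈D t ne
        ... | inj₁ (t' , eq) = trans (step b¹ t¹ t') (trans (cong₂ (λ a b → a *ℤ (b *ℤ Π)) w¹ eq) (ℤₚ.*-identityˡ (cn *ℤ Π)))
        ... | inj₂ (bad , z) = trans (zero-if b¹ (λ _ g → contradiction g bad)) (sym (cong (_*ℤ Π) z))
        c² : c₁ (ρ² ∷ τ) ≡ dl *ℤ Π
        c² with refine-ρ₂ vx vy x≼y e∈D t ne
        ... | inj₁ (t' , eq) = trans (step b² t' t²) (trans (cong₂ (λ a b → a *ℤ (b *ℤ Π)) eq w²) (cong (dl *ℤ_) (ℤₚ.*-identityˡ Π)))
        ... | inj₂ (bad , z) = trans (zero-if b² (λ g _ → contradiction g bad)) (sym (cong (_*ℤ Π) z))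

-- Pushforward

module _ {m : ℕ} where

  ∑-lifts-zero : ∀ (Fs : List (Subset m)) (c : Weight m) → (∀ σ → map proj₁ σ ≡ Fs → c σ ≡ + 0) → ∑ (lifts Fs) c ≡ + 0
  ∑-lifts-zero []       c h = trans (ℤₚ.+-identityʳ _) (h [] refl)
  ∑-lifts-zero (F ∷ Fs) c h = trans (∑-concatMap (allSubsets m) (λ G → map ((F , G) ∷_) (lifts Fs)) c)
    (∑-zero (allSubsets m) (λ G → trans (∑-map (lifts Fs) ((F , G) ∷_) c)
      (∑-lifts-zero Fs (λ σ → c ((F , G) ∷ σ)) (λ σ eq → h _ (cong (F ∷_) eq)))))

  ∑-lifts : ∀ (g : Subset m → Subset m) (Fs : List (Subset m)) (c : Weight m) →
    (∀ σ → map proj₁ σ ≡ Fs → c σ ≢ + 0 → All (λ t → proj₂ t ≡ g (proj₁ t)) σ) →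
    ∑ (lifts Fs) c ≡ c (map (λ F → F , g F) Fs)
  ∑-lifts g []       c h = ℤₚ.+-identityʳ _
  ∑-lifts g (F ∷ Fs) c h = trans (∑-concatMap (allSubsets m) (λ G → map ((F , G) ∷_) (lifts Fs)) c) (trans
    (∑-cong (allSubsets m) (λ G → ∑-map (lifts Fs) ((F , G) ∷_) c)) (trans
    (∑-allSubsets (g F) (λ G → ∑ (lifts Fs) (λ σ → c ((F , G) ∷ σ))) (λ G ne → ∑-lifts-zero Fs _ (λ σ eq →
      decidable-stable (c ((F , G) ∷ σ) ℤₚ.≟ + 0) (λ z → ne (All.head (h _ (cong (F ∷_) eq) z))))))
    (∑-lifts g Fs (λ σ → c ((F , g F) ∷ σ)) (λ σ eq z → All.tail (h _ (cong (F ∷_) eq) z)))))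

module Pushforward {m n : ℕ} (m≡2+n : m ≡ suc (suc n)) (M : Matroid m) (M-⊥ : Flat M ⊥) (N-⊥ : CoFlat M ⊥) (j : Fin m) where

  open Claims m≡2+n M M-⊥ N-⊥ j

  private
    r s : Subset m → ℕ
    r = rk M
    s = rk N

  canon : Subset m → BF m
  canon F = F , cl N (∁ F)

  Canonical : BF m → Set
  Canonical x = proj₂ x ≡ cl N (∁ (proj₁ x))

  bot-canonical : Canonical bot
  bot-canonical = Sₚ.⊆-antisym (λ _ → ⊆-cl N (∉⇒∈∁ Sₚ.∉⊥)) (λ _ → Sₚ.∈⊤)

  top-canonical : Canonical top
  top-canonical = Sₚ.⊆-antisym (λ p → contradiction p Sₚ.∉⊥)
    (cl-⊆ N N-⊥ (λ p → contradiction Sₚ.∈⊤ (∈∁⇒∉ p)))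

  vertex-canon : ∀ {F} → Flat M F → Vertex (canon F)
  vertex-canon fl = record { flatM = fl ; flatN = flat-cl N _ ; cover = λ i p → ⊆-cl N (∉⇒∈∁ p) }

  canon-mono : ∀ {F F'} → F ⊆ F' → canon F ≼ canon F'
  canon-mono h = h , cl-⊆ N (flat-cl N _) (λ p → ⊆-cl N (∁-anti h p))

  module _ {x y : BF m} (vx : Vertex x) (vy : Vertex y) (x≼y : x ≼ y) (F≢F' : proj₁ x ≢ proj₁ y) (cy : Canonical y) where
    private
      F G F' G' : Subset m
      F  = proj₁ x
      G  = proj₂ x
      F' = proj₁ y
      G' = proj₂ y

      new : ∃ λ e → e ∈ F' × e ∉ F
      new = [ (λ eq → contradiction eq F≢F') , id ]′ (≡-or-witness (≼₁ x≼y))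

      ∁F⊆G : ∁ F ⊆ G
      ∁F⊆G p = cover vx _ (∈∁⇒∉ p)

      G'⊆cl : G' ⊆ cl N (∁ F)
      G'⊆cl p = cl-⊆ N (flat-cl N _) (λ q → ⊆-cl N (∁-anti (≼₁ x≼y) q)) (subst (_ ∈_) cy p)

      lt : r F < r F'
      lt = flat-< M (flatM vx) (≼₁ x≼y) (proj₁ (proj₂ new)) (proj₂ (proj₂ new))

    -- Canonicity propagates downwards from E|∅. A step of size 1 is used up by the rise from F to
    -- F', so the dual rank does not change; in a spanning step G is spanned by G' and D, both
    -- inside the dual closure of E - F.
    good⇒canonical : Good x y → Canonical x
    good⇒canonical g = sym (flat-rk-≡ N (flat-cl N _) (cl-⊆ N (flatN vx) ∁F⊆G) (rank g))
      where
      rank : Good x y → s G ≤ s (cl N (∁ F))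
      rank (single _ eq)  = ℕₚ.≤-trans (size-<₁ x≼y 0 (ℕₚ.≤-reflexive eq) lt) (rk-mono N G'⊆cl)
      rank (spans _ _ h) = ℕₚ.≤-trans h (rk-mono N (∪-⊆ G'⊆cl (λ p → ⊆-cl N (∉⇒∈∁ (∈D⁻₁ x y p)))))

    module _ (cx : Canonical x) where
      private
        -- For a canonical pair the dual rank formula makes the rank of F minus the rank of G equal
        -- to |F| up to a constant.
        card : ∣ F ∣ + size x y ≡ ∣ F' ∣
        card = ar (∣ F ∣) (size x y) (∣ F' ∣) (r F) (r F') (s G) (s G') (s ⊤) (size-+ x≼y) (dual-at x cx) (dual-at y cy)
          where
          dual-at : ∀ z → Canonical z → r (proj₁ z) + s ⊤ ≡ ∣ proj₁ z ∣ + s (proj₂ z)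
          dual-at z cz = trans (dual-sym {M = M} {N} dual (proj₁ z))
            (cong (λ k → ∣ proj₁ z ∣ + k) (trans (sym (rk-cl N (∁ (proj₁ z)))) (cong s (sym cz))))
          ar : ∀ a z b rF rF' sG sG' t → z + (rF + sG') ≡ rF' + sG → rF + t ≡ a + sG → rF' + t ≡ b + sG' → a + z ≡ b
          ar a z b rF rF' sG sG' t h₁ h₂ h₃ = ℕₚ.+-cancelʳ-≡ (rF + sG' + (sG + t)) (a + z) b (begin
            a + z + (rF + sG' + (sG + t))     ≡⟨ l₁ a z (rF + sG') sG t ⟩
            (z + (rF + sG')) + (a + sG) + t   ≡⟨ cong₂ (λ p q → p + q + t) h₁ (sym h₂) ⟩
            rF' + sG + (rF + t) + t           ≡⟨ l₂ rF' sG rF t ⟩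
            rF' + t + (rF + sG + t)           ≡⟨ cong (_+ (rF + sG + t)) h₃ ⟩
            b + sG' + (rF + sG + t)           ≡⟨ l₃ b sG' rF sG t ⟩
            b + (rF + sG' + (sG + t))         ∎)
            where
            open ≡-Reasoning
            l₁ : ∀ a z q g t → a + z + (q + (g + t)) ≡ z + q + (a + g) + t
            l₁ = ℕRing.solve-∀
            l₂ : ∀ a b c t → a + b + (c + t) + t ≡ a + t + (c + b + t)
            l₂ = ℕRing.solve-∀
            l₃ : ∀ b h c g t → b + h + (c + g + t) ≡ b + (c + h + (g + t))
            l₃ = ℕRing.solve-∀

        Outcome : Set
        Outcome = (Tight x y × w (x , y) ≡ beta M F F') ⊎ (¬ Good x y × beta M F F' ≡ + 0)

        -- Since G' is the dual closure of E - F', the element `i` is a coloop of M|F'. It is not in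
        -- D, so F ∪ D cannot span F'; and a second new element rules out size 1 by `card`.
        two-coloop : ∀ {i i'} → i ∈ F' → i ∉ F → i ∈ G' → i' ∈ F' → i' ∉ F → i' ≢ i → Outcome
        two-coloop {i} {i'} p q g p' q' ne = inj₂ (bad , beta-coloop M (≼₁ x≼y) p q p' q' ne drop)
          where
          drop : r (F' ∖ i) < r F'
          drop = dual-coloop {M = M} {N} dual p (∈-cl⁻ N (subst (i ∈_) cy g))
          bad : ¬ Good x y
          bad (spans _ h _)  = ℕₚ.<⇒≱ drop (ℕₚ.≤-trans h (rk-mono M (∪-⊆
            (λ z → ∖⁺ (≼₁ x≼y z) (λ { refl → q z })) (λ z → ∖⁺ (∈D⇒∈₁ x vy z) (λ { refl → ∈D⁻₂ x y z g })))))
          bad (single _ eq) = ℕₚ.<-irrefl refl (begin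
            suc (suc ∣ F ∣)             ≤⟨ s≤s (s≤s (Sₚ.p⊆q⇒∣p∣≤∣q∣ {q = (F' ∖ i) ∖ i'} (λ z → ∖⁺ (∖⁺ (≼₁ x≼y z) (λ { refl → q z })) (λ { refl → q' z })))) ⟩
            suc (suc ∣ (F' ∖ i) ∖ i' ∣) ≡⟨ cong suc (∣∖∣ (∖⁺ p' ne)) ⟩
            suc ∣ F' ∖ i ∣              ≡⟨ ∣∖∣ p ⟩
            ∣ F' ∣                      ≡⟨ card ⟨
            (∣ F ∣) + size x y          ≡⟨ cong (λ z → ∣ F ∣ + z) eq ⟩
            (∣ F ∣) + 1                 ≡⟨ ℕₚ.+-comm ∣ F ∣ 1 ⟩
            suc ∣ F ∣                   ∎)
            where open ℕₚ.≤-Reasoning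

        -- The only new element is missing from D, so the step has size 1 and weight 1; this is also
        -- the beta invariant of a single nonloop.
        one-coloop : ∀ {i} → i ∈ F' → i ∉ F → i ∈ G' → (∀ i' → i' ∈ F' → i' ∉ F → i' ≡ i) → Outcome
        one-coloop {i} p q g only = inj₁ ((single none size≡1 , (λ (e , e∈D) → contradiction e∈D (none e))) ,
          trans (w-empty x y none) (sym (trans (cong (beta M F) F'≡) (beta-single M (flatM vx i q)))))
          where
          none : ∀ e → e ∉ D x y
          none e e∈D = ∈D⁻₂ x y e∈D (subst (_∈ G') (sym (only e (∈D⇒∈₁ x vy e∈D) (∈D⁻₁ x y e∈D))) g)
          F'≡ : F' ≡ F ∪ ⁅ i ⁆
          F'≡ = Sₚ.⊆-antisym back (∪-⊆ (≼₁ x≼y) (⁅⁆-⊆ p))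
            where
            back : F' ⊆ F ∪ ⁅ i ⁆
            back {k} z with k Sₚ.∈? F
            ... | yes u = ∈ˡ _ u
            ... | no u  = ∈ʳ F (subst (_∈ ⁅ i ⁆) (sym (only k z u)) (Sₚ.x∈⁅x⁆ i))
          size≡1 : size x y ≡ 1
          size≡1 = ℕₚ.+-cancelˡ-≡ ∣ F ∣ _ _ (trans card (trans (cong ∣_∣ F'≡) (trans (∣∪⁅⁆∣ q) (ℕₚ.+-comm 1 ∣ F ∣))))

        -- Now D is all of F' - F, so it spans, and `card` identifies its cardinality with the size.
        no-coloop : (∀ i → i ∈ F' → i ∉ F → i ∉ G') → Outcome
        no-coloop h = inj₁ ((spans e∈D span₁ span₂ , (λ _ → size≡)) ,
          trans (w-nonempty x y e∈D) (cong (beta M F) F∪D))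
          where
          e∈D : proj₁ new ∈ D x y
          e∈D = ∈D⁺ x y (proj₂ (proj₂ new)) (h _ (proj₁ (proj₂ new)) (proj₂ (proj₂ new)))
          F∪D : F ∪ D x y ≡ F'
          F∪D = Sₚ.⊆-antisym (∪-⊆ (≼₁ x≼y) (λ z → ∈D⇒∈₁ x vy z)) back
            where
            back : F' ⊆ F ∪ D x y
            back {k} z with k Sₚ.∈? F
            ... | yes u = ∈ˡ _ u
            ... | no u  = ∈ʳ F (∈D⁺ x y u (h k z u))
          span₁ : r F' ≤ r (F ∪ D x y)
          span₁ = ℕₚ.≤-reflexive (cong r (sym F∪D))
          span₂ : s G ≤ s (G' ∪ D x y)
          span₂ = ℕₚ.≤-trans (ℕₚ.≤-reflexive (trans (cong s cx) (rk-cl N (∁ F)))) (rk-mono N sub)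
            where
            sub : ∁ F ⊆ G' ∪ D x y
            sub {k} z with k Sₚ.∈? G'
            ... | yes u = ∈ˡ _ u
            ... | no u  = ∈ʳ G' (∈D⁺ x y (∈∁⇒∉ z) u)
          size≡ : size x y ≡ ∣ D x y ∣
          size≡ = ℕₚ.+-cancelˡ-≡ ∣ F ∣ _ _ (trans card (trans (cong ∣_∣ (sym F∪D))
            (∣∪∣-disjoint F (D x y) (λ i u v → ∈D⁻₁ x y v u))))

      canonical-weight : Outcome
      canonical-weight with Finₚ.any? (λ i → (i Sₚ.∈? F') ×-dec (¬? (i Sₚ.∈? F)) ×-dec (i Sₚ.∈? G'))
      ... | no none = no-coloop (λ i p q g → none (i , p , q , g))
      ... | yes (i , p , q , g) with Finₚ.any? (λ i' → (i' Sₚ.∈? F') ×-dec (¬? (i' Sₚ.∈? F)) ×-dec ¬? (i' Finₚ.≟ i))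
      ... | yes (i' , p' , q' , ne) = two-coloop p q g p' q' ne
      ... | no none = one-coloop p q g (λ i' p' q' → decidable-stable (i' Finₚ.≟ i) (λ ne → none (i' , p' , q' , ne)))

  consec : BF m → List (BF m) → List Step
  consec x []      = (x , top) ∷ []
  consec x (t ∷ σ) = (x , t) ∷ consec t σ

  Rising : BF m → List (BF m) → Set
  Rising x []      = x ≺ top × proj₁ x ≢ ⊤
  Rising x (t ∷ σ) = (x ≺ t × proj₁ x ≢ proj₁ t) × Rising t σ

  -- Assembled from the upper end: the tail is itself a chain starting at ∅|E, and the head splits
  -- its lowest step.
  built-consec : ∀ {σ} → All Vertex σ → Rising bot σ → Built σ (consec bot σ)
  built-consec {[]}        []             _                            = base
  built-consec {t ∷ []}    (vt ∷ [])      ((l , _) , (u , _))          = insert base ↭-refl vt l u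
  built-consec {t ∷ u ∷ σ} (vt ∷ vu ∷ vs) ((l , ne) , (k , ne') , rs)  =
    insert (built-consec (vu ∷ vs) ((≼-≺-trans bot-≼ k , ne″) , rs)) ↭-refl vt l k
    where
    ne″ : ⊥ ≢ proj₁ u
    ne″ eq = ne (Sₚ.⊆-antisym (λ p → contradiction p Sₚ.∉⊥) (λ p → subst (_ ∈_) (sym eq) (≼₁ (proj₁ k) p)))

  rising : ∀ {t σ} → All (Biflat M) (t ∷ σ) → AllPairs Apart (t ∷ σ) → IsFlagOfFlats M (map proj₁ (t ∷ σ)) → Rising t σ
  rising {t} {[]} (h ∷ []) _ ((_ , _ , ne) ∷ [] , _) = Inner.≺top (biflat⇒inner h) , ne
  rising {t} {u ∷ σ} (h ∷ hs) ((a ∷ _) ∷ as) (_ ∷ fs , (t⊆u , ne) ∷ ls) =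
    ((up (proj₂ a) , ne ∘ cong proj₁) , ne) , rising hs as (fs , ls)
    where
    up : Comparable t u → t ≼ u
    up (inj₁ (p , q)) = p , q
    up (inj₂ (p , q)) = contradiction (Sₚ.⊆-antisym t⊆u p) ne

  rising-bot : ∀ {σ} → All (Biflat M) σ → AllPairs Apart σ → IsFlagOfFlats M (map proj₁ σ) → Rising bot σ
  rising-bot {[]} _ _ _ = (bot-≼ , bot≢top) , λ eq → bot≢top (cong₂ _,_ eq (sym eq))
  rising-bot {t ∷ σ} hs@(h ∷ _) as fl@((_ , (i , i∈) , _) ∷ _ , _) =
    (Inner.bot≺ (biflat⇒inner h) , λ eq → Sₚ.∉⊥ (subst (i ∈_) (sym eq) i∈)) , rising hs as fl

  rising-canon : ∀ {F Fs} → IsFlagOfFlats M (F ∷ Fs) → Rising (canon F) (map canon Fs)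
  rising-canon {F} {[]} ((_ , _ , ne) ∷ [] , _) = (≼-top , ne ∘ cong proj₁) , ne
  rising-canon {F} {F' ∷ Fs} (_ ∷ fs , (sub , ne) ∷ ls) = ((canon-mono sub , ne ∘ cong proj₁) , ne) , rising-canon (fs , ls)

  rising-bot-canon : ∀ {Fs} → IsFlagOfFlats M Fs → Rising bot (map canon Fs)
  rising-bot-canon {[]} _ = (bot-≼ , bot≢top) , λ eq → bot≢top (cong₂ _,_ eq (sym eq))
  rising-bot-canon {F ∷ Fs} fl@((_ , (i , i∈) , _) ∷ _ , _) = ((bot-≼ , ne ∘ cong proj₁) , ne) , rising-canon fl
    where
    ne : ⊥ ≢ F
    ne eq = Sₚ.∉⊥ (subst (i ∈_) (sym eq) i∈)

  good⇒canonicals : ∀ x σ → Vertex x → All Vertex σ → Rising x σ → AllGood (consec x σ) →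
    All Canonical (x ∷ σ)
  good⇒canonicals x [] vx [] ((l , _) , ne) (g ∷ []) = good⇒canonical vx vertex-top l ne top-canonical g ∷ []
  good⇒canonicals x (t ∷ σ) vx (vt ∷ vs) (((l , _) , ne) , rs) (g ∷ gs)
    with good⇒canonicals t σ vt vs rs gs
  ... | ct ∷ cs = good⇒canonical vx vt l ne ct g ∷ ct ∷ cs

  canonical-weights : ∀ x σ → Vertex x → All Vertex σ → Rising x σ → All Canonical (x ∷ σ) →
    (AllTight (consec x σ) × ∏ (consec x σ) w ≡ prodBeta M (proj₁ x ∷ map proj₁ σ ++ ⊤ ∷ [])) ⊎
    (¬ AllGood (consec x σ) × prodBeta M (proj₁ x ∷ map proj₁ σ ++ ⊤ ∷ []) ≡ + 0)
  canonical-weights x [] vx [] ((l , _) , ne) (cx ∷ []) with canonical-weight vx vertex-top l ne top-canonical cx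
  ... | inj₁ (t , eq) = inj₁ (t ∷ [] , cong (_*ℤ + 1) eq)
  ... | inj₂ (b , z)  = inj₂ ((λ { (g ∷ []) → b g }) , cong (_*ℤ + 1) z)
  canonical-weights x (t ∷ σ) vx (vt ∷ vs) (((l , _) , ne) , rs) (cx ∷ cs@(ct ∷ _))
    with canonical-weight vx vt l ne ct cx | canonical-weights t σ vt vs rs cs
  ... | inj₂ (b , z)   | _               = inj₂ ((λ { (g ∷ _) → b g }) , cong (_*ℤ prodBeta M (proj₁ t ∷ map proj₁ σ ++ ⊤ ∷ [])) z)
  ... | inj₁ _         | inj₂ (b , z)    = inj₂ ((λ { (_ ∷ gs) → b gs }) ,
      trans (cong (beta M (proj₁ x) (proj₁ t) *ℤ_) z) (ℤₚ.*-zeroʳ (beta M (proj₁ x) (proj₁ t))))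
  ... | inj₁ (th , eq) | inj₁ (ts , eqs) = inj₁ (th ∷ ts , cong₂ _*ℤ_ eq eqs)

  pushforward≡prodBeta : ∀ {c₀ c} p → IsTop M (suc n) c₀ → PowCap M (δray j) p n c₀ c →
    ∀ 𝓕 → IsFlagOfFlats M 𝓕 → length 𝓕 + p ≡ n → pushforward c 𝓕 ≡ prodBeta M (⊥ ∷ 𝓕 ++ ⊤ ∷ [])
  pushforward≡prodBeta {c₀} {c} p isTop pc 𝓕 flag len = trans (∑-lifts (λ F → cl N (∁ F)) 𝓕 c only) value
    where
    only : ∀ σ → map proj₁ σ ≡ 𝓕 → c σ ≢ + 0 → All Canonical σ
    only σ refl c≢0 = All.tail (good⇒canonicals bot σ vertex-bot vs rs
        (nonzero⇒good isTop p pc (built-consec vs rs) c≢0))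
      where
      bf : IsBiflag M σ
      bf = proj₁ (supported-powCap isTop p pc σ c≢0)
      vs : All Vertex σ
      vs = All.map (λ h → Inner.vertex (biflat⇒inner h)) (proj₁ bf)
      rs : Rising bot σ
      rs = rising-bot (proj₁ bf) (proj₁ (proj₂ bf)) flag
    σ₀ : List (BF m)
    σ₀ = map canon 𝓕
    vs₀ : ∀ {Fs} → All (λ F → Flat M F × NonEmpty F × F ≢ ⊤) Fs → All Vertex (map canon Fs)
    vs₀ []       = []
    vs₀ (h ∷ hs) = vertex-canon (proj₁ h) ∷ vs₀ hs
    cs₀ : ∀ Fs → All Canonical (map canon Fs)
    cs₀ []       = []
    cs₀ (F ∷ Fs) = refl ∷ cs₀ Fs
    b₀ : Built σ₀ (consec bot σ₀)
    b₀ = built-consec (vs₀ (proj₁ flag)) (rising-bot-canon flag)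
    firsts : map proj₁ σ₀ ≡ 𝓕
    firsts = trans (sym (Listₚ.map-∘ 𝓕)) (Listₚ.map-id 𝓕)
    value : c σ₀ ≡ prodBeta M (⊥ ∷ 𝓕 ++ ⊤ ∷ [])
    value with canonical-weights bot σ₀ vertex-bot (vs₀ (proj₁ flag)) (rising-bot-canon flag) (bot-canonical ∷ cs₀ 𝓕)
    ... | inj₁ (ts , eq) = trans (tight⇒∏ isTop p pc b₀ (trans (cong (_+ p) (Listₚ.length-map canon 𝓕)) len) ts)
            (trans eq (cong (λ Fs → prodBeta M (⊥ ∷ Fs ++ ⊤ ∷ [])) firsts))
    ... | inj₂ (bad , z) = trans (decidable-stable (c σ₀ ℤₚ.≟ + 0) (λ h → bad (nonzero⇒good isTop p pc b₀ h)))
            (sym (trans (cong (λ Fs → prodBeta M (⊥ ∷ Fs ++ ⊤ ∷ [])) (sym firsts)) z))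

-- Existence

-- Models the insertions into one interval: the sets `p ρ` partition F' - F, like the flats covering
-- a given flat, while `q ρ` takes only the two end values. The projections stay variable so that
-- the exchanged ones serve the dual matroid.
module _ {m : ℕ} (A : BF m → ℤ) (p q : BF m → Subset m) {F F' G G' : Subset m} (F⊆F' : F ⊆ F')
         (between : ∀ ρ → A ρ ≢ + 0 → F ⊆ p ρ × p ρ ⊆ F' × (q ρ ≡ G ⊎ q ρ ≡ G'))
         (part : ∀ i → i ∈ F' → i ∉ F → ∃ λ ρ → A ρ ≡ + 1 × i ∈ p ρ × (∀ ρ' → A ρ' ≢ + 0 → i ∈ p ρ' → ρ' ≡ ρ)) where
  private
    AP : List (BF m)
    AP = allPairs m

    t : BF m → ℤ
    t ρ = if does (q ρ ≟ˢ G) then + 0 else A ρ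

    S T : ℤ
    S = ∑ AP A
    T = ∑ AP t

    z* : ∀ {a} b → a ≡ + 0 → a *ℤ b ≡ + 0
    z* b refl = refl

    one : ∀ ρ i (C : Subset m) b → (A ρ ≢ + 0 → ind C i ≡ b) → A ρ *ℤ ind C i ≡ A ρ *ℤ b
    one ρ i C b h with A ρ ℤₚ.≟ + 0
    ... | yes z = trans (z* (ind C i) z) (sym (z* b z))
    ... | no nz = cong (A ρ *ℤ_) (h nz)

    ∑-const : ∀ i (C : BF m → Subset m) b → (∀ ρ → A ρ ≢ + 0 → ind (C ρ) i ≡ b) → ∑ AP (λ ρ → A ρ *ℤ ind (C ρ) i) ≡ S *ℤ b
    ∑-const i C b h = trans (∑-cong AP (λ ρ → trans (one ρ i (C ρ) b (h ρ)) (ℤₚ.*-comm (A ρ) b)))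
      (trans (∑-*ˡ AP b A) (ℤₚ.*-comm b S))

  -- An element of F is in every part, an element of F' - F in exactly one, and an element outside
  -- F' in none.
  parts-sum₁ : ∀ i → ∑ AP (λ ρ → A ρ *ℤ ind (p ρ) i) ≡ S *ℤ ind F i +ℤ (ind F' i -ℤ ind F i)
  parts-sum₁ i with i Sₚ.∈? F | i Sₚ.∈? F'
  ... | yes i∈F | yes i∈F' = trans (∑-const i p (+ 1) (λ ρ nz → ind-∈ (proj₁ (between ρ nz) i∈F))) (sym
        (trans (cong₂ (λ a b → S *ℤ a +ℤ (b -ℤ a)) (ind-∈ i∈F) (ind-∈ i∈F')) (ℤₚ.+-identityʳ _)))
  ... | yes i∈F | no i∉F' = contradiction (F⊆F' i∈F) i∉F'
  ... | no i∉F  | no i∉F' = trans (∑-const i p (+ 0) (λ ρ nz → ind-∉ (λ z → i∉F' (proj₁ (proj₂ (between ρ nz)) z)))) (sym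
        (trans (cong₂ (λ a b → S *ℤ a +ℤ (b -ℤ a)) (ind-∉ i∉F) (ind-∉ i∉F')) (ℤₚ.+-identityʳ _)))
  ... | no i∉F  | yes i∈F' with part i i∈F' i∉F
  ... | ρ , A≡1 , i∈ρ , uniq = trans
        (trans (∑-allPairs ρ _ off) (cong₂ _*ℤ_ A≡1 (ind-∈ i∈ρ)))
        (sym (trans (cong₂ (λ a b → S *ℤ a +ℤ (b -ℤ a)) (ind-∉ i∉F) (ind-∈ i∈F')) (cong (_+ℤ + 1) (ℤₚ.*-zeroʳ S))))
    where
    off : ∀ ρ' → ρ' ≢ ρ → A ρ' *ℤ ind (p ρ') i ≡ + 0
    off ρ' ne with A ρ' ℤₚ.≟ + 0
    ... | yes z = z* (ind (p ρ') i) z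
    ... | no nz = trans (cong (A ρ' *ℤ_) (ind-∉ (λ i∈ → ne (uniq ρ' nz i∈)))) (ℤₚ.*-zeroʳ (A ρ'))

  parts-sum₂ : ∀ i → ∑ AP (λ ρ → A ρ *ℤ ind (q ρ) i) ≡ S *ℤ ind G i -ℤ T *ℤ (ind G i -ℤ ind G' i)
  parts-sum₂ i = begin
    ∑ AP (λ ρ → A ρ *ℤ ind (q ρ) i)
      ≡⟨ ∑-cong AP pointwise ⟩
    ∑ AP (λ ρ → g *ℤ A ρ -ℤ (g -ℤ g') *ℤ t ρ)
      ≡⟨ ∑-- AP _ _ ⟩
    ∑ AP (λ ρ → g *ℤ A ρ) -ℤ ∑ AP (λ ρ → (g -ℤ g') *ℤ t ρ)
      ≡⟨ cong₂ _-ℤ_ (∑-*ˡ AP g A) (∑-*ˡ AP (g -ℤ g') t) ⟩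
    g *ℤ S -ℤ (g -ℤ g') *ℤ T
      ≡⟨ cong₂ _-ℤ_ (ℤₚ.*-comm g S) (ℤₚ.*-comm (g -ℤ g') T) ⟩
    S *ℤ g -ℤ T *ℤ (g -ℤ g') ∎
    where
    open ≡-Reasoning
    g g' : ℤ
    g  = ind G i
    g' = ind G' i
    l₁ : ∀ a g d → a *ℤ g ≡ g *ℤ a -ℤ d *ℤ + 0
    l₁ = ℤRing.solve-∀
    l₂ : ∀ a g g' → a *ℤ g' ≡ g *ℤ a -ℤ (g -ℤ g') *ℤ a
    l₂ = ℤRing.solve-∀
    pointwise : ∀ ρ → A ρ *ℤ ind (q ρ) i ≡ g *ℤ A ρ -ℤ (g -ℤ g') *ℤ t ρ
    pointwise ρ with q ρ ≟ˢ G
    ... | yes eq = trans (cong (λ C → A ρ *ℤ ind C i) eq) (l₁ (A ρ) g (g -ℤ g'))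
    ... | no ne  = trans (one ρ i (q ρ) g' (λ nz → [ (λ eq → contradiction eq ne) , (λ eq → cong (λ C → ind C i) eq) ]′
                     (proj₂ (proj₂ (between ρ nz))))) (l₂ (A ρ) g g')

-- Biflats that can be added to a cone of codimension one

module Codim1 {m : ℕ} (M N : Matroid m) (dual : IsDual M N) where
  open Steps M N dual public

  private
    r s : Subset m → ℕ
    r = rk M
    s = rk N

  -- An enlarged flag must keep a gap, either in one of the two new halves or, as `R` records, in
  -- another step.
  Allowed : BF m → BF m → Set → BF m → Set
  Allowed x y R ρ = Vertex ρ × x ≺ ρ × ρ ≺ y × (Nonempty (D x ρ) ⊎ Nonempty (D ρ y) ⊎ R)

  flat-between : ∀ (K : Matroid m) {A B C : Subset m} → Flat K A → Flat K B → A ⊆ B → B ⊆ C → rk K C ≤ suc (rk K A) → B ≡ A ⊎ B ≡ C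
  flat-between K {A} {B} fA fB A⊆B B⊆C le with ≡-or-witness A⊆B
  ... | inj₁ eq          = inj₁ (sym eq)
  ... | inj₂ (e , p , q) = inj₂ (flat-rk-≡ K fB B⊆C (ℕₚ.≤-trans le (flat-< K fA A⊆B p q)))

  module _ {x y : BF m} (vx : Vertex x) (vy : Vertex y) (x≼y : x ≼ y) where
    private
      F G F' G' : Subset m
      F  = proj₁ x
      G  = proj₂ x
      F' = proj₁ y
      G' = proj₂ y

    no-gap-corner : ∀ {R : Set} → (Nonempty (D x (F' , G)) ⊎ Nonempty (D (F' , G) y) ⊎ R) → R
    no-gap-corner (inj₁ (e , p))        = contradiction (cover vx e (∈D⁻₁ x (F' , G) p)) (∈D⁻₂ x (F' , G) p)
    no-gap-corner (inj₂ (inj₁ (e , p))) = contradiction (cover vy e (∈D⁻₁ (F' , G) y p)) (∈D⁻₂ (F' , G) y p)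
    no-gap-corner (inj₂ (inj₂ R))       = R

    -- Each rank rises by at most one, so the interval is at most a square and only its corners F'|G
    -- and F|G' can be inserted. The second covers E only for empty D. Neither leaves a gap in the
    -- halves, so the gap must come from `R`.
    corner₁₁ : ∀ {R : Set} {ρ} → r F' ≤ suc (r F) → s G ≤ suc (s G') → Allowed x y R ρ →
      (ρ ≡ (F' , G) ⊎ (ρ ≡ (F , G') × (∀ e → e ∉ D x y))) × R
    corner₁₁ {R} {P , Q} a b (vρ , (x≼ρ , x≢ρ) , (ρ≼y , ρ≢y) , gap)
      with flat-between M (flatM vx) (flatM vρ) (≼₁ x≼ρ) (≼₁ ρ≼y) a
         | flat-between N (flatN vy) (flatN vρ) (≼₂ ρ≼y) (≼₂ x≼ρ) b
    ... | inj₁ refl | inj₂ refl = contradiction refl x≢ρ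
    ... | inj₂ refl | inj₁ refl = contradiction refl ρ≢y
    ... | inj₂ refl | inj₂ refl = inj₁ refl , no-gap-corner gap
    ... | inj₁ refl | inj₁ refl = inj₂ (refl , none) , rest gap
      where
      none : ∀ e → e ∉ D x y
      none e p = ∈D⁻₂ x y p (cover vρ e (∈D⁻₁ x y p))
      rest : Nonempty (D x (F , G')) ⊎ Nonempty (D (F , G') y) ⊎ R → R
      rest (inj₁ (e , p))        = contradiction p (none e)
      rest (inj₂ (inj₁ (e , p))) = contradiction p (none e)
      rest (inj₂ (inj₂ R))       = R

    vertex-corner : Vertex (F' , G)
    vertex-corner = record { flatM = flatM vy ; flatN = flatN vx ; cover = λ i p → cover vx i (λ q → p (≼₁ x≼y q)) }

    vertex-corner′ : (∀ e → e ∉ D x y) → Vertex (F , G')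
    vertex-corner′ h = record { flatM = flatM vx ; flatN = flatN vy
      ; cover = λ i p → decidable-stable (i Sₚ.∈? G') (λ q → h i (∈D⁺ x y p q)) }

    corner-allowed : ∀ {R} → r F < r F' → s G' < s G → R → Allowed x y R (F' , G)
    corner-allowed a b R = vertex-corner , ((≼₁ x≼y , id) , λ eq → ℕₚ.<-irrefl (cong (λ z → r (proj₁ z)) eq) a)
      , ((id , ≼₂ x≼y) , λ eq → ℕₚ.<-irrefl (cong (λ z → s (proj₂ z)) (sym eq)) b) , inj₂ (inj₂ R)

    corner-allowed′ : ∀ {R} → r F < r F' → s G' < s G → (∀ e → e ∉ D x y) → R → Allowed x y R (F , G')
    corner-allowed′ a b h R = vertex-corner′ h , ((id , ≼₂ x≼y) , λ eq → ℕₚ.<-irrefl (cong (λ z → s (proj₂ z)) (sym eq)) b)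
      , ((≼₁ x≼y , id) , λ eq → ℕₚ.<-irrefl (cong (λ z → r (proj₁ z)) eq) a) , inj₂ (inj₂ R)

    module _ {R : Set} (a≡2 : r F' ≡ suc (suc (r F))) (b≤1 : s G ≤ suc (s G'))
             (mixed : (∃ λ e → e ∈ D x y × ¬ R) ⊎ (G ≡ G' × R)) where

      allowed-between : ∀ ρ → Allowed x y R ρ → F ⊆ proj₁ ρ × proj₁ ρ ⊆ F' × (proj₂ ρ ≡ G ⊎ proj₂ ρ ≡ G')
      allowed-between ρ (vρ , (x≼ρ , _) , (ρ≼y , _) , _) = ≼₁ x≼ρ , ≼₁ ρ≼y ,
        [ inj₂ , inj₁ ]′ (flat-between N (flatN vy) (flatN vρ) (≼₂ ρ≼y) (≼₂ x≼ρ) b≤1)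

      module _ {i : Fin m} (i∈F' : i ∈ F') (i∉F : i ∉ F) where
        private
          P : Subset m
          P = cl M (F ∪ ⁅ i ⁆)

          F⊆P : F ⊆ P
          F⊆P p = ⊆-cl M (∈ˡ _ p)

          i∈P : i ∈ P
          i∈P = ⊆-cl M (∈ʳ F (Sₚ.x∈⁅x⁆ i))

          rP : r P ≡ suc (r F)
          rP = rk-cl-∪⁅⁆ M (flatM vx) i∉F

          P⊆F' : P ⊆ F'
          P⊆F' = cl-⊆ M (flatM vy) (∪-⊆ (≼₁ x≼y) (⁅⁆-⊆ i∈F'))

          P≢F' : P ≢ F'
          P≢F' eq = ℕₚ.<-irrefl (trans (sym rP) (trans (cong r eq) a≡2)) ℕₚ.≤-refl

          first : ∀ {Q Q' : Subset m} → Allowed x y R (Q , Q') → i ∈ Q → Q ≡ P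
          first {Q} {Q'} (vρ , (x≼ρ , _) , (ρ≼y , ρ≢y) , gap) i∈Q with ≡-or-witness (≼₁ ρ≼y)
          ... | inj₂ (k , k∈ , k∉) = sym (flat-rk-≡ M (flat-cl M _) (cl-⊆ M (flatM vρ) (∪-⊆ (≼₁ x≼ρ) (⁅⁆-⊆ i∈Q)))
                  (ℕₚ.≤-trans (ℕ.s≤s⁻¹ (ℕₚ.≤-trans (flat-< M (flatM vρ) (≼₁ ρ≼y) k∈ k∉) (ℕₚ.≤-reflexive a≡2))) (ℕₚ.≤-reflexive (sym rP))))
          -- `Q` cannot be F': the pair F'|G' is the end `y`, and F'|G either equals `y` or leaves
          -- no gap.
          ... | inj₁ refl with flat-between N (flatN vy) (flatN vρ) (≼₂ ρ≼y) (≼₂ x≼ρ) b≤1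
          ... | inj₁ refl = contradiction refl ρ≢y
          ... | inj₂ refl = ⊥-elim ([ (λ (_ , _ , ¬R) → ¬R (no-gap-corner gap)) , (λ (eq , _) → ρ≢y (cong (F' ,_) eq)) ]′ mixed)

          order : ∀ {Q} → G' ⊆ Q → Q ⊆ G → x ≺ (P , Q) × (P , Q) ≺ y
          order p q = ((F⊆P , q) , λ eq → i∉F (subst (λ z → i ∈ proj₁ z) (sym eq) i∈P)) , ((P⊆F' , p) , λ eq → P≢F' (cong proj₁ eq))

          vertex-PG : Vertex (P , G)
          vertex-PG = record { flatM = flat-cl M _ ; flatN = flatN vx ; cover = λ k h → cover vx k (λ q → h (F⊆P q)) }

        Part : Set
        Part = ∃ λ ρ → Allowed x y R ρ × i ∈ proj₁ ρ × (∀ ρ' → Allowed x y R ρ' → i ∈ proj₁ ρ' → ρ' ≡ ρ)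

        -- The first set must be the flat P spanned by F and i. If G = G', the second set is forced.
        -- If the only gap is in this step, it depends on P: when D is inside P, P|G leaves no gap
        -- and P|G' is the choice; otherwise P|G' does not cover E and P|G keeps a gap.
        allowed-part : Part
        allowed-part = [ (λ (e , e∈D , ¬R) → single-gap e∈D ¬R) , (λ (eq , R) → other-gap eq R) ]′ mixed
          where
          other-gap : G ≡ G' → R → Part
          other-gap eq R = (P , G) , (vertex-PG , proj₁ (order (≼₂ x≼y) id) , proj₂ (order (≼₂ x≼y) id) , inj₂ (inj₂ R)) , i∈P ,
            λ ρ' al i∈ → cong₂ _,_ (first al i∈) ([ id , (λ z → trans z (sym eq)) ]′ (proj₂ (proj₂ (allowed-between ρ' al))))
          single-gap : ∀ {e} → e ∈ D x y → ¬ R → Part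
          single-gap {e} e∈D ¬R with ⊆-or-witness (D x y) P
          ... | inj₁ D⊆P = (P , G') , (vert , proj₁ (order id (≼₂ x≼y)) , proj₂ (order id (≼₂ x≼y)) , inj₁ (e , ∈D⁺ x (P , G') (∈D⁻₁ x y e∈D) (∈D⁻₂ x y e∈D)))
                , i∈P , λ ρ' al i∈ → cong₂ _,_ (first al i∈) (second ρ' al i∈)
            where
            vert : Vertex (P , G')
            vert = record { flatM = flat-cl M _ ; flatN = flatN vy
              ; cover = λ k h → decidable-stable (k Sₚ.∈? G') (λ q → h (D⊆P (∈D⁺ x y (λ z → h (F⊆P z)) q))) }
            second : ∀ ρ' → Allowed x y R ρ' → i ∈ proj₁ ρ' → proj₂ ρ' ≡ G'
            second ρ' al@(_ , _ , _ , gap) i∈ with proj₂ (proj₂ (allowed-between ρ' al))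
            ... | inj₂ eq = eq
            ... | inj₁ eq = contradiction (rest gap) ¬R
              where
              rest : _ → R
              rest (inj₁ (k , p))        = contradiction (cover vx k (∈D⁻₁ x ρ' p)) (λ q → ∈D⁻₂ x ρ' p (subst (k ∈_) (sym eq) q))
              rest (inj₂ (inj₁ (k , p))) = contradiction (subst (k ∈_) (sym (first al i∈))
                (D⊆P (∈D⁺ x y (λ q → ∈D⁻₁ ρ' y p (subst (k ∈_) (sym (first al i∈)) (F⊆P q))) (∈D⁻₂ ρ' y p)))) (∈D⁻₁ ρ' y p)
              rest (inj₂ (inj₂ R))       = R
          ... | inj₂ (k , k∈D , k∉P) = (P , G) , (vertex-PG , proj₁ (order (≼₂ x≼y) id) , proj₂ (order (≼₂ x≼y) id) ,
                  inj₂ (inj₁ (k , ∈D⁺ (P , G) y k∉P (∈D⁻₂ x y k∈D))))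
                , i∈P , λ ρ' al i∈ → cong₂ _,_ (first al i∈) (second ρ' al i∈)
            where
            second : ∀ ρ' → Allowed x y R ρ' → i ∈ proj₁ ρ' → proj₂ ρ' ≡ G
            second ρ' al@(vρ , _) i∈ with proj₂ (proj₂ (allowed-between ρ' al))
            ... | inj₁ eq = eq
            ... | inj₂ eq = contradiction (subst (k ∈_) eq (cover vρ k (λ z → k∉P (subst (k ∈_) (first al i∈) z)))) (∈D⁻₂ x y k∈D)

-- Balancing of the constant weight 1

module TopBalanced {m n : ℕ} (m≡2+n : m ≡ suc (suc n)) (M : Matroid m) (M-⊥ : Flat M ⊥) (N-⊥ : CoFlat M ⊥) (j : Fin m) where

  open Claims m≡2+n M M-⊥ N-⊥ j
  open Codim1 M N dual using (Allowed; corner₁₁; corner-allowed; corner-allowed′; allowed-between; allowed-part)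

  private
    r s : Subset m → ℕ
    r = rk M
    s = rk N

    AP : List (BF m)
    AP = allPairs m

    module Op = Codim1 N M (dual-sym {M = M} {N} dual)

  -- Exchanging the two sets reverses the order and exchanges the matroid with its dual, so that
  -- each analysis of an interval serves twice.
  flip : BF m → BF m
  flip (F , G) = G , F

  flip-vertex : ∀ {x} → Vertex x → Op.Vertex (flip x)
  flip-vertex {x} v = record { flatM = flatN v ; flatN = flatM v
    ; cover = λ i p → decidable-stable (i Sₚ.∈? proj₁ x) (λ q → p (cover v i q)) }

  unflip-vertex : ∀ {x} → Op.Vertex (flip x) → Vertex x
  unflip-vertex {x} v = record { flatM = Op.Vertex.flatN v ; flatN = Op.Vertex.flatM v
    ; cover = λ i p → decidable-stable (i Sₚ.∈? proj₂ x) (λ q → p (Op.Vertex.cover v i q)) }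

  flip-≼ : ∀ {x y} → x ≼ y → flip y Op.≼ flip x
  flip-≼ (a , b) = b Op., a

  flip-allowed : ∀ {x y R ρ} → Allowed x y R ρ → Op.Allowed (flip y) (flip x) R (flip ρ)
  flip-allowed {x} {y} {R} {ρ} (v , (l , l≢) , (u , u≢) , gap) = flip-vertex v
    , (flip-≼ u , λ eq → u≢ (cong flip (sym eq))) , (flip-≼ l , λ eq → l≢ (cong flip (sym eq))) , g gap
    where
    g : Nonempty (D x ρ) ⊎ Nonempty (D ρ y) ⊎ R → Nonempty (Op.D (flip y) (flip ρ)) ⊎ Nonempty (Op.D (flip ρ) (flip x)) ⊎ R
    g (inj₁ (e , p))        = inj₂ (inj₁ (e , Op.∈D⁺ (flip ρ) (flip x) (∈D⁻₂ x ρ p) (∈D⁻₁ x ρ p)))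
    g (inj₂ (inj₁ (e , p))) = inj₁ (e , Op.∈D⁺ (flip y) (flip ρ) (∈D⁻₂ ρ y p) (∈D⁻₁ ρ y p))
    g (inj₂ (inj₂ h))       = inj₂ (inj₂ h)

  unflip-allowed : ∀ {x y R ρ} → Op.Allowed (flip y) (flip x) R (flip ρ) → Allowed x y R ρ
  unflip-allowed {x} {y} {R} {ρ} (v , (l , l≢) , (u , u≢) , gap) = unflip-vertex v
    , ((Op._≼_.≼₂ u , Op._≼_.≼₁ u) , λ eq → u≢ (cong flip (sym eq)))
    , ((Op._≼_.≼₂ l , Op._≼_.≼₁ l) , λ eq → l≢ (cong flip (sym eq))) , g gap
    where
    g : Nonempty (Op.D (flip y) (flip ρ)) ⊎ Nonempty (Op.D (flip ρ) (flip x)) ⊎ R → Nonempty (D x ρ) ⊎ Nonempty (D ρ y) ⊎ R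
    g (inj₁ (e , p))        = inj₂ (inj₁ (e , ∈D⁺ ρ y (Op.∈D⁻₂ (flip y) (flip ρ) p) (Op.∈D⁻₁ (flip y) (flip ρ) p)))
    g (inj₂ (inj₁ (e , p))) = inj₁ (e , ∈D⁺ x ρ (Op.∈D⁻₂ (flip ρ) (flip x) p) (Op.∈D⁻₁ (flip ρ) (flip x) p))
    g (inj₂ (inj₂ h))       = inj₂ (inj₂ h)

  size-parts : ∀ {x y} → x ≼ y → ∃ λ a → ∃ λ b →
    r (proj₁ y) ≡ a + r (proj₁ x) × s (proj₂ x) ≡ b + s (proj₂ y) × size x y ≡ a + b
  size-parts {x} {y} h = a , b , ra , sb ,
    ar a b (r (proj₁ x)) (s (proj₂ y)) (size x y) (trans (size-+ h) (cong₂ _+_ ra sb))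
    where
    a b : ℕ
    a = r (proj₁ y) ∸ r (proj₁ x)
    b = s (proj₂ x) ∸ s (proj₂ y)
    ra : r (proj₁ y) ≡ a + r (proj₁ x)
    ra = sym (ℕₚ.m∸n+n≡m (rk-mono M (≼₁ h)))
    sb : s (proj₂ x) ≡ b + s (proj₂ y)
    sb = sym (ℕₚ.m∸n+n≡m (rk-mono N (≼₂ h)))
    ar : ∀ a b c d z → z + (c + d) ≡ a + c + (b + d) → z ≡ a + b
    ar a b c d z eq = ℕₚ.+-cancelʳ-≡ (c + d) z (a + b) (trans eq (lem a b c d))
      where
      lem : ∀ a b c d → a + c + (b + d) ≡ a + b + (c + d)
      lem = ℕRing.solve-∀

  Pure : Step → Set
  Pure (x , y) = proj₁ x ≡ proj₁ y ⊎ proj₂ x ≡ proj₂ y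

  pure-no-gap : ∀ {x y e} → IsStep (x , y) → Pure (x , y) → e ∉ D x y
  pure-no-gap {x} {y} h (inj₁ eq) e∈D = ℕₚ.<-irrefl (cong r eq) (D⇒<₁ (source h) (target h) (less≼ h) e∈D)
  pure-no-gap {x} {y} h (inj₂ eq) e∈D = ℕₚ.<-irrefl (cong s (sym eq)) (D⇒<₂ (source h) (target h) (less≼ h) e∈D)

  small⇒pure : ∀ {x y} → IsStep (x , y) → size x y ≤ 1 → Pure (x , y)
  small⇒pure {x} {y} h le with ≡-or-witness (≼₁ (less≼ h))
  ... | inj₁ eq          = inj₁ eq
  ... | inj₂ (e , p , q) = inj₂ (sym (flat-rk-≡ N (flatN (target h)) (≼₂ (less≼ h))
          (size-<₁ (less≼ h) 0 le (flat-< M (flatM (source h)) (≼₁ (less≼ h)) p q))))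

  small⇒no-room : ∀ {x y ρ} → IsStep (x , y) → size x y ≤ 1 → Vertex ρ → x ≺ ρ → ¬ (ρ ≺ y)
  small⇒no-room {x} {y} {ρ} h le vρ l u = ℕₚ.<⇒≱ (ℕₚ.+-mono-≤ (≺⇒1≤size (source h) vρ l) (≺⇒1≤size vρ (target h) u))
    (ℕₚ.≤-trans (ℕₚ.≤-reflexive (sym (size-split (proj₁ l) (proj₁ u)))) le)

  module _ {A : Set} where

    span-∑-All : ∀ τ {L : List A} {v w : A → Fin m → ℤ} → All (λ x → Span τ (v x) (w x)) L →
      Span τ (λ i → ∑ L (λ x → v x i)) (λ i → ∑ L (λ x → w x i))
    span-∑-All τ []       = span-const τ (+ 0) (+ 0)
    span-∑-All τ (h ∷ hs) = span-+ τ h (span-∑-All τ hs)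

  span-neg : ∀ (τ : List (BF m)) {v w} → Span τ v w → Span τ (λ i → - v i) (λ i → - w i)
  span-neg τ {v} {w} h = span-cong τ (λ i → ℤₚ.-1*i≡-i (v i)) (λ i → ℤₚ.-1*i≡-i (w i)) (span-* τ (ℤ.-[1+ 0 ]) h)

  -- The indicators of F' - F and G - G' for a step. Over a chain each kind adds up to the constant
  -- 1, which is zero in the quotient.
  E B : Step → Fin m → ℤ
  E (x , y) i = ind (proj₁ y) i -ℤ ind (proj₁ x) i
  B (x , y) i = ind (proj₂ x) i -ℤ ind (proj₂ y) i

  private
    O : Fin m → ℤ
    O _ = + 0

  ind-⊥ : ∀ i → ind (⊥ {m}) i ≡ + 0
  ind-⊥ i = ind-∉ {m} {⊥} Sₚ.∉⊥

  ind-⊤ : ∀ i → ind (⊤ {m}) i ≡ + 1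
  ind-⊤ i = ind-∈ {m} {⊤} Sₚ.∈⊤

  telescope : ∀ {τ L} → Built τ L → (∀ i → ∑ L (λ st → E st i) ≡ + 1) × (∀ i → ∑ L (λ st → B st i) ≡ + 1)
  telescope base = (λ i → cong₂ (λ a b → a -ℤ b +ℤ + 0) (ind-⊤ i) (ind-⊥ i)) , (λ i → cong₂ (λ a b → a -ℤ b +ℤ + 0) (ind-⊤ i) (ind-⊥ i))
  telescope (insert {x = x} {y} {ρ} {rest} b p _ _ _) =
    (λ i → trans (l₁ (ind (proj₁ x) i) (ind (proj₁ ρ) i) (ind (proj₁ y) i) (∑ rest (λ st → E st i)))
             (trans (sym (∑-↭ (λ st → E st i) p)) (proj₁ (telescope b) i))) ,
    (λ i → trans (l₂ (ind (proj₂ x) i) (ind (proj₂ ρ) i) (ind (proj₂ y) i) (∑ rest (λ st → B st i)))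
             (trans (sym (∑-↭ (λ st → B st i) p)) (proj₂ (telescope b) i)))
    where
    l₁ : ∀ a b c z → (b -ℤ a) +ℤ ((c -ℤ b) +ℤ z) ≡ (c -ℤ a) +ℤ z
    l₁ = ℤRing.solve-∀
    l₂ : ∀ a b c z → (a -ℤ b) +ℤ ((b -ℤ c) +ℤ z) ≡ (a -ℤ c) +ℤ z
    l₂ = ℤRing.solve-∀

  span-ends : ∀ {τ L st} → Built τ L → st L∈.∈ L →
    Span τ (ind (proj₁ (proj₁ st))) (ind (proj₂ (proj₁ st))) × Span τ (ind (proj₁ (proj₂ st))) (ind (proj₂ (proj₂ st)))
  span-ends {τ} {L} {x , y} b st∈ = lower (proj₁ ends) , upper (proj₂ ends)
    where
    ends : (x ≡ bot ⊎ x L∈.∈ τ) × (y ≡ top ⊎ y L∈.∈ τ)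
    ends = All.lookup (built-ends b) st∈
    lower : x ≡ bot ⊎ x L∈.∈ τ → Span τ (ind (proj₁ x)) (ind (proj₂ x))
    lower (inj₁ refl) = span-cong τ (λ i → sym (ind-⊥ i)) (λ i → sym (ind-⊤ i)) (span-const τ (+ 0) (+ 1))
    lower (inj₂ p)    = span-∈ p
    upper : y ≡ top ⊎ y L∈.∈ τ → Span τ (ind (proj₁ y)) (ind (proj₂ y))
    upper (inj₁ refl) = span-cong τ (λ i → sym (ind-⊤ i)) (λ i → sym (ind-⊥ i)) (span-const τ (+ 1) (+ 0))
    upper (inj₂ p)    = span-∈ p

  -- The rays of the two ends differ in one component only, so their difference is one block up to
  -- sign, and the other block is zero.
  span-pure : ∀ {τ L st} → Built τ L → st L∈.∈ L → Pure st → Span τ (E st) O × Span τ O (B st)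
  span-pure {τ} {L} {x , y} b st∈ = go
    where
    diff : Span τ (λ i → ind (proj₁ y) i -ℤ ind (proj₁ x) i) (λ i → ind (proj₂ y) i -ℤ ind (proj₂ x) i)
    diff = span-+ τ (proj₂ (span-ends b st∈)) (span-neg τ (proj₁ (span-ends b st∈)))
    self : ∀ {S T : Subset m} → S ≡ T → ∀ i → + 0 ≡ ind T i -ℤ ind S i
    self {S} refl i = sym (ℤₚ.+-inverseʳ (ind S i))
    anti : ∀ a b → - (a -ℤ b) ≡ b -ℤ a
    anti = ℤRing.solve-∀
    go : Pure (x , y) → Span τ (E (x , y)) O × Span τ O (B (x , y))
    go (inj₁ eq) = span-cong τ (self eq) (λ _ → refl) (span-const τ (+ 0) (+ 0))
                 , span-cong τ (λ i → cong -_ (sym (self eq i))) (λ i → anti (ind (proj₂ y) i) (ind (proj₂ x) i)) (span-neg τ diff)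
    go (inj₂ eq) = span-cong τ (λ _ → refl) (λ i → sym (self eq i)) diff
                 , span-cong τ (λ _ → refl) (self (sym eq)) (span-const τ (+ 0) (+ 0))

  -- The block e_A over the non-pure steps is the complement of the blocks over the pure ones.
  span-rest : ∀ {τ L K K'} → Built τ L → L ↭ K ++ K' → All Pure K' →
    Span τ (λ i → ∑ K (λ st → E st i)) O × Span τ O (λ i → ∑ K (λ st → B st i))
  span-rest {τ} {L} {K} {K'} b p pures =
    span-cong τ (λ i → solveE i) (λ _ → zeros K') (span-+ τ (span-const τ (+ 1) (+ 0)) (span-neg τ (span-∑-All τ (All.map proj₁ blocks)))) ,
    span-cong τ (λ _ → zeros K') (λ i → solveB i) (span-+ τ (span-const τ (+ 0) (+ 1)) (span-neg τ (span-∑-All τ (All.map proj₂ blocks))))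
    where
    member : ∀ {st} → st L∈.∈ K' → st L∈.∈ L
    member q = ↭ₚ.∈-resp-↭ (↭-sym p) (L∈ₚ.∈-++⁺ʳ K q)
    blocks : All (λ st → Span τ (E st) O × Span τ O (B st)) K'
    blocks = All.tabulate (λ q → span-pure b (member q) (All.lookup pures q))
    zeros : ∀ (K : List Step) → + 0 +ℤ - ∑ K (λ _ → + 0) ≡ + 0
    zeros K = cong (λ z → + 0 +ℤ - z) (∑-zero K (λ _ → refl))
    lem : ∀ a b → a +ℤ b +ℤ - b ≡ a
    lem = ℤRing.solve-∀
    solveE : ∀ i → + 1 +ℤ - ∑ K' (λ st → E st i) ≡ ∑ K (λ st → E st i)
    solveE i = trans (cong (_+ℤ - ∑ K' (λ st → E st i)) (trans (sym (proj₁ (telescope b) i)) (trans (∑-↭ (λ st → E st i) p) (∑-++ K K' (λ st → E st i)))))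
      (lem (∑ K (λ st → E st i)) (∑ K' (λ st → E st i)))
    solveB : ∀ i → + 1 +ℤ - ∑ K' (λ st → B st i) ≡ ∑ K (λ st → B st i)
    solveB i = trans (cong (_+ℤ - ∑ K' (λ st → B st i)) (trans (sym (proj₂ (telescope b) i)) (trans (∑-↭ (λ st → B st i) p) (∑-++ K K' (λ st → B st i)))))
      (lem (∑ K (λ st → B st i)) (∑ K' (λ st → B st i)))

  GapIn : List Step → Set
  GapIn K = ∃ λ st → st L∈.∈ K × Nonempty (D (proj₁ st) (proj₂ st))

  module _ {c₀ : Weight m} (isTop : IsTop M (suc n) c₀) {τ : List (BF m)} {L : List Step} (b : Built τ L) (len : suc (length τ) ≡ n) where
    private
      A : BF m → ℤ
      A ρ = c₀ (ρ ∷ τ)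

      steps : All IsStep L
      steps = built-steps b

      Goal : Set
      Goal = Span τ (λ i → ∑ AP (λ ρ → A ρ *ℤ ind (proj₁ ρ) i)) (λ i → ∑ AP (λ ρ → A ρ *ℤ ind (proj₂ ρ) i))

      A-biflag : ∀ {ρ} → A ρ ≢ + 0 → IsBiflag M (ρ ∷ τ)
      A-biflag {ρ} nz = proj₁ (supported-powCap isTop zero {c₀} (λ _ → refl) (ρ ∷ τ) nz)

      A-locate : ∀ {ρ} → A ρ ≢ + 0 → Vertex ρ × ∃ λ st → st L∈.∈ L × proj₁ st ≺ ρ × ρ ≺ proj₂ st
      A-locate {ρ} nz = Inner.vertex i , locate b i (tl (proj₁ (proj₂ (A-biflag nz))))
        where
        i : Inner ρ
        i = biflat⇒inner (All.head (proj₁ (A-biflag nz)))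
        tl : AllPairs Apart (ρ ∷ τ) → All (Beside ρ) τ
        tl (h ∷ _) = All.map beside h

      A-allowed : ∀ {x y K ρ} → L ↭ (x , y) ∷ K → Vertex ρ → x ≺ ρ → ρ ≺ y → A ρ ≢ + 0 → Allowed x y (GapIn K) ρ
      A-allowed {x} {y} {K} {ρ} p vρ l u nz = vρ , l , u , sort (gap-step (insert b p vρ l u) (proj₂ (biflag-gap (A-biflag nz))))
        where
        sort : ∀ {e} → (∃ λ st → st L∈.∈ ((x , ρ) ∷ (ρ , y) ∷ K) × e ∈ D (proj₁ st) (proj₂ st)) →
          Nonempty (D x ρ) ⊎ Nonempty (D ρ y) ⊎ GapIn K
        sort (_ , here refl , e∈)         = inj₁ (_ , e∈)
        sort (_ , there (here refl) , e∈) = inj₂ (inj₁ (_ , e∈))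
        sort (st , there (there q) , e∈)  = inj₂ (inj₂ (st , q , _ , e∈))

      A-one : ∀ {x y K ρ} → L ↭ (x , y) ∷ K → Allowed x y (GapIn K) ρ → A ρ ≡ + 1
      A-one {x} {y} {K} {ρ} p (vρ , l , u , gap) = proj₁ (isTop (ρ ∷ τ)) (bf gap , len)
        where
        b' : Built (ρ ∷ τ) ((x , ρ) ∷ (ρ , y) ∷ K)
        b' = insert b p vρ l u
        bf : Nonempty (D x ρ) ⊎ Nonempty (D ρ y) ⊎ GapIn K → IsBiflag M (ρ ∷ τ)
        bf (inj₁ (e , e∈))               = built⇒biflag b' (step-gap b' (here refl) e∈)
        bf (inj₂ (inj₁ (e , e∈)))        = built⇒biflag b' (step-gap b' (there (here refl)) e∈)
        bf (inj₂ (inj₂ (st , q , e , e∈))) = built⇒biflag b' (step-gap b' (there (there q)) e∈)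

      -- By `parts-sum₁` and `parts-sum₂` the ray sum is S times the ray of x, plus the block E in
      -- the first component, minus T times the block B in the second.
      two-M : ∀ {x y K} → L ↭ (x , y) ∷ K → r (proj₁ y) ≡ suc (suc (r (proj₁ x))) → s (proj₂ x) ≤ suc (s (proj₂ y)) →
        (∃ λ e → e ∈ D x y × ¬ GapIn K) ⊎ (proj₂ x ≡ proj₂ y × GapIn K) →
        (∀ ρ → A ρ ≢ + 0 → Allowed x y (GapIn K) ρ) → Span τ (E (x , y)) O → Span τ O (B (x , y)) → Goal
      two-M {x} {y} {K} p a≡2 b≤1 mixed only spE spB = span-cong τ
          (λ i → trans (l₁ (S *ℤ ind (proj₁ x) i) (E (x , y) i) T) (sym (parts-sum₁ A proj₁ proj₂ F⊆ btw prt i)))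
          (λ i → trans (l₂ (S *ℤ ind (proj₂ x) i) (B (x , y) i) T) (sym (parts-sum₂ A proj₁ proj₂ F⊆ btw prt i)))
          (span-+ τ (span-* τ S (proj₁ (span-ends b st∈))) (span-+ τ spE (span-neg τ (span-* τ T spB))))
        where
        S T : ℤ
        S = ∑ AP A
        T = ∑ AP (λ ρ → if does (proj₂ ρ ≟ˢ proj₂ x) then + 0 else A ρ)
        st∈ : (x , y) L∈.∈ L
        st∈ = ↭ₚ.∈-resp-↭ (↭-sym p) (here refl)
        h : IsStep (x , y)
        h = All.lookup steps st∈
        F⊆ : proj₁ x ⊆ proj₁ y
        F⊆ = ≼₁ (less≼ h)
        btw : ∀ ρ → A ρ ≢ + 0 → proj₁ x ⊆ proj₁ ρ × proj₁ ρ ⊆ proj₁ y × (proj₂ ρ ≡ proj₂ x ⊎ proj₂ ρ ≡ proj₂ y)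
        btw ρ nz = allowed-between (source h) (target h) (less≼ h) a≡2 b≤1 mixed ρ (only ρ nz)
        prt : ∀ i → i ∈ proj₁ y → i ∉ proj₁ x → ∃ λ ρ → A ρ ≡ + 1 × i ∈ proj₁ ρ × (∀ ρ' → A ρ' ≢ + 0 → i ∈ proj₁ ρ' → ρ' ≡ ρ)
        prt i i∈ i∉ = let (ρ , al , i∈ρ , uniq) = allowed-part (source h) (target h) (less≼ h) a≡2 b≤1 mixed i∈ i∉ in
          ρ , A-one p al , i∈ρ , λ ρ' nz → uniq ρ' (only ρ' nz)
        l₁ : ∀ a e t → a +ℤ (e +ℤ - (t *ℤ + 0)) ≡ a +ℤ e
        l₁ = ℤRing.solve-∀
        l₂ : ∀ a e t → a +ℤ (+ 0 +ℤ - (t *ℤ e)) ≡ a -ℤ t *ℤ e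
        l₂ = ℤRing.solve-∀

      two-N : ∀ {x y K} → L ↭ (x , y) ∷ K → s (proj₂ x) ≡ suc (suc (s (proj₂ y))) → r (proj₁ y) ≤ suc (r (proj₁ x)) →
        (∃ λ e → e ∈ D x y × ¬ GapIn K) ⊎ (proj₁ x ≡ proj₁ y × GapIn K) →
        (∀ ρ → A ρ ≢ + 0 → Allowed x y (GapIn K) ρ) → Span τ (E (x , y)) O → Span τ O (B (x , y)) → Goal
      two-N {x} {y} {K} p a≡2 b≤1 mixed only spE spB = span-cong τ
          (λ i → trans (l₂ (S *ℤ ind (proj₁ y) i) (E (x , y) i) T) (sym (parts-sum₂ A proj₂ proj₁ G⊆ btw prt i)))
          (λ i → trans (l₁ (S *ℤ ind (proj₂ y) i) (B (x , y) i) T) (sym (parts-sum₁ A proj₂ proj₁ G⊆ btw prt i)))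
          (span-+ τ (span-* τ S (proj₂ (span-ends b st∈))) (span-+ τ spB (span-neg τ (span-* τ T spE))))
        where
        S T : ℤ
        S = ∑ AP A
        T = ∑ AP (λ ρ → if does (proj₁ ρ ≟ˢ proj₁ y) then + 0 else A ρ)
        st∈ : (x , y) L∈.∈ L
        st∈ = ↭ₚ.∈-resp-↭ (↭-sym p) (here refl)
        h : IsStep (x , y)
        h = All.lookup steps st∈
        G⊆ : proj₂ y ⊆ proj₂ x
        G⊆ = ≼₂ (less≼ h)
        mixed' : (∃ λ e → e ∈ Op.D (flip y) (flip x) × ¬ GapIn K) ⊎ (proj₁ y ≡ proj₁ x × GapIn K)
        mixed' = [ (λ (e , e∈ , g) → inj₁ (e , Op.∈D⁺ (flip y) (flip x) (∈D⁻₂ x y e∈) (∈D⁻₁ x y e∈) , g))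
                 , (λ (eq , g) → inj₂ (sym eq , g)) ]′ mixed
        btw : ∀ ρ → A ρ ≢ + 0 → proj₂ y ⊆ proj₂ ρ × proj₂ ρ ⊆ proj₂ x × (proj₁ ρ ≡ proj₁ y ⊎ proj₁ ρ ≡ proj₁ x)
        btw ρ nz = Op.allowed-between (flip-vertex (target h)) (flip-vertex (source h)) (flip-≼ (less≼ h)) a≡2 b≤1 mixed'
          (flip ρ) (flip-allowed (only ρ nz))
        prt : ∀ i → i ∈ proj₂ x → i ∉ proj₂ y → ∃ λ ρ → A ρ ≡ + 1 × i ∈ proj₂ ρ × (∀ ρ' → A ρ' ≢ + 0 → i ∈ proj₂ ρ' → ρ' ≡ ρ)
        prt i i∈ i∉ = let (ρ , al , i∈ρ , uniq) = Op.allowed-part (flip-vertex (target h)) (flip-vertex (source h)) (flip-≼ (less≼ h)) a≡2 b≤1 mixed' i∈ i∉ in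
          flip ρ , A-one p (unflip-allowed al) , i∈ρ , λ ρ' nz i∈' → cong flip (uniq (flip ρ') (flip-allowed (only ρ' nz)) i∈')
        l₁ : ∀ a e t → a +ℤ (e +ℤ - (t *ℤ + 0)) ≡ a +ℤ e
        l₁ = ℤRing.solve-∀
        l₂ : ∀ a e t → a +ℤ (+ 0 +ℤ - (t *ℤ e)) ≡ a -ℤ t *ℤ e
        l₂ = ℤRing.solve-∀

      two-points : ∀ {ρ σ} → ρ ≢ σ → A ρ ≡ + 1 → A σ ≡ + 1 → (∀ ρ' → A ρ' ≢ + 0 → ρ' ≡ ρ ⊎ ρ' ≡ σ) →
        ∀ (p : BF m → Subset m) i → ∑ AP (λ ρ' → A ρ' *ℤ ind (p ρ') i) ≡ ind (p ρ) i +ℤ ind (p σ) i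
      two-points {ρ} {σ} ne h k only p i = trans
        (∑-allPairs₂ ρ σ _ ne (λ ρ' n₁ n₂ → cong (_*ℤ ind (p ρ') i)
          (decidable-stable (A ρ' ℤₚ.≟ + 0) (λ nz → [ n₁ , n₂ ]′ (only ρ' nz)))))
        (cong₂ _+ℤ_ (trans (cong (_*ℤ ind (p ρ) i) h) (ℤₚ.*-identityˡ _)) (trans (cong (_*ℤ ind (p σ) i) k) (ℤₚ.*-identityˡ _)))

      Small : Step → Set
      Small st = size (proj₁ st) (proj₂ st) ≤ 1

      no-gaps : ∀ {K} → (∀ {st} → st L∈.∈ K → st L∈.∈ L) → All Pure K → ¬ GapIn K
      no-gaps sub pures (st , st∈ , e , e∈) = pure-no-gap (All.lookup steps (sub st∈)) (All.lookup pures st∈) e∈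

      pures : ∀ {K} → (∀ {st} → st L∈.∈ K → st L∈.∈ L) → All Small K → All Pure K
      pures sub small = All.tabulate (λ q → small⇒pure (All.lookup steps (sub q)) (All.lookup small q))

      -- One step with a gap carries the whole surplus. Both of its ranks rise, so the rises are 1
      -- and 2 in some order.
      one-block : ∀ {x y K e} → L ↭ (x , y) ∷ K → e ∈ D x y → size x y ≡ 3 → All Small K → Goal
      one-block {x} {y} {K} {e} p e∈D sz small = cases (size-parts (less≼ h))
        where
        sub : ∀ {st} → st L∈.∈ K → st L∈.∈ L
        sub q = ↭ₚ.∈-resp-↭ (↭-sym p) (there q)
        h : IsStep (x , y)
        h = All.lookup steps (↭ₚ.∈-resp-↭ (↭-sym p) (here refl))
        only : ∀ ρ → A ρ ≢ + 0 → Allowed x y (GapIn K) ρ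
        only ρ nz = place (↭ₚ.∈-resp-↭ p (proj₁ (proj₂ (proj₂ loc)))) (proj₁ (proj₂ (proj₂ (proj₂ loc)))) (proj₂ (proj₂ (proj₂ (proj₂ loc))))
          where
          loc = A-locate nz
          place : ∀ {st} → st L∈.∈ ((x , y) ∷ K) → proj₁ st ≺ ρ → ρ ≺ proj₂ st → Allowed x y (GapIn K) ρ
          place (here refl) l u = A-allowed p (proj₁ loc) l u nz
          place (there q)   l u = contradiction u (small⇒no-room (All.lookup steps (sub q)) (All.lookup small q) (proj₁ loc) l)
        no-gap : ¬ GapIn K
        no-gap = no-gaps sub (pures sub small)
        blocks : Span τ (λ i → E (x , y) i +ℤ + 0) O × Span τ O (λ i → B (x , y) i +ℤ + 0)
        blocks = span-rest {K = (x , y) ∷ []} b p (pures sub small)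
        spE : Span τ (E (x , y)) O
        spE = span-cong τ (λ i → ℤₚ.+-identityʳ (E (x , y) i)) (λ _ → refl) (proj₁ blocks)
        spB : Span τ O (B (x , y))
        spB = span-cong τ (λ _ → refl) (λ i → ℤₚ.+-identityʳ (B (x , y) i)) (proj₂ blocks)
        r< = D⇒<₁ (source h) (target h) (less≼ h) e∈D
        s< = D⇒<₂ (source h) (target h) (less≼ h) e∈D
        cases : (∃ λ a → ∃ λ b → r (proj₁ y) ≡ a + r (proj₁ x) × s (proj₂ x) ≡ b + s (proj₂ y) × size x y ≡ a + b) → Goal
        cases (a , b , ra , sb , ab) = go a b ra sb (trans (sym ab) sz)
          where
          go : ∀ a b → r (proj₁ y) ≡ a + r (proj₁ x) → s (proj₂ x) ≡ b + s (proj₂ y) → a + b ≡ 3 → Goal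
          go 0 b ra sb eq = contradiction r< (ℕₚ.<-irrefl (sym ra))
          go 1 2 ra sb eq = two-N p sb (ℕₚ.≤-reflexive ra) (inj₁ (e , e∈D , no-gap)) only spE spB
          go 2 1 ra sb eq = two-M p ra (ℕₚ.≤-reflexive sb) (inj₁ (e , e∈D , no-gap)) only spE spB
          go (suc (suc (suc a))) 0 ra sb eq = contradiction s< (ℕₚ.<-irrefl (sym sb))
          go 1 0 ra sb ()
          go 1 1 ra sb ()
          go 1 (suc (suc (suc b))) ra sb ()
          go 2 0 ra sb ()
          go 2 (suc (suc b)) ra sb ()
          go (suc (suc (suc a))) (suc b) ra sb eq = contradiction eq (λ eq' → ℕₚ.1+n≢0 {b} (ℕₚ.m+n≡0⇒n≡0 a (ℕₚ.suc-injective (ℕₚ.suc-injective (ℕₚ.suc-injective eq')))))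

      -- The first step has a gap, so both of its ranks rise by one. If the second step rises in one
      -- rank only, by two, every insertion falls into it and its flats form a partition; if it
      -- rises by one in each rank, two corners contribute.
      two-blocks : ∀ {x y x' y' K e} → L ↭ (x , y) ∷ (x' , y') ∷ K → e ∈ D x y → size x y ≡ 2 → size x' y' ≡ 2 → All Small K → Goal
      two-blocks {x} {y} {x'} {y'} {K} {e} p e∈D sz sz' small = cases (size-parts (less≼ h'))
        where
        p' : L ↭ (x' , y') ∷ (x , y) ∷ K
        p' = ↭-trans p (swap (x , y) (x' , y') ↭-refl)
        sub : ∀ {st} → st L∈.∈ K → st L∈.∈ L
        sub q = ↭ₚ.∈-resp-↭ (↭-sym p) (there (there q))
        st∈ : (x , y) L∈.∈ L
        st∈ = ↭ₚ.∈-resp-↭ (↭-sym p) (here refl)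
        st∈' : (x' , y') L∈.∈ L
        st∈' = ↭ₚ.∈-resp-↭ (↭-sym p') (here refl)
        h : IsStep (x , y)
        h = All.lookup steps st∈
        h' : IsStep (x' , y')
        h' = All.lookup steps st∈'
        r< = D⇒<₁ (source h) (target h) (less≼ h) e∈D
        s< = D⇒<₂ (source h) (target h) (less≼ h) e∈D
        r≤ : r (proj₁ y) ≤ suc (r (proj₁ x))
        r≤ = size-<₂ (less≼ h) 1 (ℕₚ.≤-reflexive sz) s<
        s≤ : s (proj₂ x) ≤ suc (s (proj₂ y))
        s≤ = size-<₁ (less≼ h) 1 (ℕₚ.≤-reflexive sz) r<
        pureK : All Pure K
        pureK = pures sub small
        gap₀ : GapIn ((x , y) ∷ K)
        gap₀ = (x , y) , here refl , e , e∈D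
        dichotomy : ∀ ρ → A ρ ≢ + 0 → Allowed x y (GapIn ((x' , y') ∷ K)) ρ ⊎ Allowed x' y' (GapIn ((x , y) ∷ K)) ρ
        dichotomy ρ nz = place (↭ₚ.∈-resp-↭ p (proj₁ (proj₂ (proj₂ loc)))) (proj₁ (proj₂ (proj₂ (proj₂ loc)))) (proj₂ (proj₂ (proj₂ (proj₂ loc))))
          where
          loc = A-locate nz
          place : ∀ {st} → st L∈.∈ ((x , y) ∷ (x' , y') ∷ K) → proj₁ st ≺ ρ → ρ ≺ proj₂ st →
            Allowed x y (GapIn ((x' , y') ∷ K)) ρ ⊎ Allowed x' y' (GapIn ((x , y) ∷ K)) ρ
          place (here refl)         l u = inj₁ (A-allowed p (proj₁ loc) l u nz)
          place (there (here refl)) l u = inj₂ (A-allowed p' (proj₁ loc) l u nz)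
          place (there (there q))   l u = contradiction u (small⇒no-room (All.lookup steps (sub q)) (All.lookup small q) (proj₁ loc) l)
        other-gap : (∀ e → e ∉ D x' y') → ¬ GapIn ((x' , y') ∷ K)
        other-gap none (_ , here refl , e , e∈) = none e e∈
        other-gap none (st , there q , g)       = no-gaps sub pureK (st , q , g)
        only-second : (∀ e → e ∉ D x' y') → ∀ ρ → A ρ ≢ + 0 → Allowed x' y' (GapIn ((x , y) ∷ K)) ρ
        only-second none ρ nz = [ (λ al → contradiction (proj₂ (corner₁₁ (source h) (target h) (less≼ h) r≤ s≤ al)) (other-gap none)) , id ]′ (dichotomy ρ nz)
        pure-case : Pure (x' , y') → (∀ ρ → A ρ ≢ + 0 → Allowed x' y' (GapIn ((x , y) ∷ K)) ρ) × Span τ (E (x' , y')) O × Span τ O (B (x' , y'))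
        pure-case pu = only-second (λ e → pure-no-gap h' pu) , span-pure b st∈' pu
        module _ (ra : r (proj₁ y') ≡ suc (r (proj₁ x'))) (sb : s (proj₂ x') ≡ suc (s (proj₂ y'))) where
          r<' : r (proj₁ x') < r (proj₁ y')
          r<' = ℕₚ.≤-reflexive (sym ra)
          s<' : s (proj₂ y') < s (proj₂ x')
          s<' = ℕₚ.≤-reflexive (sym sb)
          up up' : BF m
          up  = proj₁ y , proj₂ x
          up' = proj₁ y' , proj₂ x'
          A-up' : A up' ≡ + 1
          A-up' = A-one p' (corner-allowed (source h') (target h') (less≼ h') r<' s<' gap₀)
          -- Refining the first step would close the only gap. The two corners of the second step
          -- have the same ray sum as its two ends.
          gapless : (∀ e → e ∉ D x' y') → Goal
          gapless none = span-cong τ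
              (λ i → trans (ℤₚ.+-comm (ind (proj₁ x') i) _) (sym (two-points ne A-up' A-dn only proj₁ i)))
              (λ i → sym (two-points ne A-up' A-dn only proj₂ i))
              (span-+ τ (proj₁ (span-ends b st∈')) (proj₂ (span-ends b st∈')))
            where
            dn : BF m
            dn = proj₁ x' , proj₂ y'
            A-dn : A dn ≡ + 1
            A-dn = A-one p' (corner-allowed′ (source h') (target h') (less≼ h') r<' s<' none gap₀)
            ne : up' ≢ dn
            ne eq = ℕₚ.<-irrefl (cong (λ z → r (proj₁ z)) (sym eq)) r<'
            only : ∀ ρ → A ρ ≢ + 0 → ρ ≡ up' ⊎ ρ ≡ dn
            only ρ nz = [ inj₁ , (λ z → inj₂ (proj₁ z)) ]′ (proj₁ (corner₁₁ (source h') (target h') (less≼ h')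
              (ℕₚ.≤-reflexive ra) (ℕₚ.≤-reflexive sb) (only-second none ρ nz)))
          -- Each gap permits the corner F'|G of the other step. The two corners add up to the two
          -- lower ends plus the E-blocks of both steps, and `span-rest` supplies these blocks as
          -- one sum.
          gapped : Nonempty (D x' y') → Goal
          gapped (e' , e'∈D) = span-cong τ
              (λ i → trans (l₁ (ind (proj₁ x) i) (ind (proj₁ x') i) (ind (proj₁ y) i) (ind (proj₁ y') i)) (sym (two-points ne A-up A-up' only proj₁ i)))
              (λ i → trans (l₂ (ind (proj₂ x) i) (ind (proj₂ x') i)) (sym (two-points ne A-up A-up' only proj₂ i)))
              (span-+ τ (span-+ τ (proj₁ (span-ends b st∈)) (proj₁ (span-ends b st∈')))
                        (proj₁ (span-rest {K = (x , y) ∷ (x' , y') ∷ []} b p pureK)))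
            where
            l₁ : ∀ a b c d → (a +ℤ b) +ℤ ((c -ℤ a) +ℤ ((d -ℤ b) +ℤ + 0)) ≡ c +ℤ d
            l₁ = ℤRing.solve-∀
            l₂ : ∀ a b → (a +ℤ b) +ℤ + 0 ≡ a +ℤ b
            l₂ = ℤRing.solve-∀
            A-up : A up ≡ + 1
            A-up = A-one p (corner-allowed (source h) (target h) (less≼ h) r< s< ((x' , y') , here refl , e' , e'∈D))
            ne : up ≢ up'
            -- Both sets of `up` contain e, while e stays in the gap after the insertion of `up'`.
            ne eq = All.head (step-gap b'' (there (there (here refl))) e∈D)
                (subst (λ z → e ∈ proj₁ z × e ∈ proj₂ z) eq (∈D⇒∈₁ x (target h) e∈D , ∈D⇒∈₂ y (source h) e∈D))
              where
              al : Allowed x' y' (GapIn ((x , y) ∷ K)) up'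
              al = corner-allowed (source h') (target h') (less≼ h') r<' s<' gap₀
              b'' : Built (up' ∷ τ) ((x' , up') ∷ (up' , y') ∷ (x , y) ∷ K)
              b'' = insert b p' (proj₁ al) (proj₁ (proj₂ al)) (proj₁ (proj₂ (proj₂ al)))
            only : ∀ ρ → A ρ ≢ + 0 → ρ ≡ up ⊎ ρ ≡ up'
            only ρ nz = [ (λ al → first (proj₁ (corner₁₁ (source h) (target h) (less≼ h) r≤ s≤ al)))
                        , (λ al → second (proj₁ (corner₁₁ (source h') (target h') (less≼ h') (ℕₚ.≤-reflexive ra) (ℕₚ.≤-reflexive sb) al))) ]′ (dichotomy ρ nz)
              where
              first : ρ ≡ up ⊎ (ρ ≡ (proj₁ x , proj₂ y) × (∀ e → e ∉ D x y)) → ρ ≡ up ⊎ ρ ≡ up'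
              first (inj₁ eq)       = inj₁ eq
              first (inj₂ (_ , none)) = contradiction e∈D (none e)
              second : ρ ≡ up' ⊎ (ρ ≡ (proj₁ x' , proj₂ y') × (∀ e → e ∉ D x' y')) → ρ ≡ up ⊎ ρ ≡ up'
              second (inj₁ eq)       = inj₂ eq
              second (inj₂ (_ , none)) = contradiction e'∈D (none e')
          corners : Goal
          corners with Sₚ.nonempty? (D x' y')
          ... | yes g  = gapped g
          ... | no ¬g  = gapless (λ e e∈ → ¬g (e , e∈))
        cases : (∃ λ a → ∃ λ b → r (proj₁ y') ≡ a + r (proj₁ x') × s (proj₂ x') ≡ b + s (proj₂ y') × size x' y' ≡ a + b) → Goal
        cases (a , b , ra , sb , ab) = go a b ra sb (trans (sym ab) sz')
          where
          go : ∀ a b → r (proj₁ y') ≡ a + r (proj₁ x') → s (proj₂ x') ≡ b + s (proj₂ y') → a + b ≡ 2 → Goal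
          go 0 2 ra sb eq = let F≡ = flat-rk-≡ M (flatM (source h')) (≼₁ (less≼ h')) (ℕₚ.≤-reflexive ra)
                                (on , spE , spB) = pure-case (inj₁ F≡)
                            in two-N p' sb (ℕₚ.≤-trans (ℕₚ.≤-reflexive ra) (ℕₚ.n≤1+n _)) (inj₂ (F≡ , gap₀)) on spE spB
          go 2 0 ra sb eq = let G≡ = sym (flat-rk-≡ N (flatN (target h')) (≼₂ (less≼ h')) (ℕₚ.≤-reflexive sb))
                                (on , spE , spB) = pure-case (inj₂ G≡)
                            in two-M p' ra (ℕₚ.≤-trans (ℕₚ.≤-reflexive sb) (ℕₚ.n≤1+n _)) (inj₂ (G≡ , gap₀)) on spE spB
          go 1 1 ra sb eq = corners ra sb
          go 0 0 ra sb ()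
          go 0 1 ra sb ()
          go 0 (suc (suc (suc b))) ra sb ()
          go 1 0 ra sb ()
          go 1 (suc (suc b)) ra sb ()
          go 2 (suc b) ra sb ()
          go (suc (suc (suc a))) b ra sb ()

      one-bigger : ∀ {K} → All IsStep K → sizes K ≡ suc (length K) →
        ∃ λ st → ∃ λ K' → K ↭ st ∷ K' × size (proj₁ st) (proj₂ st) ≡ 2 × All Small K'
      one-bigger {st ∷ K} (h ∷ hs) eq with size (proj₁ st) (proj₂ st) ℕₚ.≟ 1
      ... | no ne  = st , K , ↭-refl , two , sizes-tight 0 hs (ℕₚ.+-cancelˡ-≤ 2 _ _ (ℕₚ.≤-reflexive (trans (cong (_+ sizes K) (sym two)) eq)))
        where
        two : size (proj₁ st) (proj₂ st) ≡ 2
        two = ℕₚ.≤-antisym (All.head (sizes-tight 1 (h ∷ hs) (ℕₚ.≤-reflexive eq)))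
          (ℕₚ.≤∧≢⇒< (≺⇒1≤size (source h) (target h) (less h)) (ne ∘ sym))
      ... | yes e1 with one-bigger hs (ℕₚ.suc-injective (trans (cong (_+ sizes K) (sym e1)) eq))
      ... | st' , K' , p , sz , sm = st' , st ∷ K' , ↭-trans (prep st p) (swap st st' ↭-refl) , sz , ℕₚ.≤-reflexive e1 ∷ sm

    -- In codimension one the total size exceeds the number of steps by two. A step with a gap has
    -- size at least 2, so it has size 3 or shares the surplus with exactly one other step of size
    -- 2.
    top-balanced : IsBiflag M τ → Goal
    top-balanced bf = start (gap-step b (proj₂ (biflag-gap bf)))
      where
      start : ∀ {e} → (∃ λ st → st L∈.∈ L × e ∈ D (proj₁ st) (proj₂ st)) → Goal
      start {e} ((x , y) , st∈ , e∈D) = split (extract st∈)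
        where
        split : (∃ λ K → L ↭ (x , y) ∷ K) → Goal
        split (K , p) = go (size x y) refl (D⇒2≤size (source h) (target h) (less≼ h) e∈D) (All.head (↭ₚ.All-resp-↭ p (sizes-tight 2 steps total≤)))
          where
          h : IsStep (x , y)
          h = All.lookup steps st∈
          hs : All IsStep K
          hs = All.tail (↭ₚ.All-resp-↭ p steps)
          total : sizes L ≡ 2 + length L
          total = trans (built-sizes b) (trans m≡2+n (cong (λ z → 2 + z) (trans (sym len) (sym (built-length b)))))
          total≤ : sizes L ≤ 2 + length L
          total≤ = ℕₚ.≤-reflexive total
          total' : size x y + sizes K ≡ 3 + length K
          total' = trans (sym (∑ℕ-↭ _ p)) (trans total (cong (λ z → 2 + z) (↭ₚ.↭-length p)))
          go : ∀ z → size x y ≡ z → 2 ≤ z → z ≤ 3 → Goal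
          go 2 eq _ _ = second (one-bigger hs (ℕₚ.+-cancelˡ-≡ 2 _ _ (trans (cong (_+ sizes K) (sym eq)) total')))
            where
            second : (∃ λ st → ∃ λ K' → K ↭ st ∷ K' × size (proj₁ st) (proj₂ st) ≡ 2 × All Small K') → Goal
            second (st' , K' , p' , sz , small) = two-blocks (↭-trans p (prep (x , y) p')) e∈D eq sz small
          go 3 eq _ _ = one-block p e∈D eq (sizes-tight 0 hs (ℕₚ.+-cancelˡ-≤ 3 _ _ (ℕₚ.≤-reflexive (trans (cong (_+ sizes K) (sym eq)) total'))))
          go 0 eq () _
          go 1 eq (s≤s ()) _
          go (suc (suc (suc (suc z)))) eq _ (s≤s (s≤s (s≤s ())))

-- Iterated cap products of the constant weight

module Existence {m n : ℕ} (m≡2+n : m ≡ suc (suc n)) (M : Matroid m) (M-⊥ : Flat M ⊥) (N-⊥ : CoFlat M ⊥) (j : Fin m) where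

  open Claims m≡2+n M M-⊥ N-⊥ j
  open TopBalanced m≡2+n M M-⊥ N-⊥ j using (top-balanced)

  private
    AP : List (BF m)
    AP = allPairs m

  -- A weight is a function on lists whereas a cone is a set; exchanging the order of two insertions
  -- in the balancing argument needs this invariance.
  Symmetric : Weight m → Set
  Symmetric c = ∀ {τ τ'} → τ ↭ τ' → c τ ≡ c τ'

  ray-sum : (BF m → Subset m) → Weight m → List (BF m) → Fin m → ℤ
  ray-sum p c τ i = ∑ AP (λ ρ → c (ρ ∷ τ) *ℤ ind (p ρ) i)

  Balanced : ℕ → Weight m → Set
  Balanced q c = ∀ τ → IsBiflag M τ → length τ ≡ q →
    Span τ (ray-sum proj₁ c τ) (ray-sum proj₂ c τ)

  biflag-tail : ∀ {ρ τ} → IsBiflag M (ρ ∷ τ) → IsBiflag M τ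
  biflag-tail {ρ} {τ} bf@(_ ∷ hs , _ ∷ as , _) = hs , as , ∉⇒≢⊤ (gap⁻ τ (All.tail (proj₂ (biflag-gap bf))))

  Apart-sym : ∀ {x y : BF m} → Apart x y → Apart y x
  Apart-sym (ne , inj₁ c) = ne ∘ sym , inj₂ c
  Apart-sym (ne , inj₂ c) = ne ∘ sym , inj₁ c

  biflag-↭ : ∀ {τ τ'} → τ ↭ τ' → IsBiflag M τ → IsBiflag M τ'
  biflag-↭ {τ} {τ'} p bf = ↭ₚ.All-resp-↭ p (proj₁ bf) , AllPairs-↭ Apart-sym p (proj₁ (proj₂ bf))
    , ∉⇒≢⊤ (gap⁻ τ' (↭ₚ.All-resp-↭ p (proj₂ (biflag-gap bf))))

  BiflagOf : ℕ → List (BF m) → Set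
  BiflagOf q τ = IsBiflag M τ × length τ ≡ q

  biflagOf? : ∀ q τ → Dec (BiflagOf q τ)
  biflagOf? q τ = biflag? M τ ×-dec (length τ ℕₚ.≟ q)

  biflagOf-↭ : ∀ {q τ τ'} → τ ↭ τ' → BiflagOf q τ → BiflagOf q τ'
  biflagOf-↭ p (bf , len) = biflag-↭ p bf , trans (sym (↭ₚ.↭-length p)) len

  restrict : ℕ → Weight m → Weight m
  restrict q f τ = if does (biflagOf? q τ) then f τ else + 0

  restrict-in : ∀ {q} f {τ} → BiflagOf q τ → restrict q f τ ≡ f τ
  restrict-in {q} f {τ} h rewrite dec-true (biflagOf? q τ) h = refl

  restrict-out : ∀ {q} f {τ} → ¬ BiflagOf q τ → restrict q f τ ≡ + 0
  restrict-out {q} f {τ} h rewrite dec-false (biflagOf? q τ) h = refl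

  restrict-sym : ∀ {q} f → (∀ {τ τ'} → BiflagOf q τ → τ ↭ τ' → f τ ≡ f τ') → Symmetric (restrict q f)
  restrict-sym {q} f h {τ} {τ'} p = go (biflagOf? q τ)
    where
    go : Dec (BiflagOf q τ) → restrict q f τ ≡ restrict q f τ'
    go (yes b) = trans (restrict-in f b) (trans (h b p) (sym (restrict-in f (biflagOf-↭ p b))))
    go (no ¬b) = trans (restrict-out f ¬b) (sym (restrict-out f (λ b → ¬b (biflagOf-↭ (↭-sym p) b))))

  top-weight : Weight m
  top-weight = restrict n (λ _ → + 1)

  top-isTop : IsTop M (suc n) top-weight
  top-isTop τ = restrict-in _ , restrict-out _

  top-weight-balanced : ∀ {q} → suc q ≡ n → Balanced q top-weight
  top-weight-balanced eq τ bf len = top-balanced top-isTop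
    (proj₂ (biflag⇒built (proj₁ bf) (proj₁ (proj₂ bf)))) (trans (cong suc len) eq) bf

  -- The value `j` only fills the case of a full union, which flags of biflats exclude.
  gap-choice : List (BF m) → Fin m
  gap-choice τ with Finₚ.any? (λ e → ¬? (e Sₚ.∈? unionFG τ))
  ... | yes (e , _) = e
  ... | no _        = j

  gap-choice-gap : ∀ {τ} → IsBiflag M τ → Gap (gap-choice τ) τ
  gap-choice-gap {τ} bf with Finₚ.any? (λ e → ¬? (e Sₚ.∈? unionFG τ))
  ... | yes (e , e∉) = gap⁺ τ e∉
  ... | no none      = contradiction (∉-witness (proj₂ (proj₂ bf))) none

  δ-sum : Weight m → Fin m → List (BF m) → ℤ
  δ-sum c e τ = ∑ AP (λ ρ → c (ρ ∷ τ) *ℤ δray e ρ)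

  gap-sum : Weight m → Weight m
  gap-sum c τ = δ-sum c (gap-choice τ) τ

  -- The gap formula is taken as the definition; balancing then provides the coefficients that the
  -- cap condition for `δray j` asks for.
  δ-cap : ℕ → Weight m → Weight m
  δ-cap q c = restrict q (gap-sum c)

  module _ {d q : ℕ} {c : Weight m} (supp : Supported d c) (bal : Balanced q c) where

    private
      head-biflat : ∀ {τ} ρ → c (ρ ∷ τ) ≢ + 0 → Biflat M ρ
      head-biflat ρ nz = All.head (proj₁ (proj₁ (supp _ nz)))

      lookup-biflat : ∀ {τ} → IsBiflag M τ → ∀ t → Biflat M (List.lookup τ t)
      lookup-biflat bf t = All.lookup (proj₁ bf) (L∈ₚ.∈-lookup t)

      coeff-sum : ∀ {τ} (bf : IsBiflag M τ) → length τ ≡ q → Fin m → ℤ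
      coeff-sum {τ} bf len e = ∑ (allFin (length τ)) (λ t → coeff τ (bal τ bf len) t *ℤ δray e (List.lookup τ t))

      independent : ∀ {τ} (bf : IsBiflag M τ) (len : length τ ≡ q) e e' →
        δ-sum c e τ -ℤ coeff-sum bf len e ≡ δ-sum c e' τ -ℤ coeff-sum bf len e'
      independent {τ} bf len = δ-independent M AP (λ ρ → c (ρ ∷ τ)) (allFin (length τ)) (coeff τ sp) (List.lookup τ)
        head-biflat (lookup-biflat bf) (λ₁-of τ sp) (λ₂-of τ sp) (span-eq₁ τ sp) (span-eq₂ τ sp)
        where sp = bal τ bf len

      gap-zero : ∀ {e} τ (a : Fin (length τ) → ℤ) → IsBiflag M τ → Gap e τ →
        ∑ (allFin (length τ)) (λ t → a t *ℤ δray e (List.lookup τ t)) ≡ + 0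
      gap-zero τ a bf gap = ∑-zero (allFin (length τ)) (λ t →
        trans (cong (a t *ℤ_) (δray-out M (lookup-biflat bf t) (All.lookup gap (L∈ₚ.∈-lookup t)))) (ℤₚ.*-zeroʳ (a t)))

    δ-cap-value : ∀ {τ} (bf : IsBiflag M τ) (len : length τ ≡ q) e → δ-cap q c τ ≡ δ-sum c e τ -ℤ coeff-sum bf len e
    δ-cap-value {τ} bf len e = begin
      δ-cap q c τ
        ≡⟨ restrict-in (gap-sum c) (bf , len) ⟩
      δ-sum c g τ
        ≡⟨ ℤₚ.+-identityʳ _ ⟨
      δ-sum c g τ -ℤ + 0
        ≡⟨ cong (λ z → δ-sum c g τ -ℤ z) (gap-zero τ (coeff τ (bal τ bf len)) bf (gap-choice-gap bf)) ⟨
      δ-sum c g τ -ℤ coeff-sum bf len g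
        ≡⟨ independent bf len g e ⟩
      δ-sum c e τ -ℤ coeff-sum bf len e ∎
      where
      open ≡-Reasoning
      g : Fin m
      g = gap-choice τ

    δ-cap-gap : ∀ {τ e} → BiflagOf q τ → Gap e τ → δ-cap q c τ ≡ δ-sum c e τ
    δ-cap-gap {τ} {e} (bf , len) gap = trans (δ-cap-value bf len e)
      (trans (cong (λ z → δ-sum c e τ -ℤ z) (gap-zero τ (coeff τ (bal τ bf len)) bf gap)) (ℤₚ.+-identityʳ _))

    δ-cap-isCap : IsCap M (δray j) (suc q) c (δ-cap q c)
    δ-cap-isCap τ = (λ (bf , len) → let sp = bal τ bf len in
      coeff τ sp , λ₁-of τ sp , λ₂-of τ sp , span-eq₁ τ sp , span-eq₂ τ sp , δ-cap-value bf len j) ,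
      restrict-out (gap-sum c)

    δ-cap-supported : Supported q (δ-cap q c)
    δ-cap-supported τ nz = decidable-stable (biflagOf? q τ) (λ h → nz (restrict-out (gap-sum c) h))

    module _ (symm : Symmetric c) where

      δ-cap-symmetric : Symmetric (δ-cap q c)
      δ-cap-symmetric {τ} {τ'} p = go (biflagOf? q τ)
        where
        go : Dec (BiflagOf q τ) → δ-cap q c τ ≡ δ-cap q c τ'
        go (no ¬b) = trans (restrict-out (gap-sum c) ¬b) (sym (restrict-out (gap-sum c) (λ b → ¬b (biflagOf-↭ (↭-sym p) b))))
        go (yes b) = begin
          δ-cap q c τ         ≡⟨ δ-cap-gap b (proj₂ gap) ⟩
          δ-sum c (proj₁ gap) τ  ≡⟨ ∑-cong AP (λ ρ → cong (_*ℤ δray (proj₁ gap) ρ) (symm (prep ρ p))) ⟩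
          δ-sum c (proj₁ gap) τ' ≡⟨ δ-cap-gap (biflagOf-↭ p b) (↭ₚ.All-resp-↭ p (proj₂ gap)) ⟨
          δ-cap q c τ'        ∎
          where
          open ≡-Reasoning
          gap : ∃ λ e → Gap e τ
          gap = biflag-gap (proj₁ b)

      -- Expand each value of δ ∩ c with one e in the gap of κ: exchanging the two sums leaves, for every
      -- ρ′ containing e, the relation of c at ρ′κ with its ρ′-term removed.
      δ-cap-balanced : ∀ {q'} → q ≡ suc q' → Balanced q' (δ-cap q c)
      δ-cap-balanced {q'} eq κ bfκ lenκ = span-cong κ (total proj₁) (total proj₂)
          (span-∑ κ AP (λ ρ → span-* κ (δray e ρ) (proj₂ (proj₂ (expand ρ)))))
        where
        gap : ∃ λ e → Gap e κ
        gap = biflag-gap bfκ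
        e : Fin m
        e = proj₁ gap
        c' : Weight m
        c' = δ-cap q c
        Expansion : BF m → Set
        Expansion ρ = Σ ℤ λ α → (c' (ρ ∷ κ) ≡ δ-sum c e (ρ ∷ κ) -ℤ α *ℤ δray e ρ) ×
          Span κ (λ i → ray-sum proj₁ c (ρ ∷ κ) i -ℤ α *ℤ ind (proj₁ ρ) i)
                 (λ i → ray-sum proj₂ c (ρ ∷ κ) i -ℤ α *ℤ ind (proj₂ ρ) i)
        expand′ : ∀ ρ → Dec (IsBiflag M (ρ ∷ κ)) → Expansion ρ
        expand′ ρ (yes bf) = proj₁ sp ,
            trans (δ-cap-value bf len e) (cong (λ z → δ-sum c e (ρ ∷ κ) -ℤ z) (trans (∑-allFin-suc (length κ) f)
              (trans (cong (λ z → f zero +ℤ z) (gap-zero κ (a ∘ suc) bfκ (proj₂ gap))) (ℤₚ.+-identityʳ (f zero))))) ,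
            proj₂ sp
          where
          len : length (ρ ∷ κ) ≡ q
          len = trans (cong suc lenκ) (sym eq)
          sp = bal (ρ ∷ κ) bf len
          a f : Fin (suc (length κ)) → ℤ
          a = coeff (ρ ∷ κ) {ray-sum proj₁ c (ρ ∷ κ)} {ray-sum proj₂ c (ρ ∷ κ)} sp
          f t = a t *ℤ δray e (List.lookup (ρ ∷ κ) t)
        -- If `ρ ∷ κ` is not a flag, `c` vanishes on all its extensions, so every term is zero and
        -- the coefficient 0 works.
        expand′ ρ (no ¬bf) = + 0 ,
            trans (restrict-out {q} (gap-sum c) (λ b → ¬bf (proj₁ b))) (sym (trans (ℤₚ.+-identityʳ (δ-sum c e (ρ ∷ κ))) (vanish (δray e)))) ,
            span-cong κ (λ i → sym (trans (ℤₚ.+-identityʳ _) (vanish (λ σ → ind (proj₁ σ) i))))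
                        (λ i → sym (trans (ℤₚ.+-identityʳ _) (vanish (λ σ → ind (proj₂ σ) i)))) (span-const κ (+ 0) (+ 0))
          where
          vanish : ∀ (g : BF m → ℤ) → ∑ AP (λ σ → c (σ ∷ ρ ∷ κ) *ℤ g σ) ≡ + 0
          vanish g = ∑-zero AP (λ σ → cong (_*ℤ g σ) (decidable-stable (c (σ ∷ ρ ∷ κ) ℤₚ.≟ + 0)
            (λ nz → ¬bf (biflag-tail (proj₁ (supp _ nz))))))
        expand : ∀ ρ → Expansion ρ
        expand ρ = expand′ ρ (biflag? M (ρ ∷ κ))
        α : BF m → ℤ
        α ρ = proj₁ (expand ρ)
        total : ∀ (p : BF m → Subset m) i →
          ∑ AP (λ ρ → δray e ρ *ℤ (∑ AP (λ σ → c (σ ∷ ρ ∷ κ) *ℤ ind (p σ) i) -ℤ α ρ *ℤ ind (p ρ) i)) ≡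
          ∑ AP (λ ρ → c' (ρ ∷ κ) *ℤ ind (p ρ) i)
        total p i = begin
          ∑ AP (λ ρ → δray e ρ *ℤ (∑ AP (λ σ → c (σ ∷ ρ ∷ κ) *ℤ u σ) -ℤ α ρ *ℤ u ρ))
            ≡⟨ ∑-cong AP (λ ρ → trans (l₁ (δray e ρ) (∑ AP (λ σ → c (σ ∷ ρ ∷ κ) *ℤ u σ)) (α ρ) (u ρ))
                 (cong (_-ℤ α ρ *ℤ δray e ρ *ℤ u ρ) (sym (∑-*ˡ AP (δray e ρ) (λ σ → c (σ ∷ ρ ∷ κ) *ℤ u σ))))) ⟩
          ∑ AP (λ ρ → ∑ AP (λ σ → δray e ρ *ℤ (c (σ ∷ ρ ∷ κ) *ℤ u σ)) -ℤ α ρ *ℤ δray e ρ *ℤ u ρ)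
            ≡⟨ ∑-- AP _ _ ⟩
          ∑ AP (λ ρ → ∑ AP (λ σ → δray e ρ *ℤ (c (σ ∷ ρ ∷ κ) *ℤ u σ))) -ℤ rest
            ≡⟨ cong (_-ℤ rest) (∑-swap AP AP (λ ρ σ → δray e ρ *ℤ (c (σ ∷ ρ ∷ κ) *ℤ u σ))) ⟩
          ∑ AP (λ σ → ∑ AP (λ ρ → δray e ρ *ℤ (c (σ ∷ ρ ∷ κ) *ℤ u σ))) -ℤ rest
            ≡⟨ cong (_-ℤ rest) (∑-cong AP (λ σ → trans (∑-cong AP (λ ρ →
                 trans (cong (λ z → δray e ρ *ℤ (z *ℤ u σ)) (symm (swap σ ρ ↭-refl))) (l₂ (δray e ρ) (c (ρ ∷ σ ∷ κ)) (u σ))))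
                 (∑-*ˡ AP (u σ) (λ ρ → c (ρ ∷ σ ∷ κ) *ℤ δray e ρ)))) ⟩
          ∑ AP (λ σ → u σ *ℤ δ-sum c e (σ ∷ κ)) -ℤ rest
            ≡⟨ ∑-- AP _ _ ⟨
          ∑ AP (λ σ → u σ *ℤ δ-sum c e (σ ∷ κ) -ℤ α σ *ℤ δray e σ *ℤ u σ)
            ≡⟨ ∑-cong AP (λ σ → trans (l₃ (u σ) (δ-sum c e (σ ∷ κ)) (α σ *ℤ δray e σ)) (cong (_*ℤ u σ) (sym (proj₁ (proj₂ (expand σ)))))) ⟩
          ∑ AP (λ σ → c' (σ ∷ κ) *ℤ u σ) ∎
          where
          open ≡-Reasoning
          u : BF m → ℤ
          u σ = ind (p σ) i
          rest : ℤ
          rest = ∑ AP (λ ρ → α ρ *ℤ δray e ρ *ℤ u ρ)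
          l₁ : ∀ d s a u → d *ℤ (s -ℤ a *ℤ u) ≡ d *ℤ s -ℤ a *ℤ d *ℤ u
          l₁ = ℤRing.solve-∀
          l₂ : ∀ d c u → d *ℤ (c *ℤ u) ≡ u *ℤ (c *ℤ d)
          l₂ = ℤRing.solve-∀
          l₃ : ∀ u s b → u *ℤ s -ℤ b *ℤ u ≡ (s -ℤ b) *ℤ u
          l₃ = ℤRing.solve-∀

  -- Capping once more needs support and balancing, and preserving the balancing needs symmetry, so
  -- all are carried along. Balancing is demanded in positive dimension only, where codimension-one
  -- cones exist.
  record Iterate (p q : ℕ) : Set where
    field
      weight    : Weight m
      powCap    : PowCap M (δray j) p n top-weight weight
      symmetric : Symmetric weight
      supported : Supported q weight
      balanced  : ∀ {q'} → q ≡ suc q' → Balanced q' weight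

  open Iterate

  iterate : ∀ p q → q + p ≡ n → Iterate p q
  iterate zero q eq = record
    { weight    = top-weight
    ; powCap    = λ _ → refl
    ; symmetric = restrict-sym (λ _ → + 1) (λ _ _ → refl)
    ; supported = λ τ nz → decidable-stable (biflagOf? q τ) (λ h → nz (restrict-out _ (λ (bf , len) → h (bf , trans len (sym q≡n)))))
    ; balanced  = λ eq' → top-weight-balanced (trans (sym eq') q≡n)
    }
    where
    q≡n : q ≡ n
    q≡n = trans (sym (ℕₚ.+-identityʳ q)) eq
  iterate (suc p) q eq = record
    { weight    = δ-cap q c
    ; powCap    = c , powCap prev , subst (λ d → IsCap M (δray j) d c (δ-cap q c)) (sym dim) (δ-cap-isCap (supported prev) (balanced prev refl))
    ; symmetric = δ-cap-symmetric (supported prev) (balanced prev refl) (symmetric prev)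
    ; supported = δ-cap-supported (supported prev) (balanced prev refl)
    ; balanced  = δ-cap-balanced (supported prev) (balanced prev refl) (symmetric prev)
    }
    where
    eq' : suc q + p ≡ n
    eq' = trans (sym (ℕₚ.+-suc q p)) eq
    prev : Iterate p (suc q)
    prev = iterate p (suc q) eq'
    c : Weight m
    c = weight prev
    dim : n ∸ p ≡ suc q
    dim = trans (cong (_∸ p) (sym eq')) (ℕₚ.m+n∸n≡m (suc q) p)

flat-⊥ : ∀ {m} (K : Matroid m) → (∀ i → ¬ (rk K ⁅ i ⁆ ≡ 0)) → Flat K ⊥
flat-⊥ K h i _ = ℕₚ.≤-trans (ℕₚ.≤-trans (s≤s (ℕₚ.≤-reflexive (rk-⊥ K))) (ℕₚ.n≢0⇒n>0 (h i)))
  (ℕₚ.≤-reflexive (cong (rk K) (sym (Sₚ.∪-identityˡ ⁅ i ⁆))))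

theorem1p1 : (n r : ℕ) (M : Matroid (suc n)) → 1 ≤ n →
    rk M ⊤ ≡ suc r → Loopless M → Coloopless M →
    (j : Fin (suc n)) (k : ℕ) → k ≤ r →
    (Σ (Weight (suc n)) λ c₀ → Σ (Weight (suc n)) λ c →
    IsTop M n c₀ × PowCap M (δray j) (n ∸ k ∸ 1) (n ∸ 1) c₀ c) ×
    ((c₀ c : Weight (suc n)) → IsTop M n c₀ →
    PowCap M (δray j) (n ∸ k ∸ 1) (n ∸ 1) c₀ c →
    (𝓕 : List (Subset (suc n))) → IsFlagOfFlats M 𝓕 → length 𝓕 ≡ k →
    csm M r k 𝓕 ≡ sgn (r ∸ k) *ℤ pushforward c 𝓕)
theorem1p1 (suc n) r M _ rk⊤ loopless coloopless j k k≤r =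
  (top-weight , Iterate.weight it , top-isTop , Iterate.powCap it) ,
  λ c₀ c isTop pc 𝓕 flag len → cong (sgn (r ∸ k) *ℤ_)
    (sym (pushforward≡prodBeta (suc n ∸ k ∸ 1) isTop pc 𝓕 flag (trans (cong (_+ (suc n ∸ k ∸ 1)) len) k+p)))
  where
  M-⊥ : Flat M ⊥
  M-⊥ = flat-⊥ M loopless
  N-⊥ : CoFlat M ⊥
  N-⊥ = flat-⊥ (dualMatroid M) coloopless
  open Existence {n = n} refl M M-⊥ N-⊥ j
  open Pushforward {n = n} refl M M-⊥ N-⊥ j using (pushforward≡prodBeta)
  -- The absence of coloops gives the dual rank at least 1, and the two ranks add up to |E|.
  r≤n : r ≤ n
  r≤n = lin≤ 0 (ℕₚ.+-mono-≤ (ℕₚ.≤-trans (ℕₚ.n≢0⇒n>0 (coloopless j)) (rk-mono (dualMatroid M) {⁅ j ⁆} {⊤} (λ _ → Sₚ.∈⊤)))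
      (ℕₚ.≤-reflexive (trans (cong (λ z → dualRk M ⊤ + z) (sym rk⊤)) (rk-⊤+rk-⊤ {M = M} {dualMatroid M} (dualMatroid-isDual M)))))
    (lem r (dualRk M ⊤) n)
    where
    lem : ∀ r s n → r + (s + suc (suc n)) ≡ n + (1 + (s + suc r))
    lem = ℕRing.solve-∀
  k≤n : k ≤ n
  k≤n = ℕₚ.≤-trans k≤r r≤n
  p≡ : suc n ∸ k ∸ 1 ≡ n ∸ k
  p≡ = cong (_∸ 1) (ℕₚ.+-∸-assoc 1 k≤n)
  -- Since k ≤ n the truncated subtractions are exact: the caps lower the dimension of the conormal
  -- fan to k.
  k+p : k + (suc n ∸ k ∸ 1) ≡ n
  k+p = trans (cong (λ z → k + z) p≡) (ℕₚ.m+[n∸m]≡n k≤n)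
  it : Iterate (suc n ∸ k ∸ 1) k
  it = iterate (suc n ∸ k ∸ 1) k k+p
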